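{- Let $G$ be a connected graph that is $2$-cell embedded in a surface $\mathbb{M}\in\{\mathbb{S}_p,\mathbb{N}_q\}$, and let $\chi=\chi(\mathbb{M})$. Suppose that $V_s(G)\neq\emptyset$ for some integer $s\geq 4$ and that \[ -14\chi < (s-4)\,\beta_0(\langle V_s,G\rangle) + 2(s-5)|G| + 4|V_{\leq 2}| + 2\sum_{j=3}^{s-1}(5-j)|V_j| . \] Then $b(G)\leq B'(G)\leq 2s-2$.
   Context: Graphs are finite, without loops or multiple edges. $\mathbb{S}_h$ ($h\ge0$) is the orientable surface of genus $h$ (sphere with $h$ handles), $\mathbb{N}_q$ ($q\ge1$) the non-orientable surface of genus $q$ (sphere with $q$ crosscaps); $\chi(\mathbb{S}_h)=2-2h$, $\chi(\mathbb{N}_q)=2-q$. An embedding is $2$-cell if every face is homeomorphic to an open disc. $|G|=|V(G)|$, $\|G\|=|E(G)|$, $d_G(x)$ is the degree, $N_G(x)$ the neighbourhood, $d_G(x,y)$ the distance. $V_r=V_r(G)=\{x: d_G(x)=r\}$, $V_{\leq r}=V_{\le r}(G)=\{x: d_G(x)\le r\}$. $\langle A,G\rangle$ is the subgraph induced by $A$, and $\beta_0(H)$ is the independence number of $H$. The domination number $\gamma(G)$ is the minimum size of a dominating set; the bondage number $b(G)$ is the smallest number of edges whose removal from $G$ yields a graph with larger domination number. Define $b_1(G)=\min\{d_G(x)+d_G(y)-1 : x,y\in V(G),\ 1\le d_G(x,y)\le 2\}$, $b_3(G)=\min_{xy\in E(G)}\max\{d_G(x)+d_G(y)-1-|N_G(x)\cap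 N_G(y)|,\ d_G(x)+d_G(y)-3\}$, and $B'(G)=\min\{b_1(G),b_3(G)\}$. -}

module Defs where

open import Data.Bool using (Bool; true; false; _∧_; _∨_; not; if_then_else_)
open import Data.Nat using (ℕ; zero; suc; _+_; _*_; _∸_; _⊓_; _⊔_; _≤ᵇ_; _<ᵇ_; _≡ᵇ_)
open import Data.Fin using (Fin; toℕ)
open import Data.Fin.Subset using (Subset; ∣_∣)
open import Data.Vec using ([]; _∷_; lookup)
open import Data.List using (List; []; _∷_; [_]; map; _++_; length; filterᵇ; allFin; upTo; foldr; cartesianProduct; drop)
open import Data.Bool.ListAction using (all; any)
open import Data.Product using (_×_; _,_; ∃)
open import Data.Integer as ℤ using (ℤ; +_)
open import Function using (_∘_)
open import Relation.Binary.PropositionalEquality using (_≡_)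

Graph : ℕ → Set
Graph n = Fin n → Fin n → Bool

Simple : ∀ {n} → Graph n → Set
Simple G = (∀ x y → G x y ≡ G y x) × (∀ x → G x x ≡ false)

data Walk {n} (G : Graph n) : Fin n → Fin n → Set where
  here : ∀ {x} → Walk G x x
  step : ∀ {x y z} → G x y ≡ true → Walk G y z → Walk G x z

Connected : ∀ {n} → Graph n → Set
Connected {n} G = ∀ (x y : Fin n) → Walk G x y

_==_ : ∀ {n} → Fin n → Fin n → Bool
a == b = toℕ a ≡ᵇ toℕ b

deg : ∀ {n} → Graph n → Fin n → ℕ
deg {n} G x = length (filterᵇ (G x) (allFin n))

numDeg : ∀ {n} → Graph n → ℕ → ℕ
numDeg {n} G j = length (filterᵇ (λ x → deg G x ≡ᵇ j) (allFin n))

numDegLe : ∀ {n} → Graph n → ℕ → ℕ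
numDegLe {n} G r = length (filterᵇ (λ x → deg G x ≤ᵇ r) (allFin n))

commonNbrs : ∀ {n} → Graph n → Fin n → Fin n → ℕ
commonNbrs {n} G x y = length (filterᵇ (λ z → G x z ∧ G y z) (allFin n))

edgeList : ∀ {n} → Graph n → List (Fin n × Fin n)
edgeList {n} G = filterᵇ (λ { (x , y) → (toℕ x <ᵇ toℕ y) ∧ G x y })
                         (cartesianProduct (allFin n) (allFin n))

size : ∀ {n} → Graph n → ℕ
size G = length (edgeList G)

allSubsets : (n : ℕ) → List (Subset n)
allSubsets zero = [ [] ]
allSubsets (suc n) = map (true ∷_) (allSubsets n) ++ map (false ∷_) (allSubsets n)

dominatingᵇ : ∀ {n} → Graph n → Subset n → Bool
dominatingᵇ {n} G D =
  all (λ x → lookup D x ∨ any (λ y → lookup D y ∧ G x y) (allFin n)) (allFin n)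

-- γ(G) = minimum size of a dominating set (V(G) itself is dominating, so
-- the default value n is never smaller than the true minimum)
γ : ∀ {n} → Graph n → ℕ
γ {n} G = foldr _⊓_ n (map ∣_∣ (filterᵇ (dominatingᵇ G) (allSubsets n)))

independentᵇ : ∀ {n} → Graph n → Subset n → Bool
independentᵇ {n} G I =
  all (λ { (x , y) → not (lookup I x ∧ lookup I y ∧ G x y) })
      (cartesianProduct (allFin n) (allFin n))

-- β₀(⟨A,G⟩) for A = {x : P x}: maximum size of an independent set of G
-- contained in A (independence in the induced subgraph = independence in G)
β₀-induced : ∀ {n} → Graph n → (Fin n → Bool) → ℕ
β₀-induced {n} G P =
  foldr _⊔_ 0 (map ∣_∣ (filterᵇ (λ I → independentᵇ G I ∧
                                      all (λ x → not (lookup I x) ∨ P x) (allFin n))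
                                (allSubsets n)))

inV : ∀ {n} → Graph n → ℕ → Fin n → Bool
inV G s x = deg G x ≡ᵇ s

sublists : ∀ {A : Set} → List A → List (List A)
sublists [] = [ [] ]
sublists (a ∷ as) = map (a ∷_) (sublists as) ++ sublists as

removeEdges : ∀ {n} → Graph n → List (Fin n × Fin n) → Graph n
removeEdges G F x y =
  G x y ∧ not (any (λ { (a , b) → (a == x ∧ b == y) ∨ (a == y ∧ b == x) }) F)

-- b(G): minimum |F| over sets F ⊆ E(G) with γ(G − F) > γ(G)
-- (default ‖G‖ only used if no such F exists, which cannot happen for a
--  connected graph with an edge)
bondage : ∀ {n} → Graph n → ℕ
bondage G =
  foldr _⊓_ (size G)
    (map length (filterᵇ (λ F → γ G <ᵇ γ (removeEdges G F)) (sublists (edgeList G))))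

dist12 : ∀ {n} → Graph n → Fin n → Fin n → Bool
dist12 {n} G x y = not (x == y) ∧ (G x y ∨ any (λ z → G x z ∧ G z y) (allFin n))

-- minima over finite lists are computed as foldr _⊓_ d with a default d
-- that is ≥ every list element (degrees are < n), so the value is the true
-- minimum whenever the list is nonempty (d is returned only for edgeless G).
b₁ : ∀ {n} → Graph n → ℕ
b₁ {n} G =
  foldr _⊓_ (2 * n) (map (λ { (x , y) → deg G x + deg G y ∸ 1 })
                   (filterᵇ (λ { (x , y) → dist12 G x y })
                            (cartesianProduct (allFin n) (allFin n))))

b₃ : ∀ {n} → Graph n → ℕ
b₃ {n} G =
  foldr _⊓_ (2 * n) (map (λ { (x , y) → (deg G x + deg G y ∸ 1 ∸ commonNbrs G x y)
                                   ⊔ (deg G x + deg G y ∸ 3) })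
                   (edgeList G))

B′ : ∀ {n} → Graph n → ℕ
B′ G = b₁ G ⊓ b₃ G

-- 2-cell embeddings, via generalized embedding schemes (rotation system +
-- edge signature), Mohar–Thomassen, Graphs on Surfaces, §3.3.

iter : ∀ {A : Set} → ℕ → (A → A) → A → A
iter zero f a = a
iter (suc k) f a = f (iter k f a)

record EmbeddingScheme {n} (G : Graph n) : Set where
  field
    rot : Fin n → Fin n → Fin n
    -- sig x y ≡ true  means edge xy has signature +1
    sig : Fin n → Fin n → Bool
    rot-closed : ∀ x y → G x y ≡ true → G x (rot x y) ≡ true
    rot-inj    : ∀ x y z → G x y ≡ true → G x z ≡ true → rot x y ≡ rot x z → y ≡ z
    rot-cyclic : ∀ x y z → G x y ≡ true → G x z ≡ true → ∃ λ k → iter k (rot x) y ≡ z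
    sig-sym    : ∀ x y → sig x y ≡ sig y x

module _ {n} {G : Graph n} (R : EmbeddingScheme G) where
  open EmbeddingScheme R

  rotInv : Fin n → Fin n → Fin n
  rotInv x = iter (deg G x ∸ 1) (rot x)

  -- face-tracing step on states (x , y , ε): traversing x→y with local sign ε
  faceStep : Fin n × Fin n × Bool → Fin n × Fin n × Bool
  faceStep (x , y , ε) =
    let ε′ = if sig x y then ε else not ε
    in (y , (if ε′ then rot y x else rotInv y x) , ε′)

  code : Fin n × Fin n × Bool → ℕ
  code (x , y , ε) = toℕ x * (2 * n) + toℕ y * 2 + (if ε then 1 else 0)

  isRep : Fin n × Fin n × Bool → Bool
  isRep t = all (λ k → code t ≤ᵇ code (iter k faceStep t)) (upTo (2 * n * n))

  allStates : List (Fin n × Fin n × Bool)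
  allStates = cartesianProduct (allFin n) (cartesianProduct (allFin n) (true ∷ false ∷ []))

  numOrbits : ℕ
  numOrbits = length (filterᵇ (λ { (x , y , ε) → G x y ∧ isRep (x , y , ε) }) allStates)

  -- every face is traced by exactly two orbits (one per direction)
  numFaces : ℕ
  numFaces = numOrbits Data.Nat./ 2

  eulerChar : ℤ
  eulerChar = + n ℤ.- + size G ℤ.+ + numFaces

sumℤ : List ℤ → ℤ
sumℤ = foldr ℤ._+_ (+ 0)

rhs : ∀ {n} → Graph n → ℕ → ℤ
rhs {n} G s =
  (+ s ℤ.- + 4) ℤ.* + β₀-induced G (inV G s)
  ℤ.+ + 2 ℤ.* (+ s ℤ.- + 5) ℤ.* + n
  ℤ.+ + 4 ℤ.* + numDegLe G 2
  ℤ.+ + 2 ℤ.* sumℤ (map (λ j → (+ 5 ℤ.- + j) ℤ.* + numDeg G j) (drop 3 (upTo s)))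

-- For the first inequality, let u and v be adjacent or have a common neighbour z.  Delete all edges at u, and the edges
-- from v that avoid N[u] (respectively avoid z).  A dominating set of what remains contains the isolated vertex u, and it
-- can be turned into a smaller dominating set of G.
--
-- For the second, suppose B′(G) ≥ 2s − 1.  Then vertices at distance at most two have degree sum at least 2s, and an edge
-- of degree sum 2s (or 2s + 1) lies in no triangle (in at most one).  Discharge 14 (|E| − |F| − |G|) minus the right-hand
-- side of the hypothesis over the vertices, faces sharing their contribution among the sides of their edges: vertices of
-- degree less than s are paid by their neighbours, which they have to themselves, and those of a maximum independent set I
-- of V_s by their neighbours of degree at least s + 1.  All charges end up nonnegative if s ≥ 5.  If s = 4, vertices of
-- degree five may be left negative; then Euler's inequality χ ≤ 2 for connected G, obtained from a spanning tree T by
-- merging all faces across the edges outside T, bounds the number of vertices, and only one configuration survives: three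
-- vertices of degree four with four common neighbours of degree six.  These would form a component of G, without vertices
-- of degree five.

module Submission where

open import Defs
open import Data.Bool using (Bool; true; false; _∧_; _∨_; not; if_then_else_; T?) renaming (T to IsTrue)
open import Data.Bool.ListAction using (all; any)
open import Data.Empty using (⊥; ⊥-elim)
open import Data.Fin using (Fin; zero; suc; toℕ)
open import Data.Fin.Properties using (toℕ-injective) renaming (_≟_ to _≟ᶠ_)
open import Data.List using (List; []; _∷_; _++_; map; length; filterᵇ; allFin; upTo; foldr; drop; cartesianProduct)
open import Data.List.Membership.Propositional using (_∈_)
open import Data.List.Membership.Propositional.Properties
  using (∈-∃++; ∈-++⁻; ∈-++⁺ˡ; ∈-++⁺ʳ; ∈-map⁺; ∈-map⁻; ∈-allFin; ∈-upTo⁺; ∈-applyUpTo⁺; ∈-applyUpTo⁻; ∈-cartesianProduct⁺)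
open import Data.List.Properties using (length-map; length-upTo; length-tabulate)
open import Data.List.Relation.Unary.All as All using (All; []; _∷_)
open import Data.List.Relation.Unary.AllPairs using ([]; _∷_)
open import Data.List.Relation.Unary.Any using (here; there; index)
open import Data.List.Relation.Unary.Any.Properties using (lookup-index)
open import Data.List.Relation.Unary.Unique.Propositional using (Unique)
open import Data.List.Relation.Unary.Unique.Propositional.Properties using (allFin⁺; cartesianProduct⁺; ++⁺; applyUpTo⁺₁; filter⁺)
open import Data.Nat using (ℕ; zero; suc; z≤n; s≤s)
open import Data.Product using (_×_; _,_; ∃; ∃₂; proj₁; proj₂)
open import Data.Sum using (_⊎_; inj₁; inj₂)
open import Function using (_∘_)
open import Relation.Binary.Definitions using (tri<; tri≈; tri>)
open import Relation.Binary.PropositionalEquality hiding ([_]; J)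
open import Relation.Nullary using (¬_; Dec; yes; no; does)

-- The constants balance exactly. Everything is multiplied by 12: a vertex of degree at least `s`
-- outside I then pays 24s + 48, a vertex of I pays 36s, and an edge brings each of its ends at
-- least 28. From degree s + 2 on, gifts to I cost at most 4 per edge on average, and the remaining
-- 24(s + 2) is just what is paid. At degree s + 1 the balance 28(s + 1) - (24s + 48) = 4s - 20 is
-- negative only for s = 4, which is why that case stands apart. There a deficit is at most 4, while
-- the total charge is at most -24, since half the gap in the hypothesis is an integer. So at least
-- six vertices are in deficit. But χ ≤ 2 leaves room for at most 13 vertices that neither have
-- degree below 4 nor are adjacent to such a vertex, and a vertex of degree four with its
-- neighbours, none of them in deficit, occupies five of these places. Boundary walks of faces may
-- repeat vertices and edges. A face is therefore never measured by its length, but by a selection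
-- of distinct states on its orbit with weight at least 12.

module Sums where
  import Data.Nat as ℕ
  import Data.Nat.Properties as ℕ
  open import Data.Integer hiding (suc)
  open import Data.Integer.Properties
  open import Data.Integer.Tactic.RingSolver using (solve-∀)

  -- Linear inequalities: the difference of the two sides is identified, by the ring solver, with a combination e of
  -- known nonnegative quantities ⌞ h ⌟, assembled with ⊕ and ⊗.
  by : ∀ {a b e} → 0ℤ ≤ e → b - a ≡ e → a ≤ b
  by p q = 0≤i-j⇒j≤i (subst (0ℤ ≤_) (sym q) p)

  ⌞_⌟ : ∀ {a b} → a ≤ b → 0ℤ ≤ b - a
  ⌞ p ⌟ = i≤j⇒0≤j-i p

  infixl 6 _⊕_
  infixl 7 _⊗_

  _⊕_ : ∀ {a b} → 0ℤ ≤ a → 0ℤ ≤ b → 0ℤ ≤ a + b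
  p ⊕ q = +-mono-≤ p q

  _⊗_ : ∀ {a b} → 0ℤ ≤ a → 0ℤ ≤ b → 0ℤ ≤ a * b
  _⊗_ {+ a} {+ b} _ _ = subst (0ℤ ≤_) (pos-* a b) (+≤+ ℕ.z≤n)

  0≤+ : ∀ {k} → 0ℤ ≤ + k
  0≤+ = +≤+ ℕ.z≤n

  # : ∀ k → 0ℤ ≤ + k
  # k = 0≤+

  -- Indicators, finite integer sums and counting by injections

  𝟙 : Bool → ℤ
  𝟙 true = 1ℤ
  𝟙 false = 0ℤ

  𝟙≥0 : ∀ b → 0ℤ ≤ 𝟙 b
  𝟙≥0 true = 0≤+
  𝟙≥0 false = 0≤+

  𝟙≤1 : ∀ b → 𝟙 b ≤ 1ℤ
  𝟙≤1 true = ≤-refl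
  𝟙≤1 false = 0≤+

  𝟙-mono : ∀ a b → (a ≡ true → b ≡ true) → 𝟙 a ≤ 𝟙 b
  𝟙-mono false b h = 𝟙≥0 b
  𝟙-mono true b h = ≤-reflexive (cong 𝟙 (sym (h refl)))

  𝟙-∧ : ∀ a b → 𝟙 (a ∧ b) ≡ 𝟙 a * 𝟙 b
  𝟙-∧ true b = sym (*-identityˡ (𝟙 b))
  𝟙-∧ false b = refl

  ∑ : ∀ {A : Set} → List A → (A → ℤ) → ℤ
  ∑ [] f = 0ℤ
  ∑ (x ∷ xs) f = f x + ∑ xs f

  true≢false : ∀ {b} → b ≡ true → b ≡ false → ⊥
  true≢false refl ()

  Bool-cases : ∀ b → b ≡ true ⊎ b ≡ false
  Bool-cases true = inj₁ refl
  Bool-cases false = inj₂ refl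

  ∧-true : ∀ {a b} → a ∧ b ≡ true → a ≡ true × b ≡ true
  ∧-true {true} {true} h = refl , refl

  ∧-intro : ∀ {a b} → a ≡ true → b ≡ true → a ∧ b ≡ true
  ∧-intro refl refl = refl

  not-true : ∀ {a} → not a ≡ true → a ≡ false
  not-true {false} h = refl

  ¬true⇒false : ∀ {a} → (a ≡ true → ⊥) → a ≡ false
  ¬true⇒false {true} h = ⊥-elim (h refl)
  ¬true⇒false {false} h = refl

  ∈-filterᵇ⁺ : ∀ {A : Set} {p : A → Bool} {x xs} → x ∈ xs → p x ≡ true → x ∈ filterᵇ p xs
  ∈-filterᵇ⁺ {p = p} {x} {y ∷ ys} (here refl) h with p x
  ∈-filterᵇ⁺ {p = p} {x} {y ∷ ys} (here refl) h | true = here refl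
  ∈-filterᵇ⁺ {p = p} {x} {y ∷ ys} (there m) h with p y
  ... | true = there (∈-filterᵇ⁺ m h)
  ... | false = ∈-filterᵇ⁺ m h

  ∈-filterᵇ⁻ : ∀ {A : Set} {p : A → Bool} {x} xs → x ∈ filterᵇ p xs → x ∈ xs × p x ≡ true
  ∈-filterᵇ⁻ {p = p} (y ∷ ys) m with p y in eq
  ∈-filterᵇ⁻ {p = p} (y ∷ ys) (here refl) | true = here refl , eq
  ∈-filterᵇ⁻ {p = p} (y ∷ ys) (there m) | true = let a , b = ∈-filterᵇ⁻ ys m in there a , b
  ∈-filterᵇ⁻ {p = p} (y ∷ ys) m | false = let a , b = ∈-filterᵇ⁻ ys m in there a , b

  module _ {A : Set} where

    ∑-cong : ∀ (xs : List A) {f g : A → ℤ} → (∀ {x} → x ∈ xs → f x ≡ g x) → ∑ xs f ≡ ∑ xs g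
    ∑-cong [] h = refl
    ∑-cong (x ∷ xs) h = cong₂ _+_ (h (here refl)) (∑-cong xs (h ∘ there))

    ∑-mono : ∀ (xs : List A) {f g : A → ℤ} → (∀ {x} → x ∈ xs → f x ≤ g x) → ∑ xs f ≤ ∑ xs g
    ∑-mono [] h = ≤-refl
    ∑-mono (x ∷ xs) h = +-mono-≤ (h (here refl)) (∑-mono xs (h ∘ there))

    ∑-nonneg : ∀ (xs : List A) {f : A → ℤ} → (∀ {x} → x ∈ xs → 0ℤ ≤ f x) → 0ℤ ≤ ∑ xs f
    ∑-nonneg [] h = ≤-refl
    ∑-nonneg (x ∷ xs) h = h (here refl) ⊕ ∑-nonneg xs (h ∘ there)

    ∑-+ : ∀ (xs : List A) (f g : A → ℤ) → ∑ xs (λ x → f x + g x) ≡ ∑ xs f + ∑ xs g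
    ∑-+ [] f g = refl
    ∑-+ (x ∷ xs) f g = trans (cong (_+_ (f x + g x)) (∑-+ xs f g)) (lem (f x) (g x) _ _)
      where
      lem : ∀ a b c d → (a + b) + (c + d) ≡ (a + c) + (b + d)
      lem = solve-∀

    ∑-*ˡ : ∀ (xs : List A) (k : ℤ) (f : A → ℤ) → ∑ xs (λ x → k * f x) ≡ k * ∑ xs f
    ∑-*ˡ [] k f = sym (*-zeroʳ k)
    ∑-*ˡ (x ∷ xs) k f = trans (cong (_+_ (k * f x)) (∑-*ˡ xs k f)) (sym (*-distribˡ-+ k (f x) (∑ xs f)))

    ∑-- : ∀ (xs : List A) (f g : A → ℤ) → ∑ xs (λ x → f x - g x) ≡ ∑ xs f - ∑ xs g
    ∑-- [] f g = refl
    ∑-- (x ∷ xs) f g = trans (cong (_+_ (f x - g x)) (∑-- xs f g)) (lem (f x) (g x) _ _)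
      where
      lem : ∀ a b c d → (a - b) + (c - d) ≡ (a + c) - (b + d)
      lem = solve-∀

    ∑-const : ∀ (xs : List A) (k : ℤ) → ∑ xs (λ _ → k) ≡ k * + length xs
    ∑-const [] k = sym (*-zeroʳ k)
    ∑-const (x ∷ xs) k = trans (cong (_+_ k) (∑-const xs k)) (lem k (+ length xs))
      where
      lem : ∀ k l → k + k * l ≡ k * (1ℤ + l)
      lem = solve-∀

    ∑-1 : ∀ (xs : List A) → ∑ xs (λ _ → 1ℤ) ≡ + length xs
    ∑-1 xs = trans (∑-const xs 1ℤ) (*-identityˡ _)

    ∑-0 : ∀ (xs : List A) → ∑ xs (λ _ → 0ℤ) ≡ 0ℤ
    ∑-0 xs = ∑-const xs 0ℤ

    ∑-++ : ∀ (xs ys : List A) f → ∑ (xs ++ ys) f ≡ ∑ xs f + ∑ ys f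
    ∑-++ [] ys f = sym (+-identityˡ _)
    ∑-++ (x ∷ xs) ys f = trans (cong (_+_ (f x)) (∑-++ xs ys f)) (sym (+-assoc (f x) _ _))

    ∑-filter : ∀ (p : A → Bool) xs f → ∑ (filterᵇ p xs) f ≡ ∑ xs (λ x → 𝟙 (p x) * f x)
    ∑-filter p [] f = refl
    ∑-filter p (x ∷ xs) f with p x
    ... | true = cong₂ _+_ (sym (*-identityˡ (f x))) (∑-filter p xs f)
    ... | false = trans (∑-filter p xs f) (sym (+-identityˡ _))

    length-filter≡∑ : ∀ (p : A → Bool) xs → + length (filterᵇ p xs) ≡ ∑ xs (λ x → 𝟙 (p x))
    length-filter≡∑ p xs = trans (sym (∑-1 (filterᵇ p xs)))
      (trans (∑-filter p xs _) (∑-cong xs (λ {x} _ → *-identityʳ (𝟙 (p x)))))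

    ∑-≥-member : ∀ {xs : List A} {x} {f : A → ℤ} → x ∈ xs → (∀ {y} → y ∈ xs → 0ℤ ≤ f y) → f x ≤ ∑ xs f
    ∑-≥-member {x ∷ xs} {f = f} (here refl) h =
      subst (_≤ ∑ (x ∷ xs) f) (+-identityʳ (f x)) (+-monoʳ-≤ (f x) (∑-nonneg xs (h ∘ there)))
    ∑-≥-member {y ∷ xs} {x} {f} (there m) h =
      subst (_≤ ∑ (y ∷ xs) f) (+-identityˡ (f x)) (+-mono-≤ (h (here refl)) (∑-≥-member m (h ∘ there)))

    -- Each entry of `xs` is located in `ys` and cut out there. Repetitions in `ys` do no harm
    -- because `f` is nonnegative.
    ∑-sublist : ∀ {xs ys : List A} {f : A → ℤ} → Unique xs → (∀ {x} → x ∈ xs → x ∈ ys) →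
      (∀ {y} → y ∈ ys → 0ℤ ≤ f y) → ∑ xs f ≤ ∑ ys f
    ∑-sublist {[]} {ys} [] h w = ∑-nonneg ys w
    ∑-sublist {x ∷ xs} {ys} {f} (x∉ ∷ u) h w with ∈-∃++ (h (here refl))
    ... | as , bs , refl = subst₂ _≤_ refl eq (+-monoʳ-≤ (f x) (∑-sublist u sub (w ∘ mem)))
      where
      eq : f x + ∑ (as ++ bs) f ≡ ∑ (as ++ x ∷ bs) f
      eq = trans (cong (_+_ (f x)) (∑-++ as bs f))
        (trans (lem (f x) (∑ as f) (∑ bs f)) (sym (∑-++ as (x ∷ bs) f)))
        where
        lem : ∀ a b c → a + (b + c) ≡ b + (a + c)
        lem = solve-∀
      mem : ∀ {y} → y ∈ as ++ bs → y ∈ as ++ x ∷ bs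
      mem m with ∈-++⁻ as m
      ... | inj₁ p = ∈-++⁺ˡ p
      ... | inj₂ p = ∈-++⁺ʳ as (there p)
      sub : ∀ {y} → y ∈ xs → y ∈ as ++ bs
      sub m with ∈-++⁻ as (h (there m))
      ... | inj₁ p = ∈-++⁺ˡ p
      ... | inj₂ (here refl) = ⊥-elim (All.lookup x∉ m refl)
      ... | inj₂ (there p) = ∈-++⁺ʳ as p

    length-sublist : ∀ {xs ys : List A} → Unique xs → (∀ {x} → x ∈ xs → x ∈ ys) → length xs ℕ.≤ length ys
    length-sublist {xs} {ys} u h = drop‿+≤+ (subst₂ _≤_ (∑-1 xs) (∑-1 ys) (∑-sublist u h (λ _ → 0≤+)))

    ∑-pos-member : ∀ (xs : List A) (p : A → Bool) → 1ℤ ≤ ∑ xs (λ x → 𝟙 (p x)) → ∃ λ x → x ∈ xs × p x ≡ true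
    ∑-pos-member [] p (+≤+ ())
    ∑-pos-member (x ∷ xs) p h with p x in eq
    ... | true = x , here refl , eq
    ... | false = let y , m , q = ∑-pos-member xs p (subst (1ℤ ≤_) (+-identityˡ _) h) in y , there m , q

    -- The differences `1ℤ - f y` are nonnegative and their sum is at most 0, so each of them
    -- vanishes.
    ∑-full : ∀ (xs : List A) (f : A → ℤ) → (∀ {x} → x ∈ xs → f x ≤ 1ℤ) → + length xs ≤ ∑ xs f →
      ∀ {x} → x ∈ xs → 1ℤ ≤ f x
    ∑-full xs f h l {x} m = by {e = ∑ xs f - + length xs + (∑ xs (λ y → 1ℤ - f y) - (1ℤ - f x))}
        (⌞ l ⌟ ⊕ ⌞ ∑-≥-member m (λ k → ⌞ h k ⌟) ⌟)
        (trans (lem (f x) (∑ xs f) (+ length xs)) (cong (λ z → ∑ xs f - + length xs + (z - (1ℤ - f x))) (sym eq)))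
      where
      eq : ∑ xs (λ y → 1ℤ - f y) ≡ + length xs - ∑ xs f
      eq = trans (∑-- xs _ f) (cong (_- ∑ xs f) (∑-1 xs))
      lem : ∀ a s l → a - 1ℤ ≡ s - l + (l - s - (1ℤ - a))
      lem = solve-∀

    ∑-map : ∀ {B : Set} (g : B → A) xs f → ∑ (map g xs) f ≡ ∑ xs (f ∘ g)
    ∑-map g [] f = refl
    ∑-map g (x ∷ xs) f = cong (_+_ (f (g x))) (∑-map g xs f)

  ∑-× : ∀ {A B : Set} (xs : List A) (ys : List B) f →
    ∑ (cartesianProduct xs ys) f ≡ ∑ xs (λ x → ∑ ys (λ y → f (x , y)))
  ∑-× [] ys f = refl
  ∑-× (x ∷ xs) ys f = trans (∑-++ (map (x ,_) ys) _ f) (cong₂ _+_ (∑-map (x ,_) ys f) (∑-× xs ys f))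

  ∑-comm : ∀ {A B : Set} (xs : List A) (ys : List B) (f : A → B → ℤ) →
    ∑ xs (λ x → ∑ ys (f x)) ≡ ∑ ys (λ y → ∑ xs (λ x → f x y))
  ∑-comm [] ys f = sym (∑-0 ys)
  ∑-comm (x ∷ xs) ys f = trans (cong (_+_ (∑ ys (f x))) (∑-comm xs ys f)) (sym (∑-+ ys (f x) (λ y → ∑ xs (λ x → f x y))))

  Unique-map : ∀ {A B : Set} (h : A → B) {xs : List A} → Unique xs →
    (∀ {x y} → x ∈ xs → y ∈ xs → h x ≡ h y → x ≡ y) → Unique (map h xs)
  Unique-map h {[]} [] inj = []
  Unique-map h {x ∷ xs} (x∉ ∷ u) inj = fresh xs there x∉ ∷ Unique-map h u (λ p q → inj (there p) (there q))
    where
    fresh : ∀ ys → (∀ {y} → y ∈ ys → y ∈ x ∷ xs) → All (x ≢_) ys → All (h x ≢_) (map h ys)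
    fresh [] s [] = []
    fresh (y ∷ ys) s (n ∷ ns) = (λ e → n (inj (here refl) (s (here refl)) e)) ∷ fresh ys (s ∘ there) ns

  Unique-filterᵇ : ∀ {A : Set} (p : A → Bool) {xs : List A} → Unique xs → Unique (filterᵇ p xs)
  Unique-filterᵇ p u = filter⁺ (T? ∘ p) u

  ∑-inj : ∀ {A B : Set} {xs : List A} {ys : List B} (p : A → Bool) (q : B → Bool) (h : A → B) → Unique xs →
    (∀ {x} → x ∈ xs → p x ≡ true → h x ∈ ys × q (h x) ≡ true) →
    (∀ {x y} → x ∈ xs → y ∈ xs → p x ≡ true → p y ≡ true → h x ≡ h y → x ≡ y) →
    ∑ xs (𝟙 ∘ p) ≤ ∑ ys (𝟙 ∘ q)
  ∑-inj {xs = xs} {ys} p q h u into inj =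
    subst₂ _≤_ (length-filter≡∑ p xs) (length-filter≡∑ q ys) (+≤+ (ℕ.≤-trans (ℕ.≤-reflexive (sym (length-map h (filterᵇ p xs))))
      (length-sublist (Unique-map h (Unique-filterᵇ p u) inj′) sub)))
    where
    inj′ : ∀ {x y} → x ∈ filterᵇ p xs → y ∈ filterᵇ p xs → h x ≡ h y → x ≡ y
    inj′ a b = let a₁ , a₂ = ∈-filterᵇ⁻ xs a ; b₁ , b₂ = ∈-filterᵇ⁻ xs b in inj a₁ b₁ a₂ b₂
    sub : ∀ {y} → y ∈ map h (filterᵇ p xs) → y ∈ filterᵇ q ys
    sub m with ∈-map⁻ h m
    ... | z , i , refl = let a , b = ∈-filterᵇ⁻ xs i ; c , d = into a b in ∈-filterᵇ⁺ c d

  module _ {A : Set} where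

    ∑-≤1 : ∀ {xs : List A} (p : A → Bool) → Unique xs →
      (∀ {x y} → x ∈ xs → y ∈ xs → p x ≡ true → p y ≡ true → x ≡ y) → ∑ xs (𝟙 ∘ p) ≤ 1ℤ
    ∑-≤1 p u h = ∑-inj {ys = 0ℤ ∷ []} p (λ _ → true) (λ _ → 0ℤ) u (λ _ _ → here refl , refl) (λ a b c d _ → h a b c d)

    ∑-not : ∀ (xs : List A) (p : A → Bool) → ∑ xs (𝟙 ∘ p) + ∑ xs (λ x → 𝟙 (not (p x))) ≡ + length xs
    ∑-not xs p = trans (sym (∑-+ xs (𝟙 ∘ p) (λ x → 𝟙 (not (p x))))) (trans (∑-cong xs (λ {x} _ → flip (p x))) (∑-1 xs))
      where
      flip : ∀ b → 𝟙 b + 𝟙 (not b) ≡ 1ℤ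
      flip true = refl
      flip false = refl

open Sums

-- Rotations, face tracing and triangular faces

module Embeddings where
  open import Data.Nat hiding (ℕ; zero; suc; z≤n; s≤s)
  open import Data.Nat.Properties
  open import Data.Nat.DivMod using (_%_; _/_; m≡m%n+[m/n]*n; m%n<n)
  open import Data.Bool.Properties using (not-involutive) renaming (_≟_ to _≟ᵇ_)
  open import Data.Fin.Properties using (toℕ<n; pigeonhole)
  open import Data.List using (lookup)
  open import Data.Product.Properties using () renaming (≡-dec to ×-≡-dec)

  iter-+ : ∀ {A : Set} (f : A → A) i j a → iter (i + j) f a ≡ iter i f (iter j f a)
  iter-+ f zero j a = refl
  iter-+ f (suc i) j a = cong f (iter-+ f i j a)

  iter-* : ∀ {A : Set} (f : A → A) p a → iter p f a ≡ a → ∀ k → iter (k * p) f a ≡ a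
  iter-* f p a h zero = refl
  iter-* f p a h (suc k) = trans (iter-+ f p (k * p) a) (trans (cong (iter p f) (iter-* f p a h k)) h)

  iter-% : ∀ {A : Set} (f : A → A) p .{{_ : NonZero p}} a → iter p f a ≡ a → ∀ k → iter k f a ≡ iter (k % p) f a
  iter-% f p a h k = trans (cong (λ m → iter m f a) (m≡m%n+[m/n]*n k p))
    (trans (iter-+ f (k % p) (k / p * p) a) (cong (iter (k % p) f) (iter-* f p a h (k / p))))

  iter-P : ∀ {A : Set} {f : A → A} (P : A → Set) → (∀ {a} → P a → P (f a)) → ∀ {a} → P a → ∀ k → P (iter k f a)
  iter-P P c p zero = p
  iter-P P c p (suc k) = c (iter-P P c p k)

  module _ {A : Set} (f : A → A) (P : A → Set) (closed : ∀ {a} → P a → P (f a))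
    (inj : ∀ {a b} → P a → P b → f a ≡ f b → a ≡ b) where

    iter-inj : ∀ {a b} k → P a → P b → iter k f a ≡ iter k f b → a ≡ b
    iter-inj zero pa pb e = e
    iter-inj (suc k) pa pb e = iter-inj k pa pb (inj (iter-P P closed pa k) (iter-P P closed pb k) e)

    -- Two of the first N + 1 iterates coincide by the pigeonhole principle, and injectivity cancels
    -- the smaller exponent.
    period : ∀ {N} (c : ∀ a → P a → Fin N) → (∀ {a b} pa pb → c a pa ≡ c b pb → a ≡ b) →
      ∀ {a} → P a → ∃ λ p → 1 ≤ p × p ≤ N × iter p f a ≡ a
    period {N} c c-inj {a} pa with pigeonhole (n<1+n N) (λ i → c (iter (toℕ i) f a) (iter-P P closed pa (toℕ i)))
    ... | i , j , i<j , e = p , m<n⇒0<n∸m i<j , ≤-trans (m∸n≤m (toℕ j) (toℕ i)) (≤-pred (toℕ<n j)) ,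
        sym (iter-inj (toℕ i) pa (iter-P P closed pa p)
          (trans (c-inj _ _ e) (trans (cong (λ m → iter m f a) (sym (m+[n∸m]≡n (<⇒≤ i<j)))) (iter-+ f (toℕ i) p a))))
      where p = toℕ j ∸ toℕ i

  foldr-⊓-≤-base : ∀ d xs → foldr _⊓_ d xs ≤ d
  foldr-⊓-≤-base d [] = ≤-refl
  foldr-⊓-≤-base d (x ∷ xs) = ≤-trans (m⊓n≤n x _) (foldr-⊓-≤-base d xs)

  foldr-⊓-≤ : ∀ {d x} {xs : List ℕ} → x ∈ xs → foldr _⊓_ d xs ≤ x
  foldr-⊓-≤ (here refl) = m⊓n≤m _ _
  foldr-⊓-≤ {xs = y ∷ _} (there m) = ≤-trans (m⊓n≤n y _) (foldr-⊓-≤ m)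

  foldr-⊓-sel : ∀ d xs → foldr _⊓_ d xs ≡ d ⊎ foldr _⊓_ d xs ∈ xs
  foldr-⊓-sel d [] = inj₁ refl
  foldr-⊓-sel d (x ∷ xs) with ⊓-sel x (foldr _⊓_ d xs)
  ... | inj₁ e = inj₂ (here e)
  ... | inj₂ e with foldr-⊓-sel d xs
  ...   | inj₁ h = inj₁ (trans e h)
  ...   | inj₂ h = inj₂ (subst (_∈ x ∷ xs) (sym e) (there h))

  ≡ᵇ-true : ∀ m n → (m ≡ᵇ n) ≡ true → m ≡ n
  ≡ᵇ-true zero zero h = refl
  ≡ᵇ-true (suc m) (suc n) h = cong suc (≡ᵇ-true m n h)

  ≡ᵇ-refl : ∀ m → (m ≡ᵇ m) ≡ true
  ≡ᵇ-refl zero = refl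
  ≡ᵇ-refl (suc m) = ≡ᵇ-refl m

  ==-true : ∀ {n} {x y : Fin n} → (x == y) ≡ true → x ≡ y
  ==-true h = toℕ-injective (≡ᵇ-true _ _ h)

  ==-refl : ∀ {n} (x : Fin n) → (x == x) ≡ true
  ==-refl x = ≡ᵇ-refl (toℕ x)

  ==-false : ∀ {n} {x y : Fin n} → x ≢ y → (x == y) ≡ false
  ==-false h = ¬true⇒false (h ∘ ==-true)

  module Graphs {n} (G : Graph n) (simple : Simple G) where

    V : List (Fin n)
    V = allFin n

    Nb : Fin n → List (Fin n)
    Nb x = filterᵇ (G x) V

    sym-G : ∀ {x y} → G x y ≡ true → G y x ≡ true
    sym-G {x} {y} h = trans (sym (proj₁ simple x y)) h

    irr-G : ∀ {x} → G x x ≡ true → ⊥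
    irr-G {x} h = true≢false h (proj₂ simple x)

    G-≢ : ∀ {x y} → G x y ≡ true → x ≢ y
    G-≢ h refl = irr-G h

    ∈-Nb⁺ : ∀ {x y} → G x y ≡ true → y ∈ Nb x
    ∈-Nb⁺ h = ∈-filterᵇ⁺ (∈-allFin _) h

    ∈-Nb⁻ : ∀ {x y} → y ∈ Nb x → G x y ≡ true
    ∈-Nb⁻ m = proj₂ (∈-filterᵇ⁻ V m)

    Unique-V : Unique V
    Unique-V = allFin⁺ n

    Unique-Nb : ∀ x → Unique (Nb x)
    Unique-Nb x = Unique-filterᵇ (G x) Unique-V

  module Embedding {n} (G : Graph n) (simple : Simple G) (R : EmbeddingScheme G) where
    open Graphs G simple public
    open EmbeddingScheme R public

    rot-P : ∀ {x} {y} → G x y ≡ true → G x (rot x y) ≡ true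
    rot-P {x} {y} = rot-closed x y

    nbr-index : ∀ {x} a → G x a ≡ true → Fin (deg G x)
    nbr-index a h = index (∈-Nb⁺ h)

    nbr-index-inj : ∀ {x} {a b} (p : G x a ≡ true) (q : G x b ≡ true) → nbr-index a p ≡ nbr-index b q → a ≡ b
    nbr-index-inj {x} p q e = trans (lookup-index (∈-Nb⁺ p)) (trans (cong (lookup (Nb x)) e) (sym (lookup-index (∈-Nb⁺ q))))

    deg≤period : ∀ {x y p} → G x y ≡ true → 1 ≤ p → iter p (rot x) y ≡ y → deg G x ≤ p
    deg≤period {x} {y} {p@(suc _)} h _ e = ≤-trans
      (length-sublist (Unique-Nb x) cover) (≤-reflexive (trans (length-map _ (upTo p)) (length-upTo p)))
      where
      cover : ∀ {z} → z ∈ Nb x → z ∈ map (λ k → iter k (rot x) y) (upTo p)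
      cover {z} m with rot-cyclic x y z h (∈-Nb⁻ m)
      ... | k , refl = subst (_∈ _) (sym (iter-% (rot x) p y e k)) (∈-map⁺ (λ k → iter k (rot x) y) (∈-upTo⁺ (m%n<n k p)))

    -- Pigeonhole on the neighbours gives some period of at most the degree, and cyclicity forbids a
    -- shorter one. Hence `rotInv`, a power of `rot` with exponent degree - 1, really inverts it.
    rot-period : ∀ {x y} → G x y ≡ true → iter (deg G x) (rot x) y ≡ y
    rot-period {x} {y} h with period (rot x) (λ z → G x z ≡ true) rot-P (λ {a} {b} → rot-inj x a b) nbr-index nbr-index-inj h
    ... | p , 1≤p , p≤d , e = subst (λ m → iter m (rot x) y ≡ y) (≤-antisym p≤d (deg≤period h 1≤p e)) e

    deg≥1 : ∀ {x y} → G x y ≡ true → 1 ≤ deg G x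
    deg≥1 {x} {y} h with deg G x | nbr-index y h
    ... | suc _ | _ = s≤s z≤n

    -- The rotation at a vertex as read with local orientation `b`; the two orientations give
    -- mutually inverse rotations.
    rotS : Fin n → Bool → Fin n → Fin n
    rotS x b y = if b then rot x y else rotInv R x y

    rotS-closed : ∀ {x y} b → G x y ≡ true → G x (rotS x b y) ≡ true
    rotS-closed true h = rot-P h
    rotS-closed {x} false h = iter-P (λ z → G x z ≡ true) rot-P h (deg G x ∸ 1)

    rotS-inv : ∀ {x y} b → G x y ≡ true → rotS x (not b) (rotS x b y) ≡ y
    rotS-inv {x} {y} true h = trans (sym (iter-+ (rot x) (deg G x ∸ 1) 1 y))
      (trans (cong (λ m → iter m (rot x) y) (m∸n+n≡m (deg≥1 h))) (rot-period h))
    rotS-inv {x} {y} false h =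
      trans (cong (λ m → iter m (rot x) y) (m+[n∸m]≡n (deg≥1 h))) (rot-period h)

    rotS-inv′ : ∀ {x y} b → G x y ≡ true → rotS x b (rotS x (not b) y) ≡ y
    rotS-inv′ {x} {y} b h = subst (λ c → rotS x c (rotS x (not b) y) ≡ y) (not-involutive b) (rotS-inv (not b) h)

    rotS-inj : ∀ {x y z} b → G x y ≡ true → G x z ≡ true → rotS x b y ≡ rotS x b z → y ≡ z
    rotS-inj {x} b h k e = trans (sym (rotS-inv b h)) (trans (cong (rotS x (not b)) e) (rotS-inv b k))

    rotS-fix⇒ : ∀ {x y} b → G x y ≡ true → rotS x b y ≡ y → deg G x ≤ 1
    rotS-fix⇒ true h e = deg≤period {p = 1} h (s≤s z≤n) e
    rotS-fix⇒ {x} {y} false h e = deg≤period {p = 1} h (s≤s z≤n) (trans (cong (rot x) (sym e)) (rotS-inv false h))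

    rotS-2⇒ : ∀ {x y} b → G x y ≡ true → rotS x b (rotS x b y) ≡ y → deg G x ≤ 2
    rotS-2⇒ true h e = deg≤period {p = 2} h (s≤s z≤n) e
    rotS-2⇒ {x} {y} false h e = deg≤period {p = 2} h (s≤s z≤n) (trans (cong (rot x ∘ rot x) (sym e))
      (trans (cong (rot x) (rotS-inv false (rotS-closed false h))) (rotS-inv false h)))

    rotS-sides⇒ : ∀ {x y} b → G x y ≡ true → rotS x b y ≡ rotS x (not b) y → deg G x ≤ 2
    rotS-sides⇒ {x} {y} b h e = rotS-2⇒ b h (trans (cong (rotS x b) e) (rotS-inv′ b h))

    State : Set
    State = Fin n × Fin n × Bool

    tail head : State → Fin n
    tail (x , y , ε) = x
    head (x , y , ε) = y

    Valid : State → Set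
    Valid t = G (tail t) (head t) ≡ true

    sgn : Fin n → Fin n → Bool → Bool
    sgn x y ε = if sig x y then ε else not ε

    sgn-not : ∀ x y ε → sgn x y (not ε) ≡ not (sgn x y ε)
    sgn-not x y ε with sig x y
    ... | true = refl
    ... | false = refl

    sgn-inv : ∀ x y ε → sgn y x (sgn x y ε) ≡ ε
    sgn-inv x y ε rewrite sig-sym y x with sig x y
    ... | true = refl
    ... | false = not-involutive ε

    f : State → State
    f = faceStep R

    -- The same side of the same edge, traversed backwards.
    ρ : State → State
    ρ (x , y , ε) = y , x , not (sgn x y ε)

    f-valid : ∀ {t} → Valid t → Valid (f t)
    f-valid {x , y , ε} h = rotS-closed (sgn x y ε) (sym-G h)

    f^-valid : ∀ {t} k → Valid t → Valid (iter k f t)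
    f^-valid k h = iter-P Valid f-valid h k

    f-inj : ∀ {t u} → Valid t → Valid u → f t ≡ f u → t ≡ u
    f-inj {x , y , ε} {x₂ , y₂ , ε₂} h k e with cong proj₁ e
    ... | refl with cong (proj₂ ∘ proj₂) e | cong (proj₁ ∘ proj₂) e
    ...   | es | er with rotS-inj (sgn x y ε) (sym-G h) (sym-G k) (trans er (cong (λ b → rotS y b x₂) (sym es)))
    ...     | refl = cong (λ b → x , y , b) (trans (sym (sgn-inv x y ε)) (trans (cong (sgn y x) es) (sgn-inv x y ε₂)))

    -- Reversal conjugates `f` to its inverse, so `ρ` sends an orbit to the opposite traversal of
    -- the same face.
    f-ρ-f : ∀ {t} → Valid t → f (ρ (f t)) ≡ ρ t
    f-ρ-f {x , y , ε} h = cong (y ,_) (cong₂ _,_ (trans (cong (λ b → rotS y b w) s≡) (rotS-inv ε′ (sym-G h))) s≡)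
      where
      ε′ = sgn x y ε
      w = rotS y ε′ x
      s≡ : sgn w y (not (sgn y w ε′)) ≡ not ε′
      s≡ = trans (sgn-not w y _) (cong not (sgn-inv y w ε′))

    ρ-ρ : ∀ t → ρ (ρ t) ≡ t
    ρ-ρ (x , y , ε) = cong (λ b → x , y , b)
      (trans (cong not (sgn-not y x _)) (trans (not-involutive _) (sgn-inv x y ε)))

    _≟ˢ_ : (t u : State) → Dec (t ≡ u)
    _≟ˢ_ = ×-≡-dec _≟ᶠ_ (×-≡-dec _≟ᶠ_ _≟ᵇ_)

    -- On valid states period one is excluded by the absence of loops, so this says that the orbit
    -- bounds a triangle.
    tri : State → Bool
    tri t = does (f (f (f t)) ≟ˢ t)

    tri⁻ : ∀ {t} → tri t ≡ true → f (f (f t)) ≡ t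
    tri⁻ {t} h with f (f (f t)) ≟ˢ t
    ... | yes e = e
    tri⁻ {t} () | no _

    tri⁺ : ∀ {t} → f (f (f t)) ≡ t → tri t ≡ true
    tri⁺ {t} h with f (f (f t)) ≟ˢ t
    ... | yes e = refl
    ... | no n = ⊥-elim (n h)

    tri-f : ∀ {t} → tri t ≡ true → tri (f t) ≡ true
    tri-f h = tri⁺ (cong f (tri⁻ h))

    tri-ρ : ∀ {t} → Valid t → tri t ≡ true → tri (ρ t) ≡ true
    tri-ρ {t} v h = tri⁺ (trans (cong (f ∘ f ∘ f ∘ ρ) (sym (tri⁻ h)))
      (trans (cong (f ∘ f) (f-ρ-f (f-valid (f-valid v)))) (trans (cong f (f-ρ-f (f-valid v))) (f-ρ-f v))))

    -- (x , z , δ) and (x , rotS x (not δ) z , not δ) leave x along the two sides of one corner, hence along the same face.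
    tri-corner : ∀ {x z δ} → G x z ≡ true → tri (x , z , δ) ≡ true → tri (x , rotS x (not δ) z , not δ) ≡ true
    tri-corner {x} {z} {δ} v h = subst (λ b → tri (x , rotS x b z , b) ≡ true)
      (trans (sgn-not z x _) (cong not (sgn-inv x z δ))) (tri-f (tri-ρ v h))

    -- The third step arrives at `x` from the third vertex and turns to `y`; hence the third vertex
    -- precedes `y` in the rotation at `x`.
    tri-adj : ∀ {x y ε} → G x y ≡ true → tri (x , y , ε) ≡ true → G y (rotS x (not ε) y) ≡ true
    tri-adj {x} {y} {ε} v h = trans (cong (G y) (sym z≡)) (f-valid v)
      where
      t = (x , y , ε)
      z = head (f t)
      e = tri⁻ h
      w≡x : head (f (f t)) ≡ x
      w≡x = cong tail e
      vz : G x z ≡ true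
      vz = trans (cong (λ w → G w z) (sym w≡x)) (sym-G (f-valid (f-valid {t} v)))
      z≡ : z ≡ rotS x (not ε) y
      z≡ = trans (sym (rotS-inv ε vz)) (cong (rotS x (not ε))
        (trans (cong₂ (λ a b → rotS a b z) (sym w≡x) (sym (cong (proj₂ ∘ proj₂) e))) (cong head e)))

open Embeddings

-- Orbits of face tracing and their count by weights

module FaceOrbits where
  open import Data.Nat hiding (ℕ; zero; suc; z≤n; s≤s)
  open import Data.Nat.Properties
  open import Data.Integer as ℤ using (ℤ)
  import Data.Integer.Properties as ℤ
  import Data.Integer.Tactic.RingSolver as ℤ
  open import Data.Nat.DivMod using (_%_; m%n<n)
  open import Data.Fin using (fromℕ<)
  open import Data.Fin.Properties using (toℕ-fromℕ<; toℕ<n)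

  all⁻ : ∀ {A : Set} {p : A → Bool} {xs x} → all p xs ≡ true → x ∈ xs → p x ≡ true
  all⁻ h (here refl) = proj₁ (∧-true h)
  all⁻ {xs = y ∷ _} h (there m) = all⁻ (proj₂ (∧-true h)) m

  ≤ᵇ-true : ∀ {m n} → (m ≤ᵇ n) ≡ true → m ≤ n
  ≤ᵇ-true {m} {n} h = ≤ᵇ⇒≤ m n (subst IsTrue (sym h) _)

  length-filter-cong : ∀ {A : Set} {p q : A → Bool} (xs : List A) → (∀ x → p x ≡ q x) →
    length (filterᵇ p xs) ≡ length (filterᵇ q xs)
  length-filter-cong [] h = refl
  length-filter-cong {p = p} {q} (x ∷ xs) h with p x | q x | h x
  ... | true | _ | refl = cong suc (length-filter-cong xs h)
  ... | false | _ | refl = length-filter-cong xs h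

  digits-< : ∀ {m a b c d} → b < m → a < c → a * m + b < c * m + d
  digits-< {m} {a} {b} {c} {d} b< a<c = begin-strict
    a * m + b <⟨ +-monoʳ-< (a * m) b< ⟩
    a * m + m ≡⟨ +-comm (a * m) m ⟩
    suc a * m ≤⟨ *-monoˡ-≤ m a<c ⟩
    c * m     ≤⟨ m≤m+n (c * m) d ⟩
    c * m + d ∎
    where open ≤-Reasoning

  digits : ∀ {m a b c d} → b < m → d < m → a * m + b ≡ c * m + d → a ≡ c × b ≡ d
  digits {m} {a} {b} {c} {d} b< d< e with <-cmp a c
  ... | tri< a<c _ _ = ⊥-elim (<-irrefl e (digits-< {d = d} b< a<c))
  ... | tri> _ _ c<a = ⊥-elim (<-irrefl (sym e) (digits-< {d = b} d< c<a))
  ... | tri≈ _ refl _ = refl , +-cancelˡ-≡ (a * m) b d e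

  module Orbits {n} (G : Graph n) (simple : Simple G) (R : EmbeddingScheme G) where
    open Embedding G simple R

    N² : ℕ
    N² = 2 * n * n

    bit : Bool → ℕ
    bit ε = if ε then 1 else 0

    bit<2 : ∀ ε → bit ε < 2
    bit<2 true = ≤-refl
    bit<2 false = s≤s z≤n

    bit-inj : ∀ {ε δ} → bit ε ≡ bit δ → ε ≡ δ
    bit-inj {true} {true} _ = refl
    bit-inj {false} {false} _ = refl

    low< : ∀ (y : Fin n) ε → toℕ y * 2 + bit ε < 2 * n
    low< y ε = ≤-trans (digits-< {d = 0} (bit<2 ε) (toℕ<n y)) (≤-reflexive (trans (+-identityʳ (n * 2)) (*-comm n 2)))

    code≡ : ∀ x y ε → code R (x , y , ε) ≡ toℕ x * (2 * n) + (toℕ y * 2 + bit ε)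
    code≡ x y ε = +-assoc (toℕ x * (2 * n)) (toℕ y * 2) (bit ε)

    code-inj : ∀ {t u} → code R t ≡ code R u → t ≡ u
    code-inj {x , y , ε} {x′ , y′ , ε′} e with digits {m = 2 * n} {a = toℕ x} {c = toℕ x′} (low< y ε) (low< y′ ε′) (trans (sym (code≡ x y ε)) (trans e (code≡ x′ y′ ε′)))
    ... | ex , e₂ with digits {m = 2} {a = toℕ y} {c = toℕ y′} (bit<2 ε) (bit<2 ε′) e₂
    ...   | ey , eε = cong₂ _,_ (toℕ-injective ex) (cong₂ _,_ (toℕ-injective ey) (bit-inj eε))

    code< : ∀ t → code R t < N²
    code< (x , y , ε) = begin-strict
      code R (x , y , ε)                        ≡⟨ code≡ x y ε ⟩
      toℕ x * (2 * n) + (toℕ y * 2 + bit ε)    <⟨ digits-< {d = 0} (low< y ε) (toℕ<n x) ⟩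
      n * (2 * n) + 0                           ≡⟨ +-identityʳ _ ⟩
      n * (2 * n)                               ≡⟨ *-comm n (2 * n) ⟩
      N² ∎
      where open ≤-Reasoning

    f-period : ∀ {t} → Valid t → ∃ λ p → suc p ≤ N² × iter (suc p) f t ≡ t
    f-period v = aux (period f Valid f-valid f-inj (λ t _ → fromℕ< (code< t))
        (λ {a} {b} _ _ e → code-inj (trans (sym (toℕ-fromℕ< (code< a))) (trans (cong toℕ e) (toℕ-fromℕ< (code< b))))) v)
      where
      aux : ∀ {t} → (∃ λ p → 1 ≤ p × p ≤ N² × iter p f t ≡ t) → ∃ λ p → suc p ≤ N² × iter (suc p) f t ≡ t
      aux (suc p , _ , p≤ , e) = p , p≤ , e

    orbitCodes : State → List ℕ
    orbitCodes t = map (λ k → code R (iter k f t)) (upTo N²)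

    -- The least code on the orbit serves as its name. Periods are at most `N²`, so the iterates
    -- listed exhaust the orbit, and the default is the code of the iterate with exponent 0.
    ℓ₀ : State → ℕ
    ℓ₀ t = foldr _⊓_ (code R t) (orbitCodes t)

    ℓ₀-≤ : ∀ {t} → Valid t → ∀ k → ℓ₀ t ≤ code R (iter k f t)
    ℓ₀-≤ {t} v k = let p , p≤ , e = f-period v in
      subst (λ u → ℓ₀ t ≤ code R u) (sym (iter-% f (suc p) t e k))
        (foldr-⊓-≤ (∈-map⁺ (λ k → code R (iter k f t)) (∈-upTo⁺ (<-≤-trans (m%n<n k (suc p)) p≤))))

    ℓ₀-att : ∀ t → ∃ λ k → ℓ₀ t ≡ code R (iter k f t)
    ℓ₀-att t with foldr-⊓-sel (code R t) (orbitCodes t)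
    ... | inj₁ e = 0 , e
    ... | inj₂ m = let k , _ , e = ∈-map⁻ _ m in k , e

    -- Going round the orbit undoes a step: if `suc p` is a period, `p` further steps lead from
    -- `f t` back to `t`.
    ℓ₀-f : ∀ {t} → Valid t → ℓ₀ (f t) ≡ ℓ₀ t
    ℓ₀-f {t} v = ≤-antisym ≤₁ ≤₂
      where
      shift : ∀ k → iter k f (f t) ≡ iter (suc k) f t
      shift k = trans (sym (iter-+ f k 1 t)) (cong (λ m → iter m f t) (+-comm k 1))
      ≤₂ : ℓ₀ t ≤ ℓ₀ (f t)
      ≤₂ with ℓ₀-att (f t)
      ... | k , e = ≤-trans (ℓ₀-≤ v (suc k)) (≤-reflexive (trans (cong (code R) (sym (shift k))) (sym e)))
      ≤₁ : ℓ₀ (f t) ≤ ℓ₀ t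
      ≤₁ = let k , e = ℓ₀-att t ; p , _ , ep = f-period v in ≤-trans (ℓ₀-≤ (f-valid v) (k + p))
        (≤-reflexive (trans (cong (code R) (trans (shift (k + p)) (trans (cong (λ m → iter m f t) (sym (+-suc k p)))
          (trans (iter-+ f k (suc p) t) (cong (iter k f) ep))))) (sym e)))

    ℓ₀-iter : ∀ {t} → Valid t → ∀ k → ℓ₀ (iter k f t) ≡ ℓ₀ t
    ℓ₀-iter v zero = refl
    ℓ₀-iter v (suc k) = trans (ℓ₀-f (f^-valid k v)) (ℓ₀-iter v k)

    validᵇ : State → Bool
    validᵇ (x , y , _) = G x y

    repᵇ : State → Bool
    repᵇ t = validᵇ t ∧ isRep R t

    reps states : List State
    reps = filterᵇ repᵇ (allStates R)
    states = filterᵇ validᵇ (allStates R)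

    numOrbits≡ : numOrbits R ≡ length reps
    numOrbits≡ = length-filter-cong (allStates R) (λ { (x , y , ε) → refl })

    ∈-allStates : ∀ t → t ∈ allStates R
    ∈-allStates (x , y , true) = ∈-cartesianProduct⁺ (∈-allFin x) (∈-cartesianProduct⁺ (∈-allFin y) (here refl))
    ∈-allStates (x , y , false) = ∈-cartesianProduct⁺ (∈-allFin x) (∈-cartesianProduct⁺ (∈-allFin y) (there (here refl)))

    Unique-allStates : Unique (allStates R)
    Unique-allStates = cartesianProduct⁺ (allFin⁺ n) (cartesianProduct⁺ (allFin⁺ n) (((λ ()) ∷ []) ∷ [] ∷ []))

    Unique-reps : Unique reps
    Unique-reps = Unique-filterᵇ repᵇ Unique-allStates

    reps-valid : ∀ {r} → r ∈ reps → Valid r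
    reps-valid m = proj₁ (∧-true (proj₂ (∈-filterᵇ⁻ (allStates R) m)))

    reps-ℓ₀ : ∀ {r} → r ∈ reps → ℓ₀ r ≡ code R r
    reps-ℓ₀ {r} m = ≤-antisym (ℓ₀-≤ v 0) min
      where
      v = reps-valid m
      isr = proj₂ (∧-true {validᵇ r} (proj₂ (∈-filterᵇ⁻ (allStates R) m)))
      min : code R r ≤ ℓ₀ r
      min = let k , e = ℓ₀-att r ; p′ , p≤ , ep = f-period v ; p = suc p′ in ≤-trans
        (≤ᵇ-true (all⁻ {p = λ k → code R r ≤ᵇ code R (iter k f r)} isr (∈-upTo⁺ (<-≤-trans (m%n<n k p) p≤))))
        (≤-reflexive (trans (cong (code R) (sym (iter-% f p r ep k))) (sym e)))

    reps-ℓ₀-inj : ∀ {r r′} → r ∈ reps → r′ ∈ reps → ℓ₀ r ≡ ℓ₀ r′ → r ≡ r′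
    reps-ℓ₀-inj m m′ e = code-inj (trans (sym (reps-ℓ₀ m)) (trans e (reps-ℓ₀ m′)))

    module Weighted (w : State → ℤ) (w≥0 : ∀ t → ℤ.0ℤ ℤ.≤ w t) (c : ℤ) where

      -- A certificate for a single orbit. It selects distinct states without listing the orbit or
      -- knowing its length.
      record Heavy (t : State) : Set where
        constructor heavy
        field
          us : List State
          us-unique : Unique us
          us-orbit : ∀ {u} → u ∈ us → ∃ λ k → u ≡ iter k f t
          us-weight : c ℤ.≤ ∑ us w

      Heavy-iter : ∀ {t} k → Heavy (iter k f t) → Heavy t
      Heavy-iter {t} k (heavy us u o h) = heavy us u
        (λ m → let j , e = o m in j + k , trans e (sym (iter-+ f j k t))) h

      module _ (H : ∀ {t} → Valid t → Heavy t) where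

        -- Selections made for different representatives are disjoint because their states carry
        -- different values of `ℓ₀`.
        gather : ∀ rs → Unique rs → (∀ {r} → r ∈ rs → r ∈ reps) → ∃ λ us → Unique us ×
          (∀ {u} → u ∈ us → ∃ λ r → r ∈ rs × Valid u × ℓ₀ u ≡ ℓ₀ r) × c ℤ.* (ℤ.+ length rs) ℤ.≤ ∑ us w
        gather [] _ _ = [] , [] , (λ ()) , ℤ.≤-reflexive (ℤ.*-zeroʳ c)
        gather (r ∷ rs) (r∉ ∷ u) sub with gather rs u (sub ∘ there) | H (reps-valid (sub (here refl)))
        ... | vs , uvs , ovs , wvs | heavy us uus ous wus =
          us ++ vs , ++⁺ uus uvs disj , orb ,
          by {e = (∑ us w ℤ.- c) ℤ.+ (∑ vs w ℤ.- c ℤ.* (ℤ.+ length rs))} (⌞ wus ⌟ ⊕ ⌞ wvs ⌟)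
            (trans (cong (ℤ._- c ℤ.* (ℤ.+ suc (length rs))) (∑-++ us vs w)) (lem (∑ us w) (∑ vs w) c (ℤ.+ length rs)))
          where
          lem : ∀ a b c l → a ℤ.+ b ℤ.- c ℤ.* (ℤ.1ℤ ℤ.+ l) ≡ (a ℤ.- c) ℤ.+ (b ℤ.- c ℤ.* l)
          lem = ℤ.solve-∀
          vr = reps-valid (sub (here refl))
          lab : ∀ {x} → x ∈ us → Valid x × ℓ₀ x ≡ ℓ₀ r
          lab m with ous m
          ... | k , refl = f^-valid k vr , ℓ₀-iter vr k
          disj : ∀ {x} → x ∈ us × x ∈ vs → ⊥
          disj (a , b) with ovs b
          ... | r′ , m , _ , e = All.lookup r∉ m (reps-ℓ₀-inj (sub (here refl)) (sub (there m)) (trans (sym (proj₂ (lab a))) e))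
          orb : ∀ {x} → x ∈ us ++ vs → ∃ λ r′ → r′ ∈ r ∷ rs × Valid x × ℓ₀ x ≡ ℓ₀ r′
          orb m with ∈-++⁻ us m
          ... | inj₁ a = r , here refl , lab a
          ... | inj₂ b = let r′ , i , q = ovs b in r′ , there i , q

        orbit-weight : c ℤ.* (ℤ.+ numOrbits R) ℤ.≤ ∑ states w
        orbit-weight with gather reps Unique-reps (λ m → m)
        ... | us , u , o , h = ℤ.≤-trans (ℤ.≤-reflexive (cong (λ k → c ℤ.* (ℤ.+ k)) numOrbits≡))
          (ℤ.≤-trans h (∑-sublist u (λ m → let _ , _ , v , _ = o m in ∈-filterᵇ⁺ {p = validᵇ} (∈-allStates _) v) (λ _ → w≥0 _)))

open FaceOrbits

-- Euler's inequality for connected embedded graphs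

module Genus where
  open import Data.Nat hiding (ℕ; zero; suc; z≤n; s≤s)
  open import Data.Nat.Properties
  open import Data.Integer as ℤ using (ℤ)
  import Data.Integer.Properties as ℤ
  import Data.Integer.Tactic.RingSolver as ℤ
  open import Data.Nat.Tactic.RingSolver using (solve-∀)
  open import Data.Fin.Properties using (all?; ¬∀⟶∃¬)
  open import Data.List using ([_])
  import Data.List.Membership.DecPropositional as DecMem
  open import Data.Product.Properties using () renaming (≡-dec to ×-≡-dec)

  <ᵇ-true : ∀ {m n} → (m <ᵇ n) ≡ true → m < n
  <ᵇ-true {m} {n} h = <ᵇ⇒< m n (subst IsTrue (sym h) _)

  T-true : ∀ {b} → IsTrue b → b ≡ true
  T-true {true} _ = refl

  <ᵇ-intro : ∀ {m n} → m < n → (m <ᵇ n) ≡ true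
  <ᵇ-intro h = T-true (<⇒<ᵇ h)

  ≤ᵇ-intro : ∀ {m n} → m ≤ n → (m ≤ᵇ n) ≡ true
  ≤ᵇ-intro h = T-true (≤⇒≤ᵇ h)

  ∨-true₁ : ∀ {a b} → a ≡ true → a ∨ b ≡ true
  ∨-true₁ refl = refl

  ∨-true₂ : ∀ a {b} → b ≡ true → a ∨ b ≡ true
  ∨-true₂ true h = refl
  ∨-true₂ false h = h

  module _ {n} {G : Graph n} where

    ∈-edgeList⁺ : ∀ {x y} → toℕ x < toℕ y → G x y ≡ true → (x , y) ∈ edgeList G
    ∈-edgeList⁺ {x} {y} l h = ∈-filterᵇ⁺ (∈-cartesianProduct⁺ (∈-allFin x) (∈-allFin y)) (∧-intro (<ᵇ-intro l) h)

    ∈-edgeList⁻ : ∀ {x y} → (x , y) ∈ edgeList G → toℕ x < toℕ y × G x y ≡ true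
    ∈-edgeList⁻ m with ∧-true (proj₂ (∈-filterᵇ⁻ (cartesianProduct (allFin n) (allFin n)) m))
    ... | a , b = <ᵇ-true a , b

  -- Identifying k pairs of labels destroys at most k classes.
  module _ {S : Set} where

    merge : ∀ (M : List (S × S)) (ℓ : S → ℕ) (rs : List S) → Unique rs →
      (∀ {r r′} → r ∈ rs → r′ ∈ rs → ℓ r ≡ ℓ r′ → r ≡ r′) →
      ∃₂ λ (ℓ′ : S → ℕ) rs′ → Unique rs′ × (∀ {r r′} → r ∈ rs′ → r′ ∈ rs′ → ℓ′ r ≡ ℓ′ r′ → r ≡ r′) ×
        length rs ≤ length rs′ + length M × (∀ {r} → r ∈ rs′ → r ∈ rs) × (∀ {a b} → ℓ a ≡ ℓ b → ℓ′ a ≡ ℓ′ b) ×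
        (∀ {a b} → (a , b) ∈ M → ℓ′ a ≡ ℓ′ b)
    merge [] ℓ rs u inj = ℓ , rs , u , inj , ≤-reflexive (sym (+-identityʳ _)) , (λ m → m) , (λ e → e) , λ ()
    merge ((a , b) ∷ M) ℓ rs u inj =
      let ℓ′ , rs′ , u′ , inj′ , len , sub , pres , mer = merge M ℓ₁ rs₁ (Unique-filterᵇ p u) inj₁′
      in ℓ′ , rs′ , u′ , inj′ , ≤-trans len₁ (≤-trans (s≤s len) (≤-reflexive (sym (+-suc (length rs′) (length M))))) ,
         (λ m → proj₁ (∈-filterᵇ⁻ rs (sub m))) , (λ e → pres (cong relabel e)) ,
         λ { (here refl) → pres (trans (relabel-a (ℓ a) (≡ᵇ-refl (ℓ a))) (sym relabel-b)) ; (there m) → mer m }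
      where
      relabel : ℕ → ℕ
      relabel l = if l ≡ᵇ ℓ a then ℓ b else l
      relabel-a : ∀ l → (l ≡ᵇ ℓ a) ≡ true → relabel l ≡ ℓ b
      relabel-a l h rewrite h = refl
      relabel-b : relabel (ℓ b) ≡ ℓ b
      relabel-b with ℓ b ≡ᵇ ℓ a
      ... | true = refl
      ... | false = refl
      relabel-≢ : ∀ {l} → (l ≡ᵇ ℓ a) ≡ false → relabel l ≡ l
      relabel-≢ h rewrite h = refl
      p : S → Bool
      p r = not (ℓ r ≡ᵇ ℓ a)
      ℓ₁ : S → ℕ
      ℓ₁ = relabel ∘ ℓ
      rs₁ = filterᵇ p rs
      inj₁′ : ∀ {r r′} → r ∈ rs₁ → r′ ∈ rs₁ → ℓ₁ r ≡ ℓ₁ r′ → r ≡ r′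
      inj₁′ m m′ e with ∈-filterᵇ⁻ rs m | ∈-filterᵇ⁻ rs m′
      ... | i , h | i′ , h′ = inj i i′ (trans (sym (relabel-≢ (not-true h))) (trans e (relabel-≢ (not-true h′))))
      len₁ : length rs ≤ suc (length rs₁)
      len₁ = ℤ.drop‿+≤+ (by {e = ℤ.1ℤ ℤ.- ∑ rs q} ⌞ ∑-≤1 (λ r → ℓ r ≡ᵇ ℓ a) u (λ i j h k → inj i j (trans (≡ᵇ-true _ _ h) (sym (≡ᵇ-true _ _ k)))) ⌟
        (trans (cong₂ (λ u v → ℤ.1ℤ ℤ.+ u ℤ.- v) (length-filter≡∑ p rs) (sym (∑-not rs (λ r → ℓ r ≡ᵇ ℓ a))))
          (lem (∑ rs q) (∑ rs (𝟙 ∘ p)))))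
        where
        q = λ r → 𝟙 (ℓ r ≡ᵇ ℓ a)
        lem : ∀ a b → ℤ.1ℤ ℤ.+ b ℤ.- (a ℤ.+ b) ≡ ℤ.1ℤ ℤ.- a
        lem = ℤ.solve-∀

  module EulerBound {n} (G : Graph n) (simple : Simple G) (conn : Connected G) (R : EmbeddingScheme G) where
    open Embedding G simple R
    open Orbits G simple R

    Edge : Set
    Edge = Fin n × Fin n

    open DecMem (_≟ᶠ_ {n}) using () renaming (_∈?_ to _∈ᵛ?_)
    open DecMem (×-≡-dec (_≟ᶠ_ {n}) (_≟ᶠ_ {n})) using () renaming (_∈?_ to _∈ᵉ?_)

    -- A tree grown from a root: its vertices, and its edges as (child , parent) pairs.
    data Grow : List (Fin n) → List Edge → Set where
      root : ∀ x → Grow [ x ] []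
      grow : ∀ {vs T p c} → Grow vs T → p ∈ vs → ¬ c ∈ vs → G p c ≡ true → Grow (c ∷ vs) ((c , p) ∷ T)

    Grow-nonempty : ∀ {vs T} → Grow vs T → ∃ (_∈ vs)
    Grow-nonempty (root x) = x , here refl
    Grow-nonempty (grow g m _ _) = _ , there m

    Grow-length : ∀ {vs T} → Grow vs T → length vs ≡ suc (length T)
    Grow-length (root x) = refl
    Grow-length (grow g _ _ _) = cong suc (Grow-length g)

    Grow-unique : ∀ {vs T} → Grow vs T → Unique vs
    Grow-unique (root x) = [] ∷ []
    Grow-unique (grow g _ c∉ _) = All.tabulate (λ m e → c∉ (subst (_∈ _) (sym e) m)) ∷ Grow-unique g

    Grow-ends : ∀ {vs T c p} → Grow vs T → (c , p) ∈ T → c ∈ vs × p ∈ vs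
    Grow-ends (grow g m _ _) (here refl) = here refl , there m
    Grow-ends (grow g _ _ _) (there i) = let a , b = Grow-ends g i in there a , there b

    Grow-edge : ∀ {vs T c p} → Grow vs T → (c , p) ∈ T → G p c ≡ true
    Grow-edge (grow g _ _ h) (here refl) = h
    Grow-edge (grow g _ _ _) (there i) = Grow-edge g i

    Grow-anti : ∀ {vs T c p} → Grow vs T → (c , p) ∈ T → ¬ (p , c) ∈ T
    Grow-anti (grow g m c∉ _) (here refl) (here refl) = c∉ m
    Grow-anti (grow g m c∉ _) (here refl) (there i) = c∉ (proj₂ (Grow-ends g i))
    Grow-anti (grow g m c∉ _) (there i) (here refl) = c∉ (proj₂ (Grow-ends g i))
    Grow-anti (grow g m c∉ _) (there i) (there j) = Grow-anti g i j

    Grow-uniqueᵉ : ∀ {vs T} → Grow vs T → Unique T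
    Grow-uniqueᵉ (root x) = []
    Grow-uniqueᵉ (grow g _ c∉ _) = All.tabulate (λ m e → c∉ (subst (_∈ _) (sym (cong proj₁ e)) (proj₁ (Grow-ends g m)))) ∷ Grow-uniqueᵉ g

    exit : ∀ {vs a x} → Walk G a x → a ∈ vs → ¬ x ∈ vs → ∃₂ λ p c → p ∈ vs × ¬ c ∈ vs × G p c ≡ true
    exit here m x∉ = ⊥-elim (x∉ m)
    exit {vs} (step {y = y} h w) m x∉ with y ∈ᵛ? vs
    ... | yes i = exit w i x∉
    ... | no y∉ = _ , y , m , y∉ , h

    Complete : List (Fin n) → Set
    Complete vs = ∀ x → x ∈ vs

    -- `k` is fuel: either the tree already spans, or it has gained a vertex at each step. For k = n
    -- the second outcome would need n + 1 vertices.
    grow-to : Fin n → ∀ k → ∃₂ λ vs T → Grow vs T × (Complete vs ⊎ length vs ≡ suc k)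
    grow-to x₀ zero = _ , _ , root x₀ , inj₂ refl
    grow-to x₀ (suc k) with grow-to x₀ k
    ... | vs , T , g , inj₁ c = vs , T , g , inj₁ c
    ... | vs , T , g , inj₂ l with all? (_∈ᵛ? vs)
    ...   | yes c = vs , T , g , inj₁ c
    ...   | no ¬c with ¬∀⟶∃¬ n _ (_∈ᵛ? vs) ¬c
    ...     | x , x∉ with exit (conn (proj₁ (Grow-nonempty g)) x) (proj₂ (Grow-nonempty g)) x∉
    ...       | p , c , p∈ , c∉ , h = c ∷ vs , (c , p) ∷ T , grow g p∈ c∉ h , inj₂ (cong suc l)

    spanning : Fin n → ∃₂ λ vs T → Grow vs T × Complete vs
    spanning x₀ with grow-to x₀ n
    ... | vs , T , g , inj₁ c = vs , T , g , c
    ... | vs , T , g , inj₂ l = ⊥-elim (1+n≰n (subst (_≤ n) l (≤-trans (length-sublist (Grow-unique g) (λ {x} _ → ∈-allFin x)) (≤-reflexive (length-tabulate (λ x → x))))))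

    module Labelled (ℓ : State → ℕ) (ℓ-f : ∀ {t} → Valid t → ℓ (f t) ≡ ℓ t) where

      -- `ρ` reverses a state on the same side with the sign negated; without the negation the
      -- reversed state lies on the other side of the edge. So this says that both sides have
      -- merged, in compatible orientations.
      Crossable : Fin n → Fin n → Set
      Crossable x y = ∀ ε → ℓ (x , y , ε) ≡ ℓ (y , x , sgn x y ε)

      cross-sym : ∀ {x y} → Crossable x y → Crossable y x
      cross-sym {x} {y} c δ = trans (cong (λ b → ℓ (y , x , b)) (sym (sgn-inv y x δ))) (sym (c (sgn y x δ)))

      turn : ∀ {x y} ε → G x y ≡ true → Crossable x y → ℓ (x , y , ε) ≡ ℓ (x , rotS x ε y , ε)
      turn {x} {y} ε h c = trans (c ε) (trans (sym (ℓ-f {y , x , sgn x y ε} (sym-G h)))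
        (cong (λ b → ℓ (x , rotS x b y , b)) (sgn-inv x y ε)))

      rotS-period : ∀ {x y} b → G x y ≡ true → iter (deg G x) (rotS x b) y ≡ y
      rotS-period true h = rot-period h
      rotS-period {x} {y} false h = trans (cong (iter (deg G x) (rotS x false)) (sym (rot-period h))) (undo (deg G x))
        where
        undo : ∀ k → iter k (rotS x false) (iter k (rot x) y) ≡ y
        undo zero = refl
        undo (suc k) = trans (cong (λ m → iter m (rotS x false) (iter (suc k) (rot x) y)) (+-comm 1 k))
          (trans (iter-+ (rotS x false) k 1 _) (trans (cong (iter k (rotS x false)) (rotS-inv true (f^ k))) (undo k)))
          where
          f^ : ∀ k → G x (iter k (rot x) y) ≡ true
          f^ = iter-P (λ z → G x z ≡ true) rot-P h

      -- The walk turns around `x` and crosses every edge it meets other than `xp`. The second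
      -- alternative of `walk` records that `p` has been reached, after which nothing more is to be
      -- crossed.
      around : ∀ {x p} ε → G x p ≡ true → (∀ y → G x y ≡ true → y ≢ p → Crossable x y) →
        ℓ (x , rotS x ε p , ε) ≡ ℓ (x , p , ε)
      around {x} {p} ε h cr = finish (deg≥1 h) (walk (deg G x ∸ 1))
        where
        L = ℓ (x , rotS x ε p , ε)
        y : ℕ → Fin n
        y k = iter (suc k) (rotS x ε) p
        walk : ∀ k → ℓ (x , y k , ε) ≡ L ⊎ ℓ (x , p , ε) ≡ L
        walk zero = inj₁ refl
        walk (suc k) with walk k
        ... | inj₂ e = inj₂ e
        ... | inj₁ e with y k ≟ᶠ p
        ...   | yes q = inj₂ (trans (cong (λ z → ℓ (x , z , ε)) (sym q)) e)
        ...   | no q = inj₁ (trans (sym (turn ε v (cr (y k) v q))) e)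
          where v = iter-P (λ z → G x z ≡ true) (rotS-closed ε) h (suc k)
        finish : 1 ≤ deg G x → ℓ (x , y (deg G x ∸ 1) , ε) ≡ L ⊎ ℓ (x , p , ε) ≡ L → L ≡ ℓ (x , p , ε)
        finish _ (inj₂ e) = sym e
        finish d (inj₁ e) = trans (sym e) (cong (λ z → ℓ (x , z , ε))
          (trans (cong (λ m → iter m (rotS x ε) p) (m+[n∸m]≡n d)) (rotS-period ε h)))

      -- A leaf edge of the tree can be crossed by walking around the leaf; then the leaf is discarded.
      cross-all : ∀ {vs T} → Grow vs T →
        (∀ {x y} → G x y ≡ true → ¬ (x , y) ∈ T → ¬ (y , x) ∈ T → Crossable x y) →
        ∀ {x y} → G x y ≡ true → Crossable x y
      cross-all (root _) H h = H h (λ ()) (λ ())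
      cross-all {c ∷ vs} {(_ , p) ∷ T} (grow g p∈ c∉ hp) H = cross-all g H′
        where
        leaf : Crossable c p
        -- The corner after `p` in the rotation at `c` is one face step from the far side of the
        -- edge, and going around `c` joins it to the near side.
        leaf ε = trans (sym (around ε (sym-G hp) nontree))
          (sym (trans (sym (ℓ-f {p , c , sgn c p ε} hp)) (cong (λ b → ℓ (c , rotS c b p , b)) (sgn-inv c p ε))))
          where
          nontree : ∀ y → G c y ≡ true → y ≢ p → Crossable c y
          nontree y h y≢ = H h
            (λ { (here e) → y≢ (cong proj₂ e) ; (there i) → c∉ (proj₁ (Grow-ends g i)) })
            (λ { (here e) → c∉ (subst (_∈ vs) (sym (cong proj₂ e)) p∈) ; (there i) → c∉ (proj₂ (Grow-ends g i)) })
        H′ : ∀ {x y} → G x y ≡ true → ¬ (x , y) ∈ T → ¬ (y , x) ∈ T → Crossable x y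
        H′ {x} {y} h a b with ×-≡-dec _≟ᶠ_ _≟ᶠ_ (x , y) (c , p) | ×-≡-dec _≟ᶠ_ _≟ᶠ_ (y , x) (c , p)
        ... | yes refl | _ = leaf
        ... | no _ | yes refl = cross-sym leaf
        ... | no q | no r = H h (λ { (here e) → q e ; (there i) → a i }) (λ { (here e) → r e ; (there i) → b i })

      module _ (cr : ∀ {x y} → G x y ≡ true → Crossable x y) where

        rot-same : ∀ {x y} ε → G x y ≡ true → ℓ (x , rot x y , ε) ≡ ℓ (x , y , ε)
        rot-same true h = sym (turn true h (cr h))
        rot-same {x} {y} false h = trans (turn false (rot-P h) (cr (rot-P h))) (cong (λ z → ℓ (x , z , false)) (rotS-inv true h))

        vertex-same : ∀ {x y z} ε → G x y ≡ true → G x z ≡ true → ℓ (x , y , ε) ≡ ℓ (x , z , ε)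
        vertex-same {x} {y} {z} ε h h′ with rot-cyclic x y z h h′
        ... | k , refl = go k
          where
          go : ∀ k → ℓ (x , y , ε) ≡ ℓ (x , iter k (rot x) y , ε)
          go zero = refl
          go (suc k) = trans (go k) (sym (rot-same ε (iter-P (λ z → G x z ≡ true) rot-P h k)))

        -- Once all edges are crossable, a label depends only on the vertex and the local
        -- orientation. Walking to `x₀` transports the orientation by `sgn`, so two labels at most
        -- survive.
        two-classes : ∀ {x x₀ y₀} → G x₀ y₀ ≡ true → Walk G x x₀ → ∀ {y} ε → G x y ≡ true → ∃ λ ε₀ → ℓ (x , y , ε) ≡ ℓ (x₀ , y₀ , ε₀)
        two-classes h₀ here ε h = ε , vertex-same ε h h₀
        two-classes h₀ (step {x} {y′} k w) ε h =
          let ε₀ , e = two-classes h₀ w (sgn x y′ ε) (sym-G k) in ε₀ , trans (vertex-same ε h k) (trans (cr k ε) e)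

    tree : List Edge → Edge → Bool
    tree T (x , y) = does ((x , y) ∈ᵉ? T) ∨ does ((y , x) ∈ᵉ? T)

    does⁺ : ∀ {P : Set} (d : Dec P) → P → does d ≡ true
    does⁺ (yes _) _ = refl
    does⁺ (no n) p = ⊥-elim (n p)

    does⁻ : ∀ {P : Set} (d : Dec P) → ¬ P → does d ≡ false
    does⁻ (no _) _ = refl
    does⁻ (yes p) n = ⊥-elim (n p)

    nontree : List Edge → List Edge
    nontree T = filterᵇ (not ∘ tree T) (edgeList G)

    crossings : List Edge → List (State × State)
    crossings [] = []
    crossings ((x , y) ∷ es) = ((x , y , true) , (y , x , sgn x y true)) ∷ ((x , y , false) , (y , x , sgn x y false)) ∷ crossings es

    crossings-length : ∀ es → length (crossings es) ≡ 2 * length es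
    crossings-length [] = refl
    crossings-length (e ∷ es) = trans (cong (2 +_) (crossings-length es)) (sym (*-suc 2 (length es)))

    ∈-crossings : ∀ {es x y} ε → (x , y) ∈ es → ((x , y , ε) , (y , x , sgn x y ε)) ∈ crossings es
    ∈-crossings true (here refl) = here refl
    ∈-crossings false (here refl) = there (here refl)
    ∈-crossings ε (there m) = there (there (∈-crossings ε m))

    -- Tree edges run from child to parent, whereas `edgeList` puts the smaller end first.
    norm : Edge → Edge
    norm (c , p) = if toℕ c <ᵇ toℕ p then (c , p) else (p , c)

    norm-cases : ∀ c p → norm (c , p) ≡ (c , p) × toℕ c < toℕ p ⊎ norm (c , p) ≡ (p , c) × toℕ p ≤ toℕ c
    norm-cases c p with toℕ c <ᵇ toℕ p in eq
    ... | true = inj₁ (refl , <ᵇ-true eq)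
    ... | false = inj₂ (refl , ≮⇒≥ (λ l → true≢false (<ᵇ-intro l) eq))

    nontree-length : ∀ {vs T} → Grow vs T → length (nontree T) + length T ≤ size G
    nontree-length {vs} {T} g = ℤ.drop‿+≤+ (by {e = ∑ E (𝟙 ∘ tree T) ℤ.- ∑ T (λ _ → ℤ.1ℤ)} ⌞ inj ⌟
        (trans (cong₂ ℤ._-_ (sym (∑-not E (tree T))) (cong₂ ℤ._+_ (length-filter≡∑ (not ∘ tree T) E) (sym (∑-1 T)))) 
          (lem (∑ E (𝟙 ∘ tree T)) (∑ E (𝟙 ∘ not ∘ tree T)) (∑ T (λ _ → ℤ.1ℤ)))))
      where
      E = edgeList G
      lem : ∀ a b t → (a ℤ.+ b) ℤ.- (b ℤ.+ t) ≡ a ℤ.- t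
      lem = ℤ.solve-∀
      into : ∀ {e} → e ∈ T → norm e ∈ E × tree T (norm e) ≡ true
      into {c , p} m with norm-cases c p
      ... | inj₁ (e , l) rewrite e = ∈-edgeList⁺ l (sym-G (Grow-edge g m)) , ∨-true₁ (does⁺ ((c , p) ∈ᵉ? T) m)
      ... | inj₂ (e , l) rewrite e = ∈-edgeList⁺ (≤∧≢⇒< l (λ q → G-≢ (Grow-edge g m) (toℕ-injective q))) (Grow-edge g m) ,
        ∨-true₂ (does ((p , c) ∈ᵉ? T)) (does⁺ ((c , p) ∈ᵉ? T) m)
      norm-inj : ∀ {e e′} → e ∈ T → e′ ∈ T → norm e ≡ norm e′ → e ≡ e′
      norm-inj {c , p} {c′ , p′} m m′ q with norm-cases c p | norm-cases c′ p′
      ... | inj₁ (e , _) | inj₁ (e′ , _) = trans (sym e) (trans q e′)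
      ... | inj₁ (e , _) | inj₂ (e′ , _) = ⊥-elim (Grow-anti g m (subst (_∈ T) (swapped (trans (sym e′) (trans (sym q) e))) m′))
        where
        swapped : (p′ , c′) ≡ (c , p) → (c′ , p′) ≡ (p , c)
        swapped refl = refl
      ... | inj₂ (e , _) | inj₁ (e′ , _) = ⊥-elim (Grow-anti g m (subst (_∈ T) (trans (sym e′) (trans (sym q) e)) m′))
      ... | inj₂ (e , _) | inj₂ (e′ , _) = swapped (trans (sym e) (trans q e′))
        where
        swapped : (p , c) ≡ (p′ , c′) → (c , p) ≡ (c′ , p′)
        swapped refl = refl
      inj : ∑ T (λ _ → ℤ.1ℤ) ℤ.≤ ∑ E (𝟙 ∘ tree T)
      inj = ∑-inj {xs = T} {ys = E} (λ _ → true) (tree T) norm (Grow-uniqueᵉ g) (λ m _ → into m) (λ a b _ _ → norm-inj a b)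

    -- An edge outside the tree costs two identifications, one per sign, and two labels remain. With
    -- at least n - 1 tree edges this is Euler's inequality doubled, as orbits count a face once per
    -- direction.
    count : ∀ {vs T x₀ y₀} → G x₀ y₀ ≡ true → Grow vs T → Complete vs → (ℓ : State → ℕ) (rs : List State) → Unique rs →
      (∀ {r r′} → r ∈ rs → r′ ∈ rs → ℓ r ≡ ℓ r′ → r ≡ r′) → length reps ≤ length rs + length (crossings (nontree T)) →
      (∀ {r} → r ∈ rs → r ∈ reps) → (∀ {a b} → ℓ₀ a ≡ ℓ₀ b → ℓ a ≡ ℓ b) →
      (∀ {a b} → (a , b) ∈ crossings (nontree T) → ℓ a ≡ ℓ b) → numOrbits R + 2 * n ≤ 2 * size G + 4
    count {vs} {T} {x₀} {y₀} h₀ g complete ℓ rs urs injrs len sub pres mer = arith orb n≤ (nontree-length g)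
      where
      arith : ∀ {o n a t m} → o ≤ 2 + 2 * a → n ≤ suc t → a + t ≤ m → o + 2 * n ≤ 2 * m + 4
      arith {o} {n} {a} {t} {m} p q r = begin
        o + 2 * n                  ≤⟨ +-mono-≤ p (*-monoʳ-≤ 2 q) ⟩
        (2 + 2 * a) + 2 * suc t    ≡⟨ lem a t ⟩
        2 * (a + t) + 4            ≤⟨ +-monoˡ-≤ 4 (*-monoʳ-≤ 2 r) ⟩
        2 * m + 4 ∎
        where
        open ≤-Reasoning
        lem : ∀ a b → (2 + 2 * a) + 2 * suc b ≡ 2 * (a + b) + 4
        lem = solve-∀
      open Labelled ℓ (λ {t} v → pres {f t} {t} (ℓ₀-f {t} v))
      edge-cross : ∀ {x y} → G x y ≡ true → ¬ (x , y) ∈ T → ¬ (y , x) ∈ T → toℕ x < toℕ y → Crossable x y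
      edge-cross {x} {y} h a b l ε = mer (∈-crossings ε (∈-filterᵇ⁺ (∈-edgeList⁺ l h)
        (cong not (cong₂ _∨_ (does⁻ ((x , y) ∈ᵉ? T) a) (does⁻ ((y , x) ∈ᵉ? T) b)))))
      base : ∀ {x y} → G x y ≡ true → ¬ (x , y) ∈ T → ¬ (y , x) ∈ T → Crossable x y
      base {x} {y} h a b with <-cmp (toℕ x) (toℕ y)
      ... | tri< l _ _ = edge-cross h a b l
      ... | tri≈ _ e _ = ⊥-elim (G-≢ h (toℕ-injective e))
      ... | tri> _ _ l = cross-sym (edge-cross (sym-G h) b a l)
      n≤ : n ≤ suc (length T)
      n≤ = subst₂ _≤_ (length-tabulate (λ x → x)) (Grow-length g) (length-sublist Unique-V (λ {x} _ → complete x))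
      rs≤2 : length rs ≤ 2
      rs≤2 = ≤-trans (≤-reflexive (sym (length-map ℓ rs))) (length-sublist {ys = ℓ (x₀ , y₀ , true) ∷ ℓ (x₀ , y₀ , false) ∷ []} (Unique-map ℓ urs injrs) in2)
        where
        in2 : ∀ {l} → l ∈ map ℓ rs → l ∈ ℓ (x₀ , y₀ , true) ∷ ℓ (x₀ , y₀ , false) ∷ []
        in2 m = let (x , y , ε) , i , e = ∈-map⁻ ℓ m
                    ε₀ , e′ = two-classes (cross-all g base) h₀ (conn x x₀) ε (reps-valid (sub i))
                in pick ε₀ (trans e e′)
          where
          pick : ∀ {l} ε₀ → l ≡ ℓ (x₀ , y₀ , ε₀) → l ∈ ℓ (x₀ , y₀ , true) ∷ ℓ (x₀ , y₀ , false) ∷ []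
          pick true e = here e
          pick false e = there (here e)
      orb : numOrbits R ≤ 2 + 2 * length (nontree T)
      orb = ≤-trans (≤-reflexive numOrbits≡) (≤-trans len (+-mono-≤ rs≤2 (≤-reflexive (crossings-length (nontree T)))))

    euler-bound : ∀ {x₀ y₀} → G x₀ y₀ ≡ true → numOrbits R + 2 * n ≤ 2 * size G + 4
    euler-bound {x₀} {y₀} h₀ =
      let vs , T , g , complete = spanning x₀
          ℓ , rs , urs , injrs , len , sub , pres , mer = merge (crossings (nontree T)) ℓ₀ reps Unique-reps (λ {r} {r′} → reps-ℓ₀-inj {r} {r′})
      in count h₀ g complete ℓ rs urs (λ {r} {r′} → injrs {r} {r′}) len sub (λ {a} {b} → pres {a} {b}) (λ {a} {b} → mer {a} {b})

open Genus

-- Domination and the upper bounds for the bondage number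

module BondageBound where
  open import Data.Nat hiding (ℕ; zero; suc; z≤n; s≤s)
  open import Data.Nat.Properties
  open import Data.Integer as ℤ using (ℤ)
  import Data.Integer.Properties as ℤ
  import Data.Integer.Tactic.RingSolver as ℤ
  open import Data.Fin.Subset using (Subset; ∣_∣)
  open import Data.Vec using ([]; _∷_; lookup; _[_]≔_; replicate)
  open import Data.Vec.Properties using (lookup∘update; lookup∘update′; lookup-replicate)
  open import Data.Bool.Properties using (∨-comm)

  ∨-false : ∀ {a b} → a ∨ b ≡ false → a ≡ false × b ≡ false
  ∨-false {false} {false} h = refl , refl

  ∨-true : ∀ {a b} → a ∨ b ≡ true → a ≡ true ⊎ b ≡ true
  ∨-true {true} h = inj₁ refl
  ∨-true {false} h = inj₂ h

  not-intro : ∀ {a} → a ≡ false → not a ≡ true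
  not-intro refl = refl

  not-false : ∀ {a} → not a ≡ false → a ≡ true
  not-false {true} h = refl

  any⁻ : ∀ {A : Set} {p : A → Bool} xs → any p xs ≡ true → ∃ λ x → x ∈ xs × p x ≡ true
  any⁻ {p = p} (x ∷ xs) h with p x in eq
  ... | true = x , here refl , eq
  ... | false = let y , m , q = any⁻ xs h in y , there m , q

  any⁺ : ∀ {A : Set} {p : A → Bool} {x xs} → x ∈ xs → p x ≡ true → any p xs ≡ true
  any⁺ (here refl) h = ∨-true₁ h
  any⁺ {p = p} {xs = y ∷ _} (there m) h = ∨-true₂ (p y) (any⁺ m h)

  all⁺ : ∀ {A : Set} {p : A → Bool} xs → (∀ {x} → x ∈ xs → p x ≡ true) → all p xs ≡ true
  all⁺ [] h = refl
  all⁺ (x ∷ xs) h = ∧-intro (h (here refl)) (all⁺ xs (h ∘ there))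

  foldr-⊓-glb : ∀ {k d} xs → k ≤ d → (∀ {x} → x ∈ xs → k ≤ x) → k ≤ foldr _⊓_ d xs
  foldr-⊓-glb [] kd h = kd
  foldr-⊓-glb (x ∷ xs) kd h = ⊓-glb (h (here refl)) (foldr-⊓-glb xs kd (h ∘ there))

  ∈-allSubsets : ∀ {n} (D : Subset n) → D ∈ allSubsets n
  ∈-allSubsets [] = here refl
  ∈-allSubsets (true ∷ D) = ∈-++⁺ˡ (∈-map⁺ (true ∷_) (∈-allSubsets D))
  ∈-allSubsets {suc n} (false ∷ D) = ∈-++⁺ʳ (map (true ∷_) (allSubsets n)) (∈-map⁺ (false ∷_) (∈-allSubsets D))

  ∣delete∣ : ∀ {n} (D : Subset n) x → lookup D x ≡ true → suc ∣ D [ x ]≔ false ∣ ≡ ∣ D ∣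
  ∣delete∣ (true ∷ D) zero h = refl
  ∣delete∣ (true ∷ D) (suc x) h = cong suc (∣delete∣ D x h)
  ∣delete∣ (false ∷ D) (suc x) h = ∣delete∣ D x h

  ∣insert∣ : ∀ {n} (D : Subset n) x → lookup D x ≡ false → ∣ D [ x ]≔ true ∣ ≡ suc ∣ D ∣
  ∣insert∣ (false ∷ D) zero h = refl
  ∣insert∣ (true ∷ D) (suc x) h = cong suc (∣insert∣ D x h)
  ∣insert∣ (false ∷ D) (suc x) h = ∣insert∣ D x h

  ∣full∣ : ∀ n → ∣ replicate n true ∣ ≡ n
  ∣full∣ zero = refl
  ∣full∣ (suc n) = cong suc (∣full∣ n)

  filter∈sublists : ∀ {A : Set} (p : A → Bool) xs → filterᵇ p xs ∈ sublists xs
  filter∈sublists p [] = here refl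
  filter∈sublists p (x ∷ xs) with p x
  ... | true = ∈-++⁺ˡ (∈-map⁺ (x ∷_) (filter∈sublists p xs))
  ... | false = ∈-++⁺ʳ (map (x ∷_) (sublists xs)) (filter∈sublists p xs)

  module _ {n} (G : Graph n) where

    Dominates : Subset n → Set
    Dominates D = ∀ x → lookup D x ≡ true ⊎ ∃ λ y → lookup D y ≡ true × G x y ≡ true

    dominating⁻ : ∀ D → dominatingᵇ G D ≡ true → Dominates D
    dominating⁻ D h x with ∨-true (all⁻ {p = λ x → lookup D x ∨ any (λ y → lookup D y ∧ G x y) (allFin n)} h (∈-allFin x))
    ... | inj₁ e = inj₁ e
    ... | inj₂ a = let y , _ , e = any⁻ {p = λ y → lookup D y ∧ G x y} (allFin n) a in inj₂ (y , ∧-true e)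

    dominating⁺ : ∀ D → Dominates D → dominatingᵇ G D ≡ true
    dominating⁺ D h = all⁺ {p = λ x → lookup D x ∨ any (λ y → lookup D y ∧ G x y) (allFin n)} (allFin n) (λ {x} _ → aux x (h x))
      where
      aux : ∀ x → lookup D x ≡ true ⊎ (∃ λ y → lookup D y ≡ true × G x y ≡ true) →
        lookup D x ∨ any (λ y → lookup D y ∧ G x y) (allFin n) ≡ true
      aux x (inj₁ e) = ∨-true₁ e
      aux x (inj₂ (y , a , b)) = ∨-true₂ (lookup D x) (any⁺ {p = λ y → lookup D y ∧ G x y} (∈-allFin y) (∧-intro a b))

    γ-≤ : ∀ D → Dominates D → γ G ≤ ∣ D ∣
    γ-≤ D h = foldr-⊓-≤ (∈-map⁺ ∣_∣ (∈-filterᵇ⁺ (∈-allSubsets D) (dominating⁺ D h)))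

    γ-attained : ∃ λ D → Dominates D × ∣ D ∣ ≡ γ G
    γ-attained with foldr-⊓-sel n (map ∣_∣ (filterᵇ (dominatingᵇ G) (allSubsets n)))
    ... | inj₁ e = replicate n true , (λ x → inj₁ (lookup-replicate x true)) , trans (∣full∣ n) (sym e)
    ... | inj₂ m = let D , i , e = ∈-map⁻ ∣_∣ m in D , dominating⁻ D (proj₂ (∈-filterᵇ⁻ (allSubsets n) i)) , sym e

  module Bondage {n} (G : Graph n) (simple : Simple G) where
    open Graphs G simple

    E : List (Fin n × Fin n)
    E = edgeList G

    Unique-E : Unique E
    Unique-E = Unique-filterᵇ _ (cartesianProduct⁺ (allFin⁺ n) (allFin⁺ n))

    module Removal (p : Fin n × Fin n → Bool) where

      F = filterᵇ p E
      G′ = removeEdges G F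

      kept : ∀ {x y} → G′ x y ≡ true → G x y ≡ true × ∃ λ e → (e ≡ (x , y) ⊎ e ≡ (y , x)) × e ∈ E × p e ≡ false
      kept {x} {y} h with <-cmp (toℕ x) (toℕ y) | ∧-true h
      ... | tri≈ _ e _ | g , r = ⊥-elim (G-≢ g (toℕ-injective e))
      ... | tri< l _ _ | g , r = g , (x , y) , inj₁ refl , ∈-edgeList⁺ l g , ¬true⇒false λ q →
        true≢false (any⁺ {p = λ { (a , b) → (a == x ∧ b == y) ∨ (a == y ∧ b == x) }} (∈-filterᵇ⁺ (∈-edgeList⁺ l g) q) (∨-true₁ (∧-intro (==-refl x) (==-refl y)))) (not-true r)
      ... | tri> _ _ l | g , r = g , (y , x) , inj₂ refl , ∈-edgeList⁺ l (sym-G g) , ¬true⇒false λ q →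
        true≢false (any⁺ {p = λ { (a , b) → (a == x ∧ b == y) ∨ (a == y ∧ b == x) }} (∈-filterᵇ⁺ (∈-edgeList⁺ l (sym-G g)) q) (∨-true₂ (y == x ∧ x == y) (∧-intro (==-refl y) (==-refl x)))) (not-true r)

      bondage-≤ : (∀ D → Dominates G′ D → ∃ λ D′ → Dominates G D′ × ∣ D′ ∣ < ∣ D ∣) → bondage G ≤ length F
      bondage-≤ h with γ-attained G′
      ... | D , dom , e with h D dom
      ...   | D′ , dom′ , lt = foldr-⊓-≤ (∈-map⁺ length (∈-filterᵇ⁺ (filter∈sublists p E)
        (<ᵇ-intro (<-≤-trans (≤-<-trans (γ-≤ G D′ dom′) lt) (≤-reflexive e)))))

    incident : Fin n → Fin n × Fin n → Bool
    incident u (x , y) = (x == u) ∨ (y == u)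

    other : Fin n → Fin n × Fin n → Fin n
    other u (x , y) = if x == u then y else x

    incident-cases : ∀ {u x y} → (x , y) ∈ E → incident u (x , y) ≡ true →
      x ≡ u × other u (x , y) ≡ y ⊎ y ≡ u × other u (x , y) ≡ x
    incident-cases {u} {x} {y} m h with x == u in eq
    ... | true = inj₁ (==-true eq , refl)
    ... | false = inj₂ (==-true h , refl)

    -- In a simple graph an edge at `u` is determined by its other end.
    star : ∀ u (q : Fin n → Bool) → ∑ E (λ e → 𝟙 (incident u e ∧ q (other u e))) ℤ.≤ ∑ (Nb u) (𝟙 ∘ q)
    star u q = ∑-inj {xs = E} {ys = Nb u} (λ e → incident u e ∧ q (other u e)) q (other u) Unique-E into inj
      where
      into : ∀ {e} → e ∈ E → incident u e ∧ q (other u e) ≡ true → other u e ∈ Nb u × q (other u e) ≡ true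
      into {x , y} m h with ∧-true {incident u (x , y)} h
      ... | i , k with incident-cases m i
      ...   | inj₁ (refl , e) = subst (_∈ Nb u) (sym e) (∈-Nb⁺ (proj₂ (∈-edgeList⁻ m))) , k
      ...   | inj₂ (refl , e) = subst (_∈ Nb u) (sym e) (∈-Nb⁺ (sym-G (proj₂ (∈-edgeList⁻ m)))) , k
      inj : ∀ {e e′} → e ∈ E → e′ ∈ E → incident u e ∧ q (other u e) ≡ true → incident u e′ ∧ q (other u e′) ≡ true →
        other u e ≡ other u e′ → e ≡ e′
      inj {x , y} {x′ , y′} m m′ h h′ eq
        with incident-cases m (proj₁ (∧-true {incident u (x , y)} h)) | incident-cases m′ (proj₁ (∧-true {incident u (x′ , y′)} h′))
      ... | inj₁ (a , e) | inj₁ (a′ , e′) = cong₂ _,_ (trans a (sym a′)) (trans (sym e) (trans eq e′))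
      ... | inj₂ (a , e) | inj₂ (a′ , e′) = cong₂ _,_ (trans (sym e) (trans eq e′)) (trans a (sym a′))
      ... | inj₁ (a , e) | inj₂ (a′ , e′) with trans a (sym a′) | trans (sym e) (trans eq e′)
      ...   | refl | refl = ⊥-elim (<-asym (proj₁ (∈-edgeList⁻ m)) (proj₁ (∈-edgeList⁻ m′)))
      inj {x , y} {x′ , y′} m m′ h h′ eq | inj₂ (a , e) | inj₁ (a′ , e′) with trans a (sym a′) | trans (sym e) (trans eq e′)
      ...   | refl | refl = ⊥-elim (<-asym (proj₁ (∈-edgeList⁻ m)) (proj₁ (∈-edgeList⁻ m′)))

    -- After the deletion u is isolated, so it lies in every dominating set and is dispensable in G.
    module TwoStars (u v : Fin n) (q : Fin n → Bool) where

      p : Fin n × Fin n → Bool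
      p e = incident u e ∨ (incident v e ∧ q (other v e))

      open Removal p public

      F-length : ∀ k → ∑ (Nb v) (𝟙 ∘ q) ℤ.+ (ℤ.+ k) ℤ.≤ ℤ.+ deg G v → length F ≤ deg G u + deg G v ∸ k
      F-length k h = m+n≤o⇒m≤o∸n (length F) (ℤ.drop‿+≤+ (by {e = (Eu ℤ.+ Ev ℤ.- ∑ E (𝟙 ∘ p)) ℤ.+ (ℤ.+ deg G u ℤ.- Eu) ℤ.+ (∑ (Nb v) (𝟙 ∘ q) ℤ.- Ev) ℤ.+ (ℤ.+ deg G v ℤ.- (∑ (Nb v) (𝟙 ∘ q) ℤ.+ (ℤ.+ k)))}
          (⌞ split ⌟ ⊕ ⌞ star₁ ⌟ ⊕ ⌞ star v q ⌟ ⊕ ⌞ h ⌟)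
          (trans (cong (λ z → ℤ.+ deg G u ℤ.+ ℤ.+ deg G v ℤ.- (z ℤ.+ (ℤ.+ k))) (length-filter≡∑ p E))
            (lem (ℤ.+ deg G u) (ℤ.+ deg G v) (ℤ.+ k) Eu Ev (∑ E (𝟙 ∘ p)) (∑ (Nb v) (𝟙 ∘ q))))))
        where
        Eu = ∑ E (λ e → 𝟙 (incident u e))
        Ev = ∑ E (λ e → 𝟙 (incident v e ∧ q (other v e)))
        lem : ∀ a b k eu ev P Q → a ℤ.+ b ℤ.- (P ℤ.+ k) ≡
          (eu ℤ.+ ev ℤ.- P) ℤ.+ (a ℤ.- eu) ℤ.+ (Q ℤ.- ev) ℤ.+ (b ℤ.- (Q ℤ.+ k))
        lem = ℤ.solve-∀
        or≤ : ∀ a b → 𝟙 (a ∨ b) ℤ.≤ 𝟙 a ℤ.+ 𝟙 b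
        or≤ true b = by {e = 𝟙 b} (𝟙≥0 b) (lem′ (𝟙 b))
          where
          lem′ : ∀ b → ℤ.1ℤ ℤ.+ b ℤ.- ℤ.1ℤ ≡ b
          lem′ = ℤ.solve-∀
        or≤ false b = ℤ.≤-reflexive (sym (ℤ.+-identityˡ (𝟙 b)))
        split : ∑ E (𝟙 ∘ p) ℤ.≤ Eu ℤ.+ Ev
        split = ℤ.≤-trans (∑-mono E (λ {e} _ → or≤ (incident u e) (incident v e ∧ q (other v e))))
          (ℤ.≤-reflexive (∑-+ E (λ e → 𝟙 (incident u e)) (λ e → 𝟙 (incident v e ∧ q (other v e)))))
        star₁ : Eu ℤ.≤ ℤ.+ deg G u
        star₁ = ℤ.≤-trans (∑-mono E (λ {e} _ → 𝟙-mono (incident u e) _ (λ i → ∧-intro i refl)))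
          (ℤ.≤-trans (star u (λ _ → true)) (ℤ.≤-reflexive (∑-1 (Nb u))))

      kept-facts : ∀ {x y} → G′ x y ≡ true → G x y ≡ true × x ≢ u × y ≢ u × (x ≡ v → q y ≡ false)
      kept-facts {x} {y} h with kept h
      ... | g , e , o , m , pf with ∨-false {incident u e} pf
      ...   | iu , iv with o
      ...     | inj₁ refl = g , (λ { refl → true≢false (∨-true₁ (==-refl x)) iu }) , (λ { refl → true≢false (∨-true₂ (x == y) (==-refl y)) iu }) , q′
        where
        q′ : x ≡ v → q y ≡ false
        q′ refl with x == x | ==-refl x
        ... | true | _ = iv
      ...     | inj₂ refl = g , (λ { refl → true≢false (∨-true₂ (y == x) (==-refl x)) iu }) , (λ { refl → true≢false (∨-true₁ (==-refl y)) iu }) , q′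
        where
        q′ : x ≡ v → q y ≡ false
        q′ refl with y == x | ==-false (G-≢ (sym-G g)) | x == x | ==-refl x
        ... | false | _ | true | _ = iv

      u∈D : ∀ D → Dominates G′ D → lookup D u ≡ true
      u∈D D dom with dom u
      ... | inj₁ e = e
      ... | inj₂ (y , _ , g) = ⊥-elim (proj₁ (proj₂ (kept-facts g)) refl)

      drop-u : ∀ D {w} → Dominates G′ D → lookup D w ≡ true → w ≢ u → G u w ≡ true → ∃ λ D′ → Dominates G D′ × ∣ D′ ∣ < ∣ D ∣
      drop-u D {w} dom wD w≢u g = D [ u ]≔ false , dom′ , ≤-reflexive (∣delete∣ D u (u∈D D dom))
        where
        dom′ : Dominates G (D [ u ]≔ false)
        dom′ x with x ≟ᶠ u
        ... | yes refl = inj₂ (w , trans (lookup∘update′ w≢u D false) wD , g)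
        ... | no x≢u with dom x
        ...   | inj₁ e = inj₁ (trans (lookup∘update′ x≢u D false) e)
        ...   | inj₂ (y , e , k) = let g′ , _ , y≢u , _ = kept-facts k in inj₂ (y , trans (lookup∘update′ y≢u D false) e , g′)

    -- What remains at `v` are the edges to common neighbours. So whatever dominates `v` afterwards,
    -- `v` itself or a common neighbour, is adjacent to `u` in `G` and makes `u` dispensable. Spared
    -- at `v` are the common neighbours and `u`, whose edge to `v` was already counted at `u`.
    bondage-adjacent : ∀ {u v} → G u v ≡ true → bondage G ≤ deg G u + deg G v ∸ 1 ∸ commonNbrs G u v
    bondage-adjacent {u} {v} g = ≤-trans (bondage-≤ smaller)
        (≤-trans (F-length (1 + c) count) (≤-reflexive (sym (∸-+-assoc (deg G u + deg G v) 1 c))))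
      where
      c = commonNbrs G u v
      q : Fin n → Bool
      q y = not (G u y) ∧ not (y == u)
      open TwoStars u v q
      count : ∑ (Nb v) (𝟙 ∘ q) ℤ.+ (ℤ.+ (1 + c)) ℤ.≤ ℤ.+ deg G v
      count = by {e = (∑ (Nb v) (λ _ → ℤ.1ℤ) ℤ.- ∑ (Nb v) (λ y → 𝟙 (q y) ℤ.+ (𝟙 (G u y) ℤ.+ 𝟙 (y == u)))) ℤ.+ (∑ (Nb v) (λ y → 𝟙 (y == u)) ℤ.- ℤ.1ℤ)}
        (⌞ ∑-mono (Nb v) (λ {y} _ → one y) ⌟ ⊕ ⌞ ℤ.≤-trans (ℤ.≤-reflexive (cong 𝟙 (sym (==-refl u)))) (∑-≥-member {f = λ y → 𝟙 (y == u)} (∈-Nb⁺ (sym-G g)) (λ {y} _ → 𝟙≥0 (y == u))) ⌟)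
        (trans (cong₂ (λ z w → z ℤ.- (∑ (Nb v) (𝟙 ∘ q) ℤ.+ (ℤ.1ℤ ℤ.+ w))) (sym (∑-1 (Nb v))) common)
          (trans (lem (∑ (Nb v) (λ _ → ℤ.1ℤ)) (∑ (Nb v) (𝟙 ∘ q)) (∑ (Nb v) (λ y → 𝟙 (G u y))) (∑ (Nb v) (λ y → 𝟙 (y == u))))
            (cong (λ z → (∑ (Nb v) (λ _ → ℤ.1ℤ) ℤ.- z) ℤ.+ (∑ (Nb v) (λ y → 𝟙 (y == u)) ℤ.- ℤ.1ℤ))
              (sym (trans (∑-+ (Nb v) (𝟙 ∘ q) (λ y → 𝟙 (G u y) ℤ.+ 𝟙 (y == u))) (cong (ℤ._+_ (∑ (Nb v) (𝟙 ∘ q))) (∑-+ (Nb v) (λ y → 𝟙 (G u y)) (λ y → 𝟙 (y == u)))))))))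
        where
        lem : ∀ d a b c → d ℤ.- (a ℤ.+ (ℤ.1ℤ ℤ.+ b)) ≡ (d ℤ.- (a ℤ.+ (b ℤ.+ c))) ℤ.+ (c ℤ.- ℤ.1ℤ)
        lem = ℤ.solve-∀
        common : ℤ.+ c ≡ ∑ (Nb v) (λ y → 𝟙 (G u y))
        common = trans (length-filter≡∑ (λ z → G u z ∧ G v z) V) (trans (∑-cong V (λ {z} _ → trans (𝟙-∧ (G u z) (G v z)) (ℤ.*-comm (𝟙 (G u z)) (𝟙 (G v z)))))
          (sym (∑-filter (G v) V (λ y → 𝟙 (G u y)))))
        one : ∀ y → 𝟙 (q y) ℤ.+ (𝟙 (G u y) ℤ.+ 𝟙 (y == u)) ℤ.≤ ℤ.1ℤ
        one y with y == u in e
        ... | true with ==-true {x = y} e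
        ...   | refl rewrite proj₂ simple y = ℤ.≤-refl
        one y | false with G u y
        ... | true = ℤ.≤-refl
        ... | false = ℤ.≤-refl
      smaller : ∀ D → Dominates G′ D → ∃ λ D′ → Dominates G D′ × ∣ D′ ∣ < ∣ D ∣
      smaller D dom with dom v
      ... | inj₁ e = drop-u D dom e (G-≢ (sym-G g)) g
      ... | inj₂ (w , e , k) with kept-facts k
      ...   | _ , _ , w≢u , qw = drop-u D dom e w≢u (not-false (¬true⇒false λ t → true≢false (∧-intro t (not-intro (==-false w≢u))) (qw refl)))

    -- At `v` only the edge to `z` remains. A dominating set that misses `z` must contain `v`, which
    -- then serves nobody but itself and `z`; so `u` and `v` can be traded for `z`.
    bondage-common : ∀ {u v z} → u ≢ v → G u z ≡ true → G z v ≡ true → bondage G ≤ deg G u + deg G v ∸ 1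
    bondage-common {u} {v} {z} u≢v g k = ≤-trans (bondage-≤ smaller) (F-length 1 count)
      where
      q : Fin n → Bool
      q y = not (y == z)
      open TwoStars u v q
      z≢u = G-≢ (sym-G g)
      count : ∑ (Nb v) (𝟙 ∘ q) ℤ.+ ℤ.1ℤ ℤ.≤ ℤ.+ deg G v
      count = by {e = ∑ (Nb v) (λ y → 𝟙 (y == z)) ℤ.- ℤ.1ℤ}
        ⌞ ℤ.≤-trans (ℤ.≤-reflexive (cong 𝟙 (sym (==-refl z)))) (∑-≥-member {f = λ y → 𝟙 (y == z)} (∈-Nb⁺ (sym-G k)) (λ {y} _ → 𝟙≥0 (y == z))) ⌟
        (trans (cong (ℤ._- (∑ (Nb v) (𝟙 ∘ q) ℤ.+ ℤ.1ℤ)) (sym (∑-not (Nb v) (_== z)))) (lem (∑ (Nb v) (λ y → 𝟙 (y == z))) (∑ (Nb v) (𝟙 ∘ q))))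
        where
        lem : ∀ a b → (a ℤ.+ b) ℤ.- (b ℤ.+ ℤ.1ℤ) ≡ a ℤ.- ℤ.1ℤ
        lem = ℤ.solve-∀
      smaller : ∀ D → Dominates G′ D → ∃ λ D′ → Dominates G D′ × ∣ D′ ∣ < ∣ D ∣
      smaller D dom with Bool-cases (lookup D z)
      ... | inj₁ zD = drop-u D dom zD z≢u g
      ... | inj₂ z∉D with dom v
      ...   | inj₂ (w , e , h) with ==-true {x = w} {y = z} (not-false (proj₂ (proj₂ (proj₂ (kept-facts h))) refl))
      ...     | refl = ⊥-elim (true≢false e z∉D)
      smaller D dom | inj₂ z∉D | inj₁ vD = D₃ , dom′ , lt
        where
        D₁ = D [ u ]≔ false
        D₂ = D₁ [ v ]≔ false
        D₃ = D₂ [ z ]≔ true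
        look : ∀ {x} → x ≢ u → x ≢ v → x ≢ z → lookup D₃ x ≡ lookup D x
        look a b c = trans (lookup∘update′ c D₂ true) (trans (lookup∘update′ b D₁ false) (lookup∘update′ a D false))
        zD₃ : lookup D₃ z ≡ true
        zD₃ = lookup∘update z D₂ true
        lt : ∣ D₃ ∣ < ∣ D ∣
        lt = ≤-reflexive (trans (cong suc (trans (∣insert∣ D₂ z (trans (lookup∘update′ (G-≢ k) D₁ false) (trans (lookup∘update′ z≢u D false) z∉D)))
          (∣delete∣ D₁ v (trans (lookup∘update′ (u≢v ∘ sym) D false) vD)))) (∣delete∣ D u (u∈D D dom)))
        dom′ : Dominates G D₃
        dom′ x with x ≟ᶠ u | x ≟ᶠ v | x ≟ᶠ z
        ... | yes refl | _ | _ = inj₂ (z , zD₃ , g)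
        ... | no _ | yes refl | _ = inj₂ (z , zD₃ , sym-G k)
        ... | no _ | no _ | yes refl = inj₁ zD₃
        ... | no a | no b | no c with dom x
        ...   | inj₁ e = inj₁ (trans (look a b c) e)
        ...   | inj₂ (y , e , h) with kept-facts h | y ≟ᶠ z
        ...     | g′ , _ , _ , _ | yes refl = inj₂ (z , zD₃ , g′)
        ...     | g′ , _ , y≢u , _ | no y≢z with y ≟ᶠ v
        ...       | no y≢v = inj₂ (y , trans (look y≢u y≢v y≢z) e , g′)
        ...       | yes refl = ⊥-elim (c (==-true (not-false (from-v h))))
          where
          from-v : G′ x v ≡ true → q x ≡ false
          from-v h = proj₂ (proj₂ (proj₂ (kept-facts (trans (sym-removed v x) h)))) refl
            where
            sym-removed : ∀ a b → G′ a b ≡ G′ b a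
            sym-removed a b = cong₂ _∧_ (proj₁ simple a b) (cong not (any-swap F))
              where
              any-swap : ∀ es → any (λ { (c , d) → (c == a ∧ d == b) ∨ (c == b ∧ d == a) }) es ≡ any (λ { (c , d) → (c == b ∧ d == a) ∨ (c == a ∧ d == b) }) es
              any-swap [] = refl
              any-swap ((c , d) ∷ es) = cong₂ _∨_ (∨-comm (c == a ∧ d == b) (c == b ∧ d == a)) (any-swap es)

    deg≤n : ∀ x → deg G x ≤ n
    deg≤n x = ≤-trans (length-sublist (Unique-Nb x) (λ {y} _ → ∈-allFin y)) (≤-reflexive (length-tabulate (λ y → y)))

    bondage-dist12 : ∀ {x y} → dist12 G x y ≡ true → bondage G ≤ deg G x + deg G y ∸ 1
    bondage-dist12 {x} {y} h with ∧-true h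
    ... | ne , d with ∨-true d
    ...   | inj₁ g = ≤-trans (bondage-adjacent g) (m∸n≤m (deg G x + deg G y ∸ 1) (commonNbrs G x y))
    ...   | inj₂ a with any⁻ (allFin n) a
    ...     | z , _ , e = bondage-common (λ { refl → true≢false (==-refl x) (not-true ne) }) (proj₁ (∧-true e)) (proj₂ (∧-true e))

    bondage≤B′ : ∀ {x y} → G x y ≡ true → bondage G ≤ B′ G
    bondage≤B′ {x₀} {y₀} g = ⊓-glb (foldr-⊓-glb _ default elem₁) (foldr-⊓-glb _ default elem₃)
      where
      default : bondage G ≤ 2 * n
      default = ≤-trans (bondage-adjacent g) (≤-trans (m∸n≤m _ (commonNbrs G x₀ y₀)) (≤-trans (m∸n≤m _ 1)
        (≤-trans (+-mono-≤ (deg≤n x₀) (deg≤n y₀)) (≤-reflexive (cong (n +_) (sym (+-identityʳ n)))))))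
      elem₁ : ∀ {k} → k ∈ map _ (filterᵇ (λ { (x , y) → dist12 G x y }) (cartesianProduct (allFin n) (allFin n))) → bondage G ≤ k
      elem₁ m with ∈-map⁻ (λ { (x , y) → deg G x + deg G y ∸ 1 }) m
      ... | (x , y) , i , refl = bondage-dist12 {x} {y} (proj₂ (∈-filterᵇ⁻ (cartesianProduct (allFin n) (allFin n)) i))
      elem₃ : ∀ {k} → k ∈ map _ (edgeList G) → bondage G ≤ k
      elem₃ m with ∈-map⁻ _ m
      ... | (x , y) , i , refl = ≤-trans (bondage-adjacent (proj₂ (∈-edgeList⁻ i))) (m≤m⊔n _ _)

open BondageBound

-- Vertices of degree below s, and orbits of weight at least twelve

module FaceWeights where
  open import Data.Nat hiding (ℕ; zero; suc; z≤n; s≤s)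
  open import Data.Nat.Properties
  open import Data.Integer as ℤ using (ℤ)
  import Data.Integer.Properties as ℤ

  module Setting {n} (G : Graph n) (simple : Simple G) (R : EmbeddingScheme G) (s : ℕ) (4≤s : 4 ≤ s)
    (far : ∀ {x y} → x ≢ y → (G x y ≡ true ⊎ ∃ λ z → G x z ≡ true × G z y ≡ true) → 2 * s ≤ deg G x + deg G y)
    (triangles : ∀ {x y} → G x y ≡ true → deg G x + deg G y ≤ 2 * s + 1 → 2 * s + commonNbrs G x y ≤ deg G x + deg G y)
    where

    open Embedding G simple R public
    open Orbits G simple R public

    d : Fin n → ℕ
    d = deg G

    inW leaf : Fin n → Bool
    inW x = d x <ᵇ s
    leaf x = d x ≡ᵇ 1

    hasNbr : (Fin n → Bool) → Fin n → Bool
    hasNbr P x = any (λ y → G x y ∧ P y) V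

    -- Safe vertices have distance at least three from every vertex of degree less than `s`.
    nextW safe : Fin n → Bool
    nextW = hasNbr inW
    safe x = not (inW x ∨ (nextW x ∨ hasNbr nextW x))

    W : Fin n → Set
    W x = inW x ≡ true

    hasNbr⁺ : ∀ {P x y} → G x y ≡ true → P y ≡ true → hasNbr P x ≡ true
    hasNbr⁺ {y = y} h p = any⁺ (∈-allFin y) (∧-intro h p)

    hasNbr⁻ : ∀ {P x} → hasNbr P x ≡ true → ∃ λ y → G x y ≡ true × P y ≡ true
    hasNbr⁻ h = let y , _ , e = any⁻ V h in y , ∧-true e

    W⁻ : ∀ {x} → W x → d x < s
    W⁻ = <ᵇ-true

    W⁺ : ∀ {x} → d x < s → W x
    W⁺ = <ᵇ-intro

    ¬W⁻ : ∀ {x} → ¬ W x → s ≤ d x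
    ¬W⁻ h = ≮⇒≥ (λ l → h (W⁺ l))

    leaf⇒W : ∀ {x} → leaf x ≡ true → W x
    leaf⇒W {x} h = W⁺ {x} (subst (_< s) (sym (≡ᵇ-true _ _ h)) (≤-trans (s≤s (s≤s z≤n)) 4≤s))

    sum<⇒⊥ : ∀ {a b} → 2 * s ≤ a + b → a < s → b ≤ s → ⊥
    sum<⇒⊥ {a} {b} h p q = <-irrefl refl (<-≤-trans (+-mono-<-≤ p q) (≤-trans (≤-reflexive (cong (s +_) (sym (+-identityʳ s)))) h))

    far₁ : ∀ {w x} → W w → G w x ≡ true → 2 * s ≤ d w + d x
    far₁ h g = far (G-≢ g) (inj₁ g)

    far₂ : ∀ {w a x} → G w a ≡ true → G a x ≡ true → w ≢ x → 2 * s ≤ d w + d x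
    far₂ g k ne = far ne (inj₂ (_ , g , k))

    W-nbr : ∀ {w x} → W w → G w x ≡ true → s < d x
    W-nbr {w} h g = ≰⇒> (sum<⇒⊥ (far₁ h g) (W⁻ {w} h))

    W-dist2 : ∀ {w a x} → W w → G w a ≡ true → G a x ≡ true → w ≢ x → s < d x
    W-dist2 {w} h g k ne = ≰⇒> (sum<⇒⊥ (far₂ g k ne) (W⁻ {w} h))

    s<⇒¬W : ∀ {x} → s < d x → ¬ W x
    s<⇒¬W {x} l h = <-asym l (W⁻ {x} h)

    -- Two vertices of degree below `s` have degree sum below 2s, so their distance is at least
    -- three.
    W-nbr-unique : ∀ {w w′ a} → W w → W w′ → G a w ≡ true → G a w′ ≡ true → w ≡ w′
    W-nbr-unique {w} {w′} {a} h h′ g g′ with w ≟ᶠ w′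
    ... | yes e = e
    ... | no ne = ⊥-elim (s<⇒¬W {w′} (W-dist2 h (sym-G g) g′ ne) h′)

    safe⇒¬W : ∀ {x} → safe x ≡ true → ¬ W x
    safe⇒¬W h w = true≢false w (proj₁ (∨-false (not-true h)))

    safe⇒¬next : ∀ {x} → safe x ≡ true → nextW x ≡ false
    safe⇒¬next {x} h = proj₁ (∨-false (proj₂ (∨-false {inW x} (not-true h))))

    safe-nbr : ∀ {x y} → safe x ≡ true → G x y ≡ true → ¬ W y
    safe-nbr {x} {y} h g w = true≢false (hasNbr⁺ g w) (safe⇒¬next {x} h)

    next⇒unsafe : ∀ {x w} → W w → G w x ≡ true → safe x ≡ false
    next⇒unsafe h g = ¬true⇒false λ k → safe-nbr k (sym-G g) h

    W⇒unsafe : ∀ {x} → W x → safe x ≡ false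
    W⇒unsafe h = ¬true⇒false λ k → safe⇒¬W k h

    dist2⇒unsafe : ∀ {x a w} → W w → G w a ≡ true → G a x ≡ true → safe x ≡ false
    dist2⇒unsafe {x} h g k = ¬true⇒false λ m → true≢false
      (hasNbr⁺ (sym-G k) (hasNbr⁺ (sym-G g) h)) (proj₂ (∨-false {nextW x} (proj₂ (∨-false {inW x} (not-true m)))))

    safe⁺ : ∀ {x} → ¬ W x → (∀ {y} → G x y ≡ true → ¬ W y) → (∀ {y z} → G x y ≡ true → G y z ≡ true → ¬ W z) → safe x ≡ true
    safe⁺ {x} a b c = not-intro (∨-intro-false (¬true⇒false a) (∨-intro-false
      (¬true⇒false λ h → let y , g , w = hasNbr⁻ {inW} h in b g w)
      (¬true⇒false λ h → let y , g , h′ = hasNbr⁻ {nextW} h ; z , g′ , w = hasNbr⁻ {inW} h′ in c g g′ w)))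
      where
      ∨-intro-false : ∀ {a b} → a ≡ false → b ≡ false → a ∨ b ≡ false
      ∨-intro-false refl refl = refl

    s⇒safe : ∀ {x} → d x ≡ s → safe x ≡ true
    s⇒safe {x} e = safe⁺ ¬Wx (λ g w → <-irrefl (sym e) (W-nbr w (sym-G g))) two
      where
      ¬Wx : ¬ W x
      ¬Wx w = <-irrefl e (W⁻ {x} w)
      two : ∀ {y z} → G x y ≡ true → G y z ≡ true → ¬ W z
      two {y} {z} g k w with z ≟ᶠ x
      ... | yes refl = ¬Wx w
      ... | no ne = <-irrefl (sym e) (W-dist2 w (sym-G k) (sym-G g) ne)

    ¬W⇒2≤ : ∀ {x} → ¬ W x → 2 ≤ d x
    ¬W⇒2≤ {x} h = ≤-trans (≤-trans (s≤s (s≤s z≤n)) 4≤s) (¬W⁻ {x} h)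

    ¬W⇒3≤ : ∀ {x} → ¬ W x → 3 ≤ d x
    ¬W⇒3≤ {x} h = ≤-trans (≤-trans (s≤s (s≤s (s≤s z≤n))) 4≤s) (¬W⁻ {x} h)

    -- Twelve times the share of its orbit that a state stands for.  Corners at vertices of degree less than s
    -- in non-triangular faces, and the returns from leaves, get no share: such faces are long enough without them.
    weight : Bool → Bool → Bool → Bool → ℤ
    weight leafHead smallTail triangle unsafe =
      if leafHead then ℤ.0ℤ else
      if smallTail then (if triangle then ℤ.+ 4 else ℤ.0ℤ) else
      if triangle ∨ unsafe then ℤ.+ 4 else ℤ.+ 3

    unsafeEnds : State → Bool
    unsafeEnds (x , y , _) = not (safe x) ∧ not (safe y)

    wt : State → ℤ
    wt t = weight (leaf (head t)) (inW (tail t)) (tri t) (unsafeEnds t)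

    weight≥0 : ∀ a b c e → ℤ.0ℤ ℤ.≤ weight a b c e
    weight≥0 true b c e = 0≤+
    weight≥0 false true true e = 0≤+
    weight≥0 false true false e = 0≤+
    weight≥0 false false true e = 0≤+
    weight≥0 false false false true = 0≤+
    weight≥0 false false false false = 0≤+

    weight≥3 : ∀ {a b} c e → a ≡ false → b ≡ false → ℤ.+ 3 ℤ.≤ weight a b c e
    weight≥3 true e refl refl = ℤ.+≤+ (s≤s (s≤s (s≤s z≤n)))
    weight≥3 false true refl refl = ℤ.+≤+ (s≤s (s≤s (s≤s z≤n)))
    weight≥3 false false refl refl = ℤ.≤-refl

    weight-unsafe : ∀ {a b} c {e} → a ≡ false → b ≡ false → e ≡ true → weight a b c e ≡ ℤ.+ 4
    weight-unsafe true refl refl refl = refl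
    weight-unsafe false refl refl refl = refl

    weight-tri : ∀ {a} b {c} e → a ≡ false → c ≡ true → weight a b c e ≡ ℤ.+ 4
    weight-tri true e refl refl = refl
    weight-tri false e refl refl = refl

    ¬W⇒¬leaf : ∀ {x} → ¬ W x → leaf x ≡ false
    ¬W⇒¬leaf {x} h = ¬true⇒false λ l → h (leaf⇒W {x} l)

    wt≥3 : ∀ {t} → ¬ W (tail t) → leaf (head t) ≡ false → ℤ.+ 3 ℤ.≤ wt t
    wt≥3 {t} h l = weight≥3 (tri t) (unsafeEnds t) l (¬true⇒false h)

    wt-unsafe : ∀ {t} → ¬ W (tail t) → leaf (head t) ≡ false → safe (tail t) ≡ false → safe (head t) ≡ false → wt t ≡ ℤ.+ 4
    wt-unsafe {t} h l a b = weight-unsafe (tri t) l (¬true⇒false h) (∧-intro (not-intro a) (not-intro b))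

    wt-tri : ∀ {t} → leaf (head t) ≡ false → tri t ≡ true → wt t ≡ ℤ.+ 4
    wt-tri {t} l h = weight-tri (inW (tail t)) (unsafeEnds t) l h

    head-f-≢ : ∀ {t} → Valid t → 2 ≤ d (head t) → head (f t) ≢ tail t
    head-f-≢ {x , y , ε} v h e = <-irrefl refl (≤-trans h (rotS-fix⇒ (sgn x y ε) (sym-G v) e))

    leaf-turn : ∀ {x y} ε → G x y ≡ true → leaf y ≡ true → f (f (x , y , ε)) ≡ (x , rotS x ε y , ε)
    leaf-turn {x} {y} ε v l = trans (cong (λ z → f (y , z , sgn x y ε)) back) (cong (λ b → x , rotS x b y , b) (sgn-inv x y ε))
      where
      back : rotS y (sgn x y ε) x ≡ x
      back = nbr-index-inj (rotS-closed (sgn x y ε) (sym-G v)) (sym-G v)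
        (one (≡ᵇ-true (d y) 1 l) _ _)
        where
        one : ∀ {k} → k ≡ 1 → (i j : Fin k) → i ≡ j
        one refl zero zero = refl

    open Weighted wt (λ t → weight≥0 (leaf (head t)) (inW (tail t)) (tri t) (unsafeEnds t)) (ℤ.+ 12) public

    ≢-tail : ∀ {t u : State} → tail t ≢ tail u → t ≢ u
    ≢-tail h refl = h refl

    safe-≢ : ∀ {x y} → safe x ≡ false → safe y ≡ true → x ≢ y
    safe-≢ a b refl = true≢false b a

    -- Supplies the last 4 of the 12 from the continuation of an orbit beyond the unsafe vertex `c`.
    -- The condition on tails lets these states be told apart from those already selected, whose
    -- tails are unsafe and different from `c`.
    module Third {t} (v : Valid t) (¬Wc : ¬ W (head t)) (unsafe-c : safe (head t) ≡ false) where

      c = head t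
      e = head (f t)
      ve : G c e ≡ true
      ve = f-valid {t} v

      record Result : Set where
        constructor result
        field
          vs : List State
          unique : Unique vs
          orbit : ∀ {u} → u ∈ vs → ∃ λ k → u ≡ iter k f t
          total : ℤ.+ 4 ℤ.≤ ∑ vs wt
          tails : ∀ {u} → u ∈ vs → tail u ≡ c ⊎ safe (tail u) ≡ true

      third : Result
      third with Bool-cases (leaf e)
      ... | inj₁ l = result (iter 3 f t ∷ []) ([] ∷ []) (λ { (here e) → 3 , e })
          (ℤ.≤-reflexive (sym (trans (ℤ.+-identityʳ _) (trans (cong wt after-leaf) wt4))))
          (λ { (here refl) → inj₁ (cong tail after-leaf) })
        where
        ε = proj₂ (proj₂ (f t))
        g = rotS c ε e
        vg : G c g ≡ true
        vg = rotS-closed ε ve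
        after-leaf : iter 3 f t ≡ (c , g , ε)
        after-leaf = leaf-turn ε ve l
        We : W e
        We = leaf⇒W {e} l
        g≢e : g ≢ e
        g≢e q = <-irrefl refl (≤-trans (¬W⇒2≤ {c} ¬Wc) (rotS-fix⇒ ε ve q))
        wt4 : wt (c , g , ε) ≡ ℤ.+ 4
        wt4 = wt-unsafe {c , g , ε} ¬Wc (¬W⇒¬leaf {g} (s<⇒¬W {g} (W-dist2 We (sym-G ve) vg (g≢e ∘ sym)))) unsafe-c
          (dist2⇒unsafe We (sym-G ve) vg)
      ... | inj₂ l with Bool-cases (safe e)
      ...   | inj₂ ns = result (f t ∷ []) ([] ∷ []) (λ { (here e) → 1 , e })
          (ℤ.≤-reflexive (sym (trans (ℤ.+-identityʳ _) (wt-unsafe {f t} ¬Wc l unsafe-c ns))))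
          (λ { (here refl) → inj₁ refl })
      ...   | inj₁ se = result (f t ∷ f (f t) ∷ []) ((≢-tail (safe-≢ unsafe-c se) ∷ []) ∷ [] ∷ [])
          (λ { (here q) → 1 , q ; (there (here q)) → 2 , q })
          (ℤ.≤-trans (ℤ.+≤+ (s≤s (s≤s (s≤s (s≤s z≤n))))) (ℤ.+-mono-≤ (wt≥3 {f t} ¬Wc l)
            (ℤ.+-mono-≤ (wt≥3 {f (f t)} (safe⇒¬W {e} se) (¬W⇒¬leaf {head (f (f t))} (safe-nbr se (f-valid {f t} ve)))) (ℤ.≤-refl {ℤ.0ℤ}))))
          (λ { (here refl) → inj₁ refl ; (there (here refl)) → inj₂ se })

    complete : ∀ {t u r} → ¬ W (head r) → safe (head r) ≡ false → Valid r →
      (∃ λ i → u ≡ iter i f t) → (∃ λ j → r ≡ iter j f t) →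
      wt u ≡ ℤ.+ 4 → wt r ≡ ℤ.+ 4 → safe (tail u) ≡ false → safe (tail r) ≡ false →
      tail u ≢ tail r → tail u ≢ head r → Heavy t
    complete {t} {u} {r} ¬W unsafe v (i , ui) (j , rj) w₁ w₂ s₁ s₂ ne₁ ne₂ =
      heavy (u ∷ r ∷ T.vs) ((≢-tail ne₁ ∷ All.tabulate (λ m → ≢-tail (≢tail ne₂ s₁ (T.tails m)))) ∷
          (All.tabulate (λ m → ≢-tail (≢tail (G-≢ v) s₂ (T.tails m)))) ∷ T.unique)
        (λ { (here q) → i , trans q ui ; (there (here q)) → j , trans q rj
           ; (there (there m)) → let k , q = T.orbit m in k + j , trans q (trans (cong (iter k f) rj) (sym (iter-+ f k j t))) })
        (subst₂ (λ a b → ℤ.+ 12 ℤ.≤ a ℤ.+ (b ℤ.+ ∑ T.vs wt)) (sym w₁) (sym w₂) (ℤ.+-monoʳ-≤ (ℤ.+ 4) (ℤ.+-monoʳ-≤ (ℤ.+ 4) T.total)))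
      where
      module T = Third.Result (Third.third {r} v ¬W unsafe)
      ≢tail : ∀ {x z} → x ≢ head r → safe x ≡ false → z ≡ head r ⊎ safe z ≡ true → x ≢ z
      ≢tail ne sx (inj₁ refl) = ne
      ≢tail ne sx (inj₂ sz) = safe-≢ sx sz

    module SmallFace {t} (v : Valid t) (Ww : W (head (f t))) where

      p = tail t
      a = head t
      w = head (f t)
      va : G a w ≡ true
      va = f-valid {t} v
      s<a : s < d a
      s<a = W-nbr Ww (sym-G va)
      ¬Wa = s<⇒¬W {a} s<a
      unsafe-a : safe a ≡ false
      unsafe-a = next⇒unsafe Ww (sym-G va)

      p≢w : p ≢ w
      p≢w e = head-f-≢ {t} v (¬W⇒2≤ {a} ¬Wa) (sym e)

      -- The boundary runs p, a, w, a, c, where the visit to the leaf earns nothing. The edges pa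
      -- and ac have unsafe ends and weight 4 each, and `p` differs from `c` because `a` has degree
      -- at least three.
      heavy-leaf : leaf w ≡ true → Heavy t
      heavy-leaf l = complete {t} {t} {r} ¬Wc (dist2⇒unsafe Ww (sym-G va) vc) vc (0 , refl) (3 , sym after-leaf)
          (wt-unsafe {t} ¬Wp (¬W⇒¬leaf {a} ¬Wa) (dist2⇒unsafe Ww (sym-G va) (sym-G v)) unsafe-a)
          (wt-unsafe {r} ¬Wa (¬W⇒¬leaf {c} ¬Wc) unsafe-a (dist2⇒unsafe Ww (sym-G va) vc))
          (dist2⇒unsafe Ww (sym-G va) (sym-G v)) unsafe-a (G-≢ v) p≢c
        where
        ε = proj₂ (proj₂ (f t))
        c = rotS a ε w
        r = (a , c , ε)
        vc : G a c ≡ true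
        vc = rotS-closed ε va
        after-leaf : iter 3 f t ≡ r
        after-leaf = leaf-turn ε va l
        w≢c : w ≢ c
        w≢c q = <-irrefl refl (≤-trans (¬W⇒2≤ {a} ¬Wa) (rotS-fix⇒ ε va (sym q)))
        ¬Wc : ¬ W c
        ¬Wc = s<⇒¬W {c} (W-dist2 Ww (sym-G va) vc w≢c)
        ¬Wp : ¬ W p
        ¬Wp = s<⇒¬W {p} (W-dist2 Ww (sym-G va) (sym-G v) (p≢w ∘ sym))
        p≢c : p ≢ c
        p≢c q = <-irrefl refl (≤-trans (¬W⇒3≤ {a} ¬Wa) (rotS-2⇒ ε (sym-G v) (sym q)))

      -- The boundary runs a, w, b, c. The states leaving `a` and `b` have weight 4 each, while the
      -- one leaving `w` counts only in a triangle; otherwise the last 4 must be found beyond `c`.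
      heavy-small : leaf w ≡ false → 2 ≤ d w → Heavy t
      heavy-small l 2≤w = by-tri (Bool-cases (tri (iter 2 f t))) (c ≟ᶠ a)
        where
        b = head (iter 2 f t)
        c = head (iter 3 f t)
        vb : G w b ≡ true
        vb = f^-valid {t} 2 v
        vc : G b c ≡ true
        vc = f^-valid {t} 3 v
        a≢b : a ≢ b
        a≢b q = head-f-≢ {f t} va 2≤w (sym q)
        s<b : s < d b
        s<b = W-nbr Ww vb
        ¬Wb = s<⇒¬W {b} s<b
        w≢c : w ≢ c
        w≢c q = head-f-≢ {iter 2 f t} vb (¬W⇒2≤ {b} ¬Wb) (sym q)
        ¬Wc : ¬ W c
        ¬Wc = s<⇒¬W {c} (W-dist2 Ww vb vc w≢c)
        unsafe-b : safe b ≡ false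
        unsafe-b = next⇒unsafe Ww vb
        unsafe-c : safe c ≡ false
        unsafe-c = dist2⇒unsafe Ww vb vc
        wt₁ : wt (f t) ≡ ℤ.+ 4
        wt₁ = wt-unsafe {f t} ¬Wa l unsafe-a (W⇒unsafe Ww)
        wt₃ : wt (iter 3 f t) ≡ ℤ.+ 4
        wt₃ = wt-unsafe {iter 3 f t} ¬Wb (¬W⇒¬leaf {c} ¬Wc) unsafe-b unsafe-c
        three : ∀ {x y z : State} → wt x ≡ ℤ.+ 4 → wt y ≡ ℤ.+ 4 → wt z ≡ ℤ.+ 4 → ℤ.+ 12 ℤ.≤ ∑ (x ∷ y ∷ z ∷ []) wt
        three p q r = ℤ.≤-reflexive (sym (cong₂ ℤ._+_ p (cong₂ ℤ._+_ q (trans (ℤ.+-identityʳ _) r))))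
        by-tri : tri (iter 2 f t) ≡ true ⊎ tri (iter 2 f t) ≡ false → Dec (c ≡ a) → Heavy t
        by-tri (inj₁ h) _ = heavy (f t ∷ iter 2 f t ∷ iter 3 f t ∷ [])
          ((≢-tail (G-≢ va) ∷ ≢-tail a≢b ∷ []) ∷ (≢-tail (G-≢ vb) ∷ []) ∷ [] ∷ [])
          (λ { (here q) → 1 , q ; (there (here q)) → 2 , q ; (there (there (here q))) → 3 , q })
          (three {f t} {iter 2 f t} {iter 3 f t} wt₁ (wt-tri {iter 2 f t} (¬W⇒¬leaf {b} ¬Wb) h) wt₃)
        by-tri (inj₂ h) (no c≢a) = complete {t} {f t} {iter 3 f t} ¬Wc unsafe-c vc (1 , refl) (3 , refl) wt₁ wt₃ unsafe-a unsafe-b a≢b (c≢a ∘ sym)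
        -- The boundary is back at `a` after three steps without closing up, so it now leaves `a` by
        -- a state different from `f t`. That state does not lead to a leaf: `w` is the only
        -- neighbour of `a` of degree below `s`, and it is no leaf.
        by-tri (inj₂ h) (yes c≡a) = heavy (f t ∷ iter 3 f t ∷ iter 4 f t ∷ [])
          ((≢-tail a≢b ∷ ne ∷ []) ∷ (≢-tail (G-≢ vc) ∷ []) ∷ [] ∷ [])
          (λ { (here q) → 1 , q ; (there (here q)) → 3 , q ; (there (there (here q))) → 4 , q })
          (three {f t} {iter 3 f t} {iter 4 f t} wt₁ wt₃
            (wt-unsafe {iter 4 f t} ¬Wc leaf-e unsafe-c (dist2⇒unsafe Ww (sym-G va) vae)))
          where
          e = head (iter 4 f t)
          vae : G a e ≡ true
          vae = trans (cong (λ z → G z e) (sym c≡a)) (f^-valid {t} 4 v)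
          leaf-e : leaf e ≡ false
          leaf-e = ¬true⇒false λ q → true≢false (trans (cong leaf (W-nbr-unique Ww (leaf⇒W {e} q) va vae)) q) l
          ne : f t ≢ iter 4 f t
          ne q = true≢false (tri-f {f t} (tri⁺ {f t} (sym q))) h

      small-heavy : Heavy t
      small-heavy with Bool-cases (leaf w)
      ... | inj₁ l = heavy-leaf l
      ... | inj₂ l = heavy-small l (≤∧≢⇒< (deg≥1 (sym-G va)) (λ q → true≢false (trans (cong (_≡ᵇ 1) (sym q)) (≡ᵇ-refl 1)) l))

    -- A triangle has three states of weight 4. Otherwise four successive states are distinct, since
    -- the degrees exclude turning back and `tri` fails, and each has weight at least 3.
    big-heavy : ∀ {t} → Valid t → ¬ W (tail t) → ¬ W (head t) → ¬ W (head (f t)) → ¬ W (head (iter 2 f t)) → ¬ W (head (iter 3 f t)) → Heavy t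
    big-heavy {t} v h₀ h₁ h₂ h₃ h₄ = by-tri (Bool-cases (tri t))
      where
      x≢z : tail t ≢ head (f t)
      x≢z q = head-f-≢ {t} v (¬W⇒2≤ {head t} h₁) (sym q)
      y≢u : head t ≢ head (iter 2 f t)
      y≢u q = head-f-≢ {f t} (f-valid {t} v) (¬W⇒2≤ {head (f t)} h₂) (sym q)
      by-tri : tri t ≡ true ⊎ tri t ≡ false → Heavy t
      by-tri (inj₁ h) = heavy (t ∷ f t ∷ iter 2 f t ∷ [])
        ((≢-tail (G-≢ v) ∷ ≢-tail x≢z ∷ []) ∷ (≢-tail (G-≢ (f-valid {t} v)) ∷ []) ∷ [] ∷ [])
        (λ { (here q) → 0 , q ; (there (here q)) → 1 , q ; (there (there (here q))) → 2 , q })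
        (ℤ.≤-reflexive (sym (cong₂ ℤ._+_ (wt-tri {t} (¬W⇒¬leaf {head t} h₁) h)
          (cong₂ ℤ._+_ (wt-tri {f t} (¬W⇒¬leaf {head (f t)} h₂) (tri-f {t} h))
            (trans (ℤ.+-identityʳ _) (wt-tri {iter 2 f t} (¬W⇒¬leaf {head (iter 2 f t)} h₃) (tri-f {f t} (tri-f {t} h))))))))
      by-tri (inj₂ h) = heavy (t ∷ f t ∷ iter 2 f t ∷ iter 3 f t ∷ [])
        ((≢-tail (G-≢ v) ∷ ≢-tail x≢z ∷ (λ q → true≢false (tri⁺ {t} (sym q)) h) ∷ []) ∷
         (≢-tail (G-≢ (f-valid {t} v)) ∷ ≢-tail y≢u ∷ []) ∷ (≢-tail (G-≢ (f^-valid {t} 2 v)) ∷ []) ∷ [] ∷ [])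
        (λ { (here q) → 0 , q ; (there (here q)) → 1 , q ; (there (there (here q))) → 2 , q ; (there (there (there (here q)))) → 3 , q })
        (ℤ.+-mono-≤ (wt≥3 {t} h₀ (¬W⇒¬leaf {head t} h₁)) (ℤ.+-mono-≤ (wt≥3 {f t} h₁ (¬W⇒¬leaf {head (f t)} h₂))
          (ℤ.+-mono-≤ (wt≥3 {iter 2 f t} h₂ (¬W⇒¬leaf {head (iter 2 f t)} h₃))
            (ℤ.+-mono-≤ (wt≥3 {iter 3 f t} h₃ (¬W⇒¬leaf {head (iter 3 f t)} h₄)) (ℤ.≤-refl {ℤ.0ℤ})))))

    first-true : ∀ (q : ℕ → Bool) m → (∃ λ k → q k ≡ true) ⊎ (∀ k → k < m → q k ≡ false)
    first-true q zero = inj₂ λ _ ()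
    first-true q (suc m) with first-true q m | Bool-cases (q m)
    ... | inj₁ e | _ = inj₁ e
    ... | inj₂ _ | inj₁ e = inj₁ (m , e)
    ... | inj₂ h | inj₂ e = inj₂ λ k k< → last k (≤-pred k<)
      where
      last : ∀ k → k ≤ m → q k ≡ false
      last k k≤ with m≤n⇒m<n∨m≡n k≤
      ... | inj₁ l = h k l
      ... | inj₂ refl = e

    all-heavy : ∀ {t} → Valid t → Heavy t
    all-heavy {t} v = by-case (first-true q 5)
      where
      q : ℕ → Bool
      q k = inW (head (iter (suc k) f t))
      by-case : (∃ λ k → q k ≡ true) ⊎ (∀ k → k < 5 → q k ≡ false) → Heavy t
      by-case (inj₁ (k , Ww)) = Heavy-iter {t} k (SmallFace.small-heavy {iter k f t} (f^-valid {t} k v) Ww)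
      -- The five heads examined are the tail of `iter 2 f t` and the four heads from there on.
      by-case (inj₂ h) = Heavy-iter {t} 2 (big-heavy {iter 2 f t} (f^-valid {t} 2 v) (¬W 0 refl) (¬W 1 refl) (¬W 2 refl) (¬W 3 refl) (¬W 4 refl))
        where
        ¬W : ∀ k → (suc k ≤ᵇ 5) ≡ true → q k ≡ true → ⊥
        ¬W k l e = true≢false e (h k (≤ᵇ-true l))

open FaceWeights

-- Charges and discharging rules

module Charges where
  open import Data.Nat as ℕ using (_≡ᵇ_)
  import Data.Nat.Properties as ℕ
  open import Data.Integer hiding (suc)
  open import Data.Integer.Properties
  open import Data.Integer.Tactic.RingSolver using (solve-∀)
  open import Data.List using (applyUpTo)
  open import Data.Nat.DivMod using (m/n*n≤m)
  open import Relation.Nullary.Decidable using (toWitness; True)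

  lit : ∀ {a b} {_ : True (a ≤? b)} → a ≤ b
  lit {_} {_} {h} = toWitness h

  𝟙-not : ∀ b → 𝟙 (not b) ≡ 1ℤ - 𝟙 b
  𝟙-not true = refl
  𝟙-not false = refl

  ∑-δ : ∀ {J : List ℕ} (g : ℕ → ℤ) {m} → Unique J → m ∈ J → ∑ J (λ j → g j * 𝟙 (m ≡ᵇ j)) ≡ g m
  ∑-δ {j ∷ J} g {m} (j∉ ∷ u) (here refl) = trans (cong₂ _+_ (trans (cong (λ b → g m * 𝟙 b) (≡ᵇ-refl m)) (*-identityʳ (g m)))
    (trans (∑-cong J (λ {k} i → trans (cong (λ b → g k * 𝟙 b) (¬true⇒false λ e → All.lookup j∉ i (≡ᵇ-true m k e))) (*-zeroʳ (g k)))) (∑-0 J))) (+-identityʳ (g m))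
  ∑-δ {j ∷ J} g {m} (j∉ ∷ u) (there i) = trans (cong₂ _+_
    (trans (cong (λ b → g j * 𝟙 b) (¬true⇒false λ e → All.lookup j∉ i (sym (≡ᵇ-true m j e)))) (*-zeroʳ (g j))) (∑-δ g u i)) (+-identityˡ (g m))

  ∑-δ-∉ : ∀ (J : List ℕ) (g : ℕ → ℤ) {m} → ¬ m ∈ J → ∑ J (λ j → g j * 𝟙 (m ≡ᵇ j)) ≡ 0ℤ
  ∑-δ-∉ J g {m} m∉ = trans (∑-cong J (λ {k} i → trans (cong (λ b → g k * 𝟙 b)
    (¬true⇒false λ e → m∉ (subst (_∈ J) (sym (≡ᵇ-true m k e)) i))) (*-zeroʳ (g k)))) (∑-0 J)

  module Discharging {n} (G : Graph n) (simple : Simple G) (R : EmbeddingScheme G) (s : ℕ) (4≤s : 4 ℕ.≤ s)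
    (far : ∀ {x y} → x ≢ y → (G x y ≡ true ⊎ ∃ λ z → G x z ≡ true × G z y ≡ true) → 2 ℕ.* s ℕ.≤ deg G x ℕ.+ deg G y)
    (triangles : ∀ {x y} → G x y ≡ true → deg G x ℕ.+ deg G y ℕ.≤ 2 ℕ.* s ℕ.+ 1 → 2 ℕ.* s ℕ.+ commonNbrs G x y ℕ.≤ deg G x ℕ.+ deg G y)
    (nbr : ∀ x → ∃ λ y → G x y ≡ true)
    (I : Fin n → Bool) (I-deg : ∀ {x} → I x ≡ true → deg G x ≡ s) (I-indep : ∀ {x y} → I x ≡ true → I y ≡ true → ¬ G x y ≡ true)
    (I-maximal : ∀ {x} → deg G x ≡ s → I x ≡ false → ∃ λ y → I y ≡ true × G x y ≡ true)
    where

    open Setting G simple R s 4≤s far triangles public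

    S : ℤ
    S = + s

    D : Fin n → ℤ
    D x = + d x

    4≤S : + 4 ≤ S
    4≤S = +≤+ 4≤s

    deg1≤ : ∀ x → 1 ℕ.≤ d x
    deg1≤ x = deg≥1 (proj₂ (nbr x))

    common≥1 : ∀ {x y z} → G x z ≡ true → G y z ≡ true → 1 ℕ.≤ commonNbrs G x y
    common≥1 {x} {y} {z} h k = length-sublist {xs = z ∷ []} ([] ∷ []) (λ { (here refl) → ∈-filterᵇ⁺ {p = λ z → G x z ∧ G y z} (∈-allFin z) (∧-intro h k) })

    common≥2 : ∀ {x y z z′} → z ≢ z′ → G x z ≡ true → G y z ≡ true → G x z′ ≡ true → G y z′ ≡ true → 2 ℕ.≤ commonNbrs G x y
    common≥2 {x} {y} {z} {z′} ne h k h′ k′ = length-sublist {xs = z ∷ z′ ∷ []} ((ne ∷ []) ∷ [] ∷ [])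
      (λ { (here refl) → ∈-filterᵇ⁺ {p = λ z → G x z ∧ G y z} (∈-allFin z) (∧-intro h k)
         ; (there (here refl)) → ∈-filterᵇ⁺ {p = λ z → G x z ∧ G y z} (∈-allFin z′) (∧-intro h′ k′) })

    no-common : ∀ {x y z} → G x y ≡ true → d x ℕ.+ d y ℕ.≤ 2 ℕ.* s → G x z ≡ true → G y z ≡ true → ⊥
    no-common {x} {y} g le h k = ℕ.1+n≰n (ℕ.≤-trans (ℕ.≤-reflexive (ℕ.+-comm 1 (2 ℕ.* s)))
      (ℕ.≤-trans (ℕ.+-monoʳ-≤ (2 ℕ.* s) (common≥1 {x} {y} h k)) (ℕ.≤-trans (triangles g (ℕ.≤-trans le (ℕ.m≤m+n _ 1))) le)))

    no-tri : ∀ {x y} ε → G x y ≡ true → d x ℕ.+ d y ℕ.≤ 2 ℕ.* s → tri (x , y , ε) ≡ false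
    no-tri {x} {y} ε g le = ¬true⇒false λ h → no-common g le (rotS-closed (not ε) g) (tri-adj {x} {y} {ε} g h)

    -- The third vertices of the two triangles are the successor and the predecessor of `y` in the
    -- rotation at `x`. They differ when `x` has degree at least three, and then are two common
    -- neighbours.
    one-tri : ∀ {x y} → G x y ≡ true → d x ℕ.+ d y ℕ.≤ 2 ℕ.* s ℕ.+ 1 → 3 ℕ.≤ d x →
      tri (x , y , true) ≡ true → tri (x , y , false) ≡ true → ⊥
    one-tri {x} {y} g le 3≤ h k = ℕ.1+n≰n (ℕ.≤-trans (ℕ.≤-reflexive (trans (cong suc (ℕ.+-comm (2 ℕ.* s) 1)) (ℕ.+-comm 2 (2 ℕ.* s))))
      (ℕ.≤-trans (ℕ.+-monoʳ-≤ (2 ℕ.* s) (common≥2 {x} {y} (λ e → ℕ.1+n≰n (ℕ.≤-trans 3≤ (rotS-sides⇒ true g (sym e))))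
        (rotS-closed false g) (tri-adj {x} {y} {true} g h) (rotS-closed true g) (tri-adj {x} {y} {false} g k)))
        (ℕ.≤-trans (triangles g le) le)))

    trc : Fin n → Fin n → ℤ
    trc x y = 𝟙 (tri (x , y , true)) + 𝟙 (tri (x , y , false))

    tri-rev : ∀ {x y} ε → G x y ≡ true → 𝟙 (tri (x , y , ε)) ≡ 𝟙 (tri (y , x , not (sgn x y ε)))
    tri-rev {x} {y} ε g = ≤-antisym (𝟙-mono (tri t) (tri (ρ t)) (tri-ρ {t} g))
      (𝟙-mono (tri (ρ t)) (tri t) (λ h → subst (λ u → tri u ≡ true) (ρ-ρ t) (tri-ρ {ρ t} (sym-G g) h)))
      where
      t : State
      t = x , y , ε

    trc-sym : ∀ {x y} → G x y ≡ true → trc x y ≡ trc y x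
    trc-sym {x} {y} g = trans (cong₂ _+_ (tri-rev true g) (tri-rev false g)) (swap (sgn x y true) (sgn x y false) (sgn-not x y true))
      where
      swap : ∀ a b → b ≡ not a → 𝟙 (tri (y , x , not a)) + 𝟙 (tri (y , x , not b)) ≡ trc y x
      swap true false refl = +-comm (𝟙 (tri (y , x , false))) (𝟙 (tri (y , x , true)))
      swap false true refl = refl

    trc≤2 : ∀ x y → trc x y ≤ + 2
    trc≤2 x y = +-mono-≤ (𝟙≤1 (tri (x , y , true))) (𝟙≤1 (tri (x , y , false)))

    cast : ∀ k {a b} → 2 ℕ.* s ℕ.+ k ℕ.≤ a ℕ.+ b → + k + + 2 * S ≤ + a + + b
    cast k h = subst (_≤ _) (trans (cong (_+ + k) (pos-* 2 s)) (+-comm (+ 2 * S) (+ k))) (+≤+ h)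

    trc-bound′ : ∀ {x y} → G x y ≡ true → 3 ℕ.≤ d x → trc x y + + 2 * S ≤ D x + D y
    trc-bound′ {x} {y} g 3≤ with ℕ.<-cmp (d x ℕ.+ d y) (2 ℕ.* s ℕ.+ 1)
    ... | tri> _ _ gt = ≤-trans (+-monoˡ-≤ (+ 2 * S) (trc≤2 x y)) (cast 2 {d x} {d y} (ℕ.≤-trans (ℕ.≤-reflexive (ℕ.+-suc (2 ℕ.* s) 1)) gt))
    ... | tri≈ _ e _ = ≤-trans (+-monoˡ-≤ (+ 2 * S) (le1 (tri (x , y , true)) (tri (x , y , false)) (one-tri g (ℕ.≤-reflexive e) 3≤)))
        (cast 1 {d x} {d y} (ℕ.≤-reflexive (sym e)))
      where
      le1 : ∀ a b → (a ≡ true → b ≡ true → ⊥) → 𝟙 a + 𝟙 b ≤ 1ℤ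
      le1 true true h = ⊥-elim (h refl refl)
      le1 true false h = ≤-refl
      le1 false b h = subst (_≤ 1ℤ) (sym (+-identityˡ (𝟙 b))) (𝟙≤1 b)
    ... | tri< lt _ _ = ≤-trans (≤-reflexive (cong (_+ + 2 * S) zero-tri)) (cast 0 {d x} {d y} (ℕ.≤-trans (ℕ.≤-reflexive (ℕ.+-identityʳ (2 ℕ.* s))) (far (G-≢ g) (inj₁ g))))
      where
      le : d x ℕ.+ d y ℕ.≤ 2 ℕ.* s
      le = ℕ.≤-pred (ℕ.≤-trans lt (ℕ.≤-reflexive (ℕ.+-comm (2 ℕ.* s) 1)))
      zero-tri : trc x y ≡ 0ℤ
      zero-tri = cong₂ (λ a b → 𝟙 a + 𝟙 b) (no-tri true g le) (no-tri false g le)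

    -- Degree sum 2s admits no triangular side and 2s + 1 at most one. If `x` may have degree below
    -- three, the count is made at `y`, which then has degree above `s`.
    trc-bound : ∀ {x y} → G x y ≡ true → trc x y + + 2 * S ≤ D x + D y
    trc-bound {x} {y} g with Bool-cases (inW x)
    ... | inj₂ e = trc-bound′ g (¬W⇒3≤ {x} (λ h → true≢false h e))
    ... | inj₁ Wx = subst₂ _≤_ (cong (_+ + 2 * S) (sym (trc-sym g))) (+-comm (D y) (D x))
      (trc-bound′ (sym-G g) (¬W⇒3≤ {y} (s<⇒¬W {y} (W-nbr Wx g))))

    -- 12 · 14 (|E| − |F|) is at least the sum of these values over the 4 |E| states: every face is traced by two orbits,
    -- and an orbit has weight at least 12.
    value : ℤ → ℤ
    value w = + 42 - + 7 * w

    val : State → ℤ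
    val t = value (wt t)

    vals : Fin n → Fin n → ℤ
    vals x y = val (x , y , true) + val (x , y , false)

    value-any : ∀ a b c e → + 14 ≤ value (weight a b c e)
    value-any true b c e = lit
    value-any false true true e = lit
    value-any false true false e = lit
    value-any false false true e = lit
    value-any false false false true = lit
    value-any false false false false = lit

    value-small : ∀ a {b} c e → b ≡ true → + 42 - + 28 * 𝟙 c ≤ value (weight a b c e)
    value-small true true e refl = lit
    value-small true false e refl = lit
    value-small false true e refl = lit
    value-small false false e refl = lit

    value-safe : ∀ a {b} c {e} → b ≡ false → e ≡ false → + 21 - + 7 * 𝟙 c ≤ value (weight a b c e)
    value-safe true true refl refl = lit
    value-safe true false refl refl = lit
    value-safe false true refl refl = lit
    value-safe false false refl refl = lit

    val≥14 : ∀ t → + 14 ≤ val t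
    val≥14 t = value-any (leaf (head t)) (inW (tail t)) (tri t) (unsafeEnds t)

    vals≥28 : ∀ x y → + 28 ≤ vals x y
    vals≥28 x y = +-mono-≤ (val≥14 (x , y , true)) (val≥14 (x , y , false))

    vals-leaf : ∀ x {y} → leaf y ≡ true → vals x y ≡ + 84
    vals-leaf x {y} l = cong₂ (λ a b → value a + value b) (zero-wt (inW x) (tri (x , y , true)) (unsafeEnds (x , y , true)) l) (zero-wt (inW x) (tri (x , y , false)) (unsafeEnds (x , y , false)) l)
      where
      zero-wt : ∀ {a} b c e → a ≡ true → weight a b c e ≡ 0ℤ
      zero-wt b c e refl = refl

    vals-small : ∀ {x} y → W x → + 84 - + 28 * trc x y ≤ vals x y
    vals-small {x} y h = ≤-trans (≤-reflexive (lem (𝟙 (tri (x , y , true))) (𝟙 (tri (x , y , false)))))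
      (+-mono-≤ (value-small (leaf y) (tri (x , y , true)) (unsafeEnds (x , y , true)) h) (value-small (leaf y) (tri (x , y , false)) (unsafeEnds (x , y , false)) h))
      where
      lem : ∀ a b → + 84 - + 28 * (a + b) ≡ (+ 42 - + 28 * a) + (+ 42 - + 28 * b)
      lem = solve-∀

    vals-safe : ∀ {x y} → ¬ W x → safe x ≡ true ⊎ safe y ≡ true → + 42 - + 7 * trc x y ≤ vals x y
    vals-safe {x} {y} h sf = ≤-trans (≤-reflexive (lem (𝟙 (tri (x , y , true))) (𝟙 (tri (x , y , false)))))
      (+-mono-≤ (value-safe (leaf y) (tri (x , y , true)) (¬true⇒false h) (ends sf)) (value-safe (leaf y) (tri (x , y , false)) (¬true⇒false h) (ends sf)))
      where
      lem : ∀ a b → + 42 - + 7 * (a + b) ≡ (+ 21 - + 7 * a) + (+ 21 - + 7 * b)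
      lem = solve-∀
      ends : safe x ≡ true ⊎ safe y ≡ true → not (safe x) ∧ not (safe y) ≡ false
      ends (inj₁ e) = cong (λ b → not b ∧ not (safe y)) e
      ends (inj₂ e) = trans (cong (λ b → not (safe x) ∧ not b) e) (∧-falseʳ (not (safe x)))
        where
        ∧-falseʳ : ∀ b → b ∧ false ≡ false
        ∧-falseʳ true = refl
        ∧-falseʳ false = refl

    mids : List ℕ
    mids = drop 3 (upTo s)

    -- 14 plus the share of `x` in the right-hand side of the hypothesis, with membership in `I` in
    -- place of the independence number.
    need : Fin n → ℤ
    need x = + 14 + + 2 * (S - + 5) + (S - + 4) * 𝟙 (I x) + + 4 * 𝟙 (d x ℕ.≤ᵇ 2) + + 2 * ∑ mids (λ j → (+ 5 - + j) * 𝟙 (d x ≡ᵇ j))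

    mids≡ : mids ≡ applyUpTo (3 ℕ.+_) (s ℕ.∸ 3)
    mids≡ = trans (cong (λ k → drop 3 (upTo k)) (sym (ℕ.m+[n∸m]≡n (ℕ.≤-trans (s≤s (s≤s (s≤s z≤n))) 4≤s)))) refl

    mids-unique : Unique mids
    mids-unique = subst Unique (sym mids≡) (applyUpTo⁺₁ (3 ℕ.+_) (s ℕ.∸ 3) (λ i<j _ e → ℕ.<-irrefl (ℕ.+-cancelˡ-≡ 3 _ _ e) i<j))

    ∈-mids⁺ : ∀ {j} → 3 ℕ.≤ j → j ℕ.< s → j ∈ mids
    ∈-mids⁺ {j} 3≤ j<s = subst (_∈ mids) (ℕ.m+[n∸m]≡n 3≤) (subst (3 ℕ.+ (j ℕ.∸ 3) ∈_) (sym mids≡)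
      (∈-applyUpTo⁺ (3 ℕ.+_) (ℕ.∸-monoˡ-< j<s 3≤)))

    ∈-mids⁻ : ∀ {j} → j ∈ mids → 3 ℕ.≤ j × j ℕ.< s
    ∈-mids⁻ {j} m with ∈-applyUpTo⁻ (3 ℕ.+_) (subst (j ∈_) mids≡ m)
    ... | i , i< , refl = ℕ.m≤m+n 3 i , ℕ.≤-trans (ℕ.+-monoʳ-< 3 i<) (ℕ.≤-reflexive (ℕ.m+[n∸m]≡n (ℕ.≤-trans (s≤s (s≤s (s≤s z≤n))) 4≤s)))

    ≢s⇒¬I : ∀ {x} → d x ≢ s → I x ≡ false
    ≢s⇒¬I h = ¬true⇒false (h ∘ I-deg)

    needAt : ℤ → ℤ → ℤ → ℤ
    needAt i l m = + 14 + + 2 * (S - + 5) + (S - + 4) * i + + 4 * l + + 2 * m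

    need-big : ∀ {x} → s ℕ.≤ d x → need x ≡ + 2 * S + + 4 + (S - + 4) * 𝟙 (I x)
    need-big {x} h = trans (cong₂ (λ l m → needAt (𝟙 (I x)) (𝟙 l) m)
        (¬true⇒false λ e → ℕ.1+n≰n (ℕ.≤-trans (ℕ.≤-trans (ℕ.≤-trans (s≤s (s≤s (s≤s z≤n))) 4≤s) h) (≤ᵇ-true e)))
        (∑-δ-∉ mids (λ j → + 5 - + j) (λ m → ℕ.<-irrefl refl (ℕ.<-≤-trans (proj₂ (∈-mids⁻ m)) h))))
      (lem S (𝟙 (I x)))
      where
      lem : ∀ S i → + 14 + + 2 * (S - + 5) + (S - + 4) * i + + 4 * 0ℤ + + 2 * 0ℤ ≡ + 2 * S + + 4 + (S - + 4) * i
      lem = solve-∀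

    need-¬I : ∀ {x} → s ℕ.≤ d x → I x ≡ false → need x ≡ + 2 * S + + 4
    need-¬I {x} h i = trans (need-big {x} h) (trans (cong (λ b → + 2 * S + + 4 + (S - + 4) * 𝟙 b) i) (lem S))
      where
      lem : ∀ S → + 2 * S + + 4 + (S - + 4) * 0ℤ ≡ + 2 * S + + 4
      lem = solve-∀

    need-mid : ∀ {x} → 3 ℕ.≤ d x → W x → need x ≡ + 2 * S + + 14 - + 2 * D x
    need-mid {x} h w = trans (cong (λ b → needAt (𝟙 b) (𝟙 (d x ℕ.≤ᵇ 2)) (∑ mids (λ j → (+ 5 - + j) * 𝟙 (d x ≡ᵇ j)))) (≢s⇒¬I (ℕ.<⇒≢ (W⁻ {x} w))))
      (trans (cong₂ (λ l m → needAt 0ℤ (𝟙 l) m) (¬true⇒false λ e → ℕ.1+n≰n (ℕ.≤-trans h (≤ᵇ-true e)))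
        (∑-δ (λ j → + 5 - + j) mids-unique (∈-mids⁺ h (W⁻ {x} w)))) (lem S (D x)))
      where
      lem : ∀ S j → + 14 + + 2 * (S - + 5) + (S - + 4) * 0ℤ + + 4 * 0ℤ + + 2 * (+ 5 - j) ≡ + 2 * S + + 14 - + 2 * j
      lem = solve-∀

    need-low : ∀ {x} → d x ℕ.≤ 2 → need x ≡ + 2 * S + + 8
    need-low {x} h = trans (cong (λ b → needAt (𝟙 b) (𝟙 (d x ℕ.≤ᵇ 2)) (∑ mids (λ j → (+ 5 - + j) * 𝟙 (d x ≡ᵇ j))))
        (≢s⇒¬I (ℕ.<⇒≢ (ℕ.≤-trans (s≤s h) (ℕ.≤-trans (s≤s (s≤s (s≤s z≤n))) 4≤s)))))
      (trans (cong₂ (λ l m → needAt 0ℤ (𝟙 l) m) (≤ᵇ-intro h)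
        (∑-δ-∉ mids (λ j → + 5 - + j) (λ m → ℕ.1+n≰n (ℕ.≤-trans (proj₁ (∈-mids⁻ m)) h)))) (lem S))
      where
      lem : ∀ S → + 14 + + 2 * (S - + 5) + (S - + 4) * 0ℤ + + 4 * 1ℤ + + 2 * 0ℤ ≡ + 2 * S + + 8
      lem = solve-∀

    ch : Fin n → ℤ
    ch x = ∑ (Nb x) (vals x) - + 12 * need x

    -- Charge sent from u to v.  A vertex of degree less than s absorbs its neighbours.  A vertex of I is short of 4 on every
    -- triangular side of its edges and has 3 to spare on every other side; neighbours of larger degree make up for the
    -- shortage, and a neighbour of degree s, across an edge in no triangle, receives the surplus 6.
    choose : Bool → Bool → ℤ → ℤ → ℤ → ℤ
    choose true _ a b c = a
    choose false true a b c = b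
    choose false false a b c = c

    gift : Fin n → Fin n → ℤ
    gift u v = choose (d u ≡ᵇ s) (d u ≡ᵇ suc s) (- + 6) 1ℤ (+ 4 * trc u v)

    flow : Fin n → Fin n → ℤ
    flow u v = choose (inW v) (I v) (ch u) (gift u v) 0ℤ

    ch′ : Fin n → ℤ
    ch′ x = ch x + ∑ (Nb x) (λ v → flow v x) - ∑ (Nb x) (flow x)

    ∑-ch′ : ∑ V ch′ ≡ ∑ V ch
    ∑-ch′ = trans (∑-- V (λ x → ch x + ∑ (Nb x) (λ v → flow v x)) (λ x → ∑ (Nb x) (flow x)))
      (trans (cong₂ _-_ (∑-+ V ch (λ x → ∑ (Nb x) (λ v → flow v x))) outflow) (lem (∑ V ch) (∑ V (λ x → ∑ (Nb x) (λ v → flow v x)))))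
      where
      lem : ∀ a b → a + b - b ≡ a
      lem = solve-∀
      outflow : ∑ V (λ x → ∑ (Nb x) (flow x)) ≡ ∑ V (λ x → ∑ (Nb x) (λ v → flow v x))
      outflow = trans (∑-cong V (λ {x} _ → ∑-filter (G x) V (flow x)))
        (trans (∑-comm V V (λ x v → 𝟙 (G x v) * flow x v))
        (trans (∑-cong V (λ {v} _ → ∑-cong V (λ {x} _ → cong (λ b → 𝟙 b * flow x v) (proj₁ simple x v))))
          (∑-cong V (λ {v} _ → sym (∑-filter (G v) V (λ x → flow x v))))))

    choose₁ : ∀ {p} q {a b c} → p ≡ true → choose p q a b c ≡ a
    choose₁ q refl = refl

    choose₂ : ∀ {p q a b c} → p ≡ false → q ≡ true → choose p q a b c ≡ b
    choose₂ refl refl = refl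

    choose₃ : ∀ {p q a b c} → p ≡ false → q ≡ false → choose p q a b c ≡ c
    choose₃ refl refl = refl

    flow-W : ∀ u {v} → W v → flow u v ≡ ch u
    flow-W u {v} h = choose₁ (I v) h

    flow-0 : ∀ u {v} → ¬ W v → I v ≡ false → flow u v ≡ 0ℤ
    flow-0 u h i = choose₃ (¬true⇒false h) i

    safe-I : ∀ {x} → I x ≡ true → safe x ≡ true
    safe-I h = s⇒safe (I-deg h)

    I⇒¬W : ∀ {x} → I x ≡ true → ¬ W x
    I⇒¬W h = safe⇒¬W (safe-I h)

    flow-I : ∀ u {v} → I v ≡ true → flow u v ≡ gift u v
    flow-I u h = choose₂ (¬true⇒false (I⇒¬W h)) h

    flow-I-s : ∀ {u v} → I v ≡ true → d u ≡ s → flow u v ≡ - + 6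
    flow-I-s {u} h e = trans (flow-I u h) (choose₁ (d u ≡ᵇ suc s) (trans (cong (_≡ᵇ s) e) (≡ᵇ-refl s)))

    flow-I-s+1 : ∀ {u v} → I v ≡ true → d u ≡ suc s → flow u v ≡ 1ℤ
    flow-I-s+1 {u} h e = trans (flow-I u h) (choose₂ (¬true⇒false λ q → ℕ.1+n≢n (trans (sym e) (≡ᵇ-true (d u) s q)))
      (trans (cong (_≡ᵇ suc s) e) (≡ᵇ-refl (suc s))))

    flow-I-big : ∀ {u v} → I v ≡ true → suc s ℕ.< d u → flow u v ≡ + 4 * trc u v
    flow-I-big {u} h e = trans (flow-I u h) (choose₃ (¬true⇒false λ q → ℕ.<-irrefl (sym (≡ᵇ-true (d u) s q)) (ℕ.<-trans (ℕ.n<1+n s) e))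
      (¬true⇒false λ q → ℕ.<-irrefl (sym (≡ᵇ-true (d u) (suc s) q)) e))

    ∑-≥-const : ∀ x k {g : Fin n → ℤ} → (∀ {v} → G x v ≡ true → k ≤ g v) → k * D x ≤ ∑ (Nb x) g
    ∑-≥-const x k h = subst (_≤ _) (∑-const (Nb x) k) (∑-mono (Nb x) (λ m → h (∈-Nb⁻ m)))

    ∑-zero : ∀ x {g : Fin n → ℤ} → (∀ {v} → G x v ≡ true → g v ≡ 0ℤ) → ∑ (Nb x) g ≡ 0ℤ
    ∑-zero x h = trans (∑-cong (Nb x) (λ m → h (∈-Nb⁻ m))) (∑-0 (Nb x))

    ch-≥ : ∀ {x} → s ℕ.< d x → + 28 * D x - + 12 * (+ 2 * S + + 4) ≤ ch x
    ch-≥ {x} h = +-mono-≤ (∑-≥-const x (+ 28) (λ {v} _ → vals≥28 x v))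
      (≤-reflexive (cong (λ z → - (+ 12 * z)) (sym (need-¬I {x} (ℕ.<⇒≤ h) (≢s⇒¬I (ℕ.>⇒≢ h))))))

    -- Both states heading for the leaf have weight 0, so this edge brings 84 instead of 28.
    ch-≥-leaf : ∀ {x w} → s ℕ.< d x → G x w ≡ true → leaf w ≡ true → + 28 * D x + + 56 - + 12 * (+ 2 * S + + 4) ≤ ch x
    ch-≥-leaf {x} {w} h g l = +-mono-≤ (≤-trans (+-mono-≤ (≤-reflexive (sym (∑-const (Nb x) (+ 28)))) one) (≤-trans (≤-reflexive (sym (∑-+ (Nb x) (λ _ → + 28) (λ v → + 56 * 𝟙 (leaf v)))))
        (∑-mono (Nb x) (λ {v} _ → term v))))
      (≤-reflexive (cong (λ z → - (+ 12 * z)) (sym (need-¬I {x} (ℕ.<⇒≤ h) (≢s⇒¬I (ℕ.>⇒≢ h))))))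
      where
      one : + 56 ≤ ∑ (Nb x) (λ v → + 56 * 𝟙 (leaf v))
      one = ≤-trans (≤-reflexive (cong (λ b → + 56 * 𝟙 b) (sym l))) (∑-≥-member {f = λ v → + 56 * 𝟙 (leaf v)} (∈-Nb⁺ g) (λ {v} _ → # 56 ⊗ 𝟙≥0 (leaf v)))
      term : ∀ v → + 28 + + 56 * 𝟙 (leaf v) ≤ vals x v
      term v = by-leaf (leaf v) (vals x v) (vals-leaf x {v}) (vals≥28 x v)
        where
        by-leaf : ∀ l z → (l ≡ true → z ≡ + 84) → + 28 ≤ z → + 28 + + 56 * 𝟙 l ≤ z
        by-leaf true z h _ = ≤-reflexive (sym (h refl))
        by-leaf false z _ h = h

    ch′-W≡ : ∀ {w} → W w → ch′ w ≡ ∑ (Nb w) (λ u → vals w u + ch u) - + 12 * need w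
    ch′-W≡ {w} h = trans (cong₂ (λ a b → ch w + a - b) (∑-cong (Nb w) (λ {u} _ → flow-W u h)) (∑-zero w out))
      (trans (lem (∑ (Nb w) (vals w)) (+ 12 * need w) (∑ (Nb w) ch)) (cong (_- + 12 * need w) (sym (∑-+ (Nb w) (vals w) ch))))
      where
      lem : ∀ a b c → a - b + c - 0ℤ ≡ a + c - b
      lem = solve-∀
      out : ∀ {v} → G w v ≡ true → flow w v ≡ 0ℤ
      out {v} g = flow-0 w (s<⇒¬W {v} (W-nbr h g)) (≢s⇒¬I (ℕ.>⇒≢ (W-nbr h g)))

    -- Each triangular side lowers `vals w u` by 28, but by `trc-bound` it also raises the degree of
    -- `u` by one, worth 28 at `u`. The number of triangular sides thus cancels.
    cluster : ∀ {w u} → W w → G w u ≡ true → + 36 - + 28 * D w + + 32 * S ≤ vals w u + ch u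
    cluster {w} {u} h g = by {e = (vals w u - (+ 84 - + 28 * trc w u)) + (ch u - (+ 28 * D u - + 12 * (+ 2 * S + + 4))) + + 28 * (D w + D u - (trc w u + + 2 * S))}
        (⌞ vals-small u h ⌟ ⊕ ⌞ ch-≥ {u} (W-nbr h g) ⌟ ⊕ # 28 ⊗ ⌞ trc-bound g ⌟) (lem (vals w u) (ch u) (trc w u) (D w) (D u) S)
      where
      lem : ∀ v c t dw du S → v + c - (+ 36 - + 28 * dw + + 32 * S) ≡
        (v - (+ 84 - + 28 * t)) + (c - (+ 28 * du - + 12 * (+ 2 * S + + 4))) + + 28 * (dw + du - (t + + 2 * S))
      lem = solve-∀

    cluster-leaf : ∀ {w u} → leaf w ≡ true → G w u ≡ true → + 64 + + 32 * S ≤ vals w u + ch u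
    cluster-leaf {w} {u} l g = by {e = (vals w u - (+ 84 - + 28 * trc w u)) + (ch u - (+ 28 * D u + + 56 - + 12 * (+ 2 * S + + 4))) + + 28 * (1ℤ + D u - (trc w u + + 2 * S))}
        (⌞ vals-small u h ⌟ ⊕ ⌞ ch-≥-leaf {u} {w} (W-nbr h g) (sym-G g) l ⌟ ⊕ # 28 ⊗ ⌞ subst (λ k → trc w u + + 2 * S ≤ + k + D u) (≡ᵇ-true (d w) 1 l) (trc-bound g) ⌟) (lem (vals w u) (ch u) (trc w u) (D u) S)
      where
      h = leaf⇒W {w} l
      lem : ∀ v c t du S → v + c - (+ 64 + + 32 * S) ≡
        (v - (+ 84 - + 28 * t)) + (c - (+ 28 * du + + 56 - + 12 * (+ 2 * S + + 4))) + + 28 * (1ℤ + du - (t + + 2 * S))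
      lem = solve-∀

    ch′-leaf : ∀ {w} → leaf w ≡ true → 0ℤ ≤ ch′ w
    ch′-leaf {w} l = subst (0ℤ ≤_) (sym (ch′-W≡ (leaf⇒W {w} l))) bound
      where
      below : + 12 * need w + (+ 8 * S - + 32) ≤ ∑ (Nb w) (λ u → vals w u + ch u)
      below = ≤-trans (≤-reflexive (trans (cong (λ z → + 12 * z + (+ 8 * S - + 32)) (need-low {w} (ℕ.≤-trans (ℕ.≤-reflexive (≡ᵇ-true (d w) 1 l)) (s≤s z≤n)))) (trans (lem S) (cong (λ k → (+ 64 + + 32 * S) * + k) (sym (≡ᵇ-true (d w) 1 l))))))
        (∑-≥-const w (+ 64 + + 32 * S) (cluster-leaf {w} l))
        where
        lem : ∀ S → + 12 * (+ 2 * S + + 8) + (+ 8 * S - + 32) ≡ (+ 64 + + 32 * S) * 1ℤ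
        lem = solve-∀
      bound : 0ℤ ≤ ∑ (Nb w) (λ u → vals w u + ch u) - + 12 * need w
      bound = by {e = (∑ (Nb w) (λ u → vals w u + ch u) - (+ 12 * need w + (+ 8 * S - + 32))) + + 8 * (S - + 4)}
        (⌞ below ⌟ ⊕ # 8 ⊗ ⌞ 4≤S ⌟) (lem (∑ (Nb w) (λ u → vals w u + ch u)) (+ 12 * need w) S)
        where
        lem : ∀ a b S → a - b - 0ℤ ≡ (a - (b + (+ 8 * S - + 32))) + + 8 * (S - + 4)
        lem = solve-∀

    ch′-small : ∀ {w} → W w → leaf w ≡ false → + 24 ≤ ch′ w
    ch′-small {w} h l = subst (+ 24 ≤_) (sym (ch′-W≡ h)) (by-degree (ℕ.m≤n⇒m<n∨m≡n (ℕ.≤∧≢⇒< (deg1≤ w) (λ e → true≢false (trans (cong (_≡ᵇ 1) (sym e)) (≡ᵇ-refl 1)) l))))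
      where
      T = ∑ (Nb w) (λ u → vals w u + ch u)
      T≥ : (+ 36 - + 28 * D w + + 32 * S) * D w ≤ T
      T≥ = ∑-≥-const w (+ 36 - + 28 * D w + + 32 * S) (cluster h)
      by-degree : 2 ℕ.< d w ⊎ 2 ≡ d w → + 24 ≤ T - + 12 * need w
      by-degree (inj₂ e) = by {e = (T - (+ 36 - + 28 * + 2 + + 32 * S) * + 2) + (+ 40 * (S - + 4))}
        (⌞ subst (λ k → (+ 36 - + 28 * + k + + 32 * S) * + k ≤ T) (sym e) T≥ ⌟ ⊕ # 40 ⊗ ⌞ 4≤S ⌟)
        (trans (cong (λ z → T - + 12 * z - + 24) (need-low {w} (ℕ.≤-reflexive (sym e)))) (lem T S))
        where
        lem : ∀ T S → T - + 12 * (+ 2 * S + + 8) - + 24 ≡ (T - (+ 36 - + 28 * + 2 + + 32 * S) * + 2) + (+ 40 * (S - + 4))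
        lem = solve-∀
      -- In terms of the nonnegative quantities deg - 3 and s - 1 - deg, the polynomial left over
      -- has only nonnegative coefficients.
      by-degree (inj₁ 3≤) = by {e = (T - (+ 36 - + 28 * D w + + 32 * S) * D w) + (+ 24 + + 92 * a + + 4 * (a * a) + + 72 * b + + 32 * (a * b))}
        (⌞ T≥ ⌟ ⊕ (# 24 ⊕ # 92 ⊗ a≥0 ⊕ # 4 ⊗ (a≥0 ⊗ a≥0) ⊕ # 72 ⊗ b≥0 ⊕ # 32 ⊗ (a≥0 ⊗ b≥0)))
        (trans (cong (λ z → T - + 12 * z - + 24) (need-mid {w} 3≤ h)) (lem T (D w) S))
        where
        a = D w - + 3
        b = S - (1ℤ + D w)
        a≥0 : 0ℤ ≤ a
        a≥0 = ⌞ +≤+ 3≤ ⌟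
        b≥0 : 0ℤ ≤ b
        b≥0 = ⌞ +≤+ (W⁻ {w} h) ⌟
        lem : ∀ T j S → T - + 12 * (+ 2 * S + + 14 - + 2 * j) - + 24 ≡ (T - (+ 36 - + 28 * j + + 32 * S) * j) +
          (+ 24 + + 92 * (j - + 3) + + 4 * ((j - + 3) * (j - + 3)) + + 72 * (S - (1ℤ + j)) + + 32 * ((j - + 3) * (S - (1ℤ + j))))
        lem = solve-∀

    W-count : ∀ x → ∑ (Nb x) (𝟙 ∘ inW) ≤ 1ℤ
    W-count x = ∑-≤1 inW (Unique-Nb x) (λ a b h k → W-nbr-unique h k (∈-Nb⁻ a) (∈-Nb⁻ b))

    ¬I-next : ∀ {x w} → W w → G w x ≡ true → I x ≡ false
    ¬I-next h g = ¬true⇒false λ i → true≢false (safe-I i) (next⇒unsafe h g)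

    -- `w` is the only neighbour of degree below `s` and takes the whole charge. Vertices of I are
    -- safe, hence neither `x` nor any of its neighbours lies in I.
    ch′-next : ∀ {x w} → W w → G w x ≡ true → ch′ x ≡ 0ℤ
    ch′-next {x} {w} h g = trans (cong₂ (λ a b → ch x + a - b) (∑-zero x (λ {v} _ → flow-0 v (s<⇒¬W {x} (W-nbr h g)) (¬I-next h g))) out) (lem (ch x))
      where
      lem : ∀ a → a + 0ℤ - a ≡ 0ℤ
      lem = solve-∀
      one : ∑ (Nb x) (𝟙 ∘ inW) ≡ 1ℤ
      one = ≤-antisym (W-count x) (≤-trans (≤-reflexive (cong 𝟙 (sym h))) (∑-≥-member {f = 𝟙 ∘ inW} (∈-Nb⁺ (sym-G g)) (λ {y} _ → 𝟙≥0 (inW y))))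
      pt : ∀ {v} → G x v ≡ true → flow x v ≡ ch x * 𝟙 (inW v)
      pt {v} k = trans (cong (λ i → choose (inW v) i (ch x) (gift x v) 0ℤ) ¬Iv) (pick (inW v))
        where
        ¬Iv : I v ≡ false
        ¬Iv = ¬true⇒false λ i → true≢false (safe-I i) (dist2⇒unsafe h g k)
        pick : ∀ b → choose b false (ch x) (gift x v) 0ℤ ≡ ch x * 𝟙 b
        pick true = sym (*-identityʳ (ch x))
        pick false = sym (*-zeroʳ (ch x))
      out : ∑ (Nb x) (flow x) ≡ ch x
      out = trans (∑-cong (Nb x) (λ m → pt (∈-Nb⁻ m))) (trans (∑-*ˡ (Nb x) (ch x) (𝟙 ∘ inW)) (trans (cong (ch x *_) one) (*-identityʳ (ch x))))

    safe-nbr-s≤ : ∀ {x v} → safe x ≡ true → G x v ≡ true → s ℕ.≤ d v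
    safe-nbr-s≤ {x} {v} h g = ¬W⁻ {v} (safe-nbr h g)

    I-term : Fin n → Fin n → ℤ
    I-term x v = vals x v + flow v x

    I-vals : ∀ {x v} → I x ≡ true → + 42 - + 7 * trc x v ≤ vals x v
    I-vals {x} {v} i = vals-safe {x} {v} (I⇒¬W i) (inj₁ (safe-I i))

    trc-at-I : ∀ {x v} → I x ≡ true → G x v ≡ true → trc x v + S ≤ D v
    trc-at-I {x} {v} i g = by {e = S + D v - (trc x v + + 2 * S)} ⌞ subst (λ k → trc x v + + 2 * S ≤ + k + D v) (I-deg i) (trc-bound g) ⌟ (lem (D v) (trc x v) S)
      where
      lem : ∀ v t S → v - (t + S) ≡ S + v - (t + + 2 * S)
      lem = solve-∀

    I-term-big : ∀ {x v} → I x ≡ true → G x v ≡ true → suc s ℕ.< d v → + 42 - + 3 * trc x v ≤ I-term x v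
    I-term-big {x} {v} i g h = by {e = vals x v - (+ 42 - + 7 * trc x v)} ⌞ I-vals i ⌟
      (trans (cong (λ z → vals x v + z - (+ 42 - + 3 * trc x v)) (trans (flow-I-big i h) (cong (+ 4 *_) (trc-sym (sym-G g))))) (lem (vals x v) (trc x v)))
      where
      lem : ∀ a t → a + + 4 * t - (+ 42 - + 3 * t) ≡ a - (+ 42 - + 7 * t)
      lem = solve-∀

    -- 36 is the price per edge, as a vertex of I pays 36s. A neighbour of degree s allows no
    -- triangular side, 42 - 6; degree s + 1 allows one, 35 + 1; beyond that a triangular side loses
    -- 7 and gets 4 back, 42 - 3 · 2.
    I-term≥36 : ∀ {x v} → I x ≡ true → G x v ≡ true → + 36 ≤ I-term x v
    I-term≥36 {x} {v} i g = by-degree (ℕ.<-cmp (d v) (suc s))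
      where
      by-degree : _ → + 36 ≤ I-term x v
      by-degree (tri> _ _ h) = by {e = (I-term x v - (+ 42 - + 3 * trc x v)) + + 3 * (+ 2 - trc x v)} (⌞ I-term-big i g h ⌟ ⊕ # 3 ⊗ ⌞ trc≤2 x v ⌟) (lem (I-term x v) (trc x v))
        where
        lem : ∀ a t → a - + 36 ≡ (a - (+ 42 - + 3 * t)) + + 3 * (+ 2 - t)
        lem = solve-∀
      by-degree (tri≈ _ e _) = by {e = (vals x v - (+ 42 - + 7 * trc x v)) + + 7 * (1ℤ + S - (trc x v + S))} (⌞ I-vals i ⌟ ⊕ # 7 ⊗ ⌞ subst (λ k → trc x v + S ≤ + k) e (trc-at-I i g) ⌟)
        (trans (cong (λ z → vals x v + z - + 36) (flow-I-s+1 i e)) (lem (vals x v) (trc x v) S))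
        where
        lem : ∀ a t S → a + 1ℤ - + 36 ≡ (a - (+ 42 - + 7 * t)) + + 7 * (1ℤ + S - (t + S))
        lem = solve-∀
      by-degree (tri< h _ _) = by {e = (vals x v - (+ 42 - + 7 * trc x v)) + + 7 * (S - (trc x v + S))} (⌞ I-vals i ⌟ ⊕ # 7 ⊗ ⌞ subst (λ k → trc x v + S ≤ + k) e (trc-at-I i g) ⌟)
        (trans (cong (λ z → vals x v + z - + 36) (flow-I-s i e)) (lem (vals x v) (trc x v) S))
        where
        e : d v ≡ s
        e = ℕ.≤-antisym (ℕ.≤-pred h) (safe-nbr-s≤ (safe-I i) g)
        lem : ∀ a t S → a + - + 6 - + 36 ≡ (a - (+ 42 - + 7 * t)) + + 7 * (S - (t + S))
        lem = solve-∀

    ch′-I≡ : ∀ {x} → I x ≡ true → ch′ x ≡ ∑ (Nb x) (λ v → I-term x v - + 36)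
    ch′-I≡ {x} i = trans (cong (λ b → ch x + ∑ (Nb x) (λ v → flow v x) - b) (∑-zero x out))
      (trans (cong (λ z → ∑ (Nb x) (vals x) - + 12 * z + ∑ (Nb x) (λ v → flow v x) - 0ℤ) (trans (need-big {x} (ℕ.≤-reflexive (sym (I-deg i)))) (cong (λ b → + 2 * S + + 4 + (S - + 4) * 𝟙 b) i)))
      (trans (lem (∑ (Nb x) (vals x)) (∑ (Nb x) (λ v → flow v x)) S)
      (sym (trans (∑-- (Nb x) (I-term x) (λ _ → + 36)) (cong₂ _-_ (∑-+ (Nb x) (vals x) (λ v → flow v x)) (trans (∑-const (Nb x) (+ 36)) (cong (λ k → + 36 * + k) (I-deg i))))))))
      where
      lem : ∀ a b S → a - + 12 * (+ 2 * S + + 4 + (S - + 4) * 1ℤ) + b - 0ℤ ≡ a + b - + 36 * S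
      lem = solve-∀
      out : ∀ {v} → G x v ≡ true → flow x v ≡ 0ℤ
      out {v} g = flow-0 x (safe-nbr (safe-I i) g) (¬true⇒false λ j → I-indep i j g)

    ch′-I : ∀ {x} → I x ≡ true → 0ℤ ≤ ch′ x
    ch′-I {x} i = subst (0ℤ ≤_) (sym (ch′-I≡ i)) (∑-nonneg (Nb x) (λ m → ⌞ I-term≥36 i (∈-Nb⁻ m) ⌟))

    ch′-I-surplus : ∀ {x z} → I x ≡ true → G x z ≡ true → suc s ℕ.< d z → trc x z ≤ 1ℤ → + 3 ≤ ch′ x
    ch′-I-surplus {x} {z} i g h t = subst (+ 3 ≤_) (sym (ch′-I≡ i)) (≤-trans
      (by {e = (I-term x z - (+ 42 - + 3 * trc x z)) + + 3 * (1ℤ - trc x z)} (⌞ I-term-big i g h ⌟ ⊕ # 3 ⊗ ⌞ t ⌟) (lem (I-term x z) (trc x z)))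
      (∑-≥-member {f = λ v → I-term x v - + 36} (∈-Nb⁺ g) (λ m → ⌞ I-term≥36 i (∈-Nb⁻ m) ⌟)))
      where
      lem : ∀ a t → a - + 36 - + 3 ≡ (a - (+ 42 - + 3 * t)) + + 3 * (1ℤ - t)
      lem = solve-∀

    ch′-free≡ : ∀ {x} → ¬ W x → I x ≡ false → ch′ x ≡ ∑ (Nb x) (λ v → vals x v - flow x v) - + 12 * need x
    ch′-free≡ {x} h i = trans (cong (λ a → ch x + a - ∑ (Nb x) (flow x)) (∑-zero x (λ {v} _ → flow-0 v h i)))
      (trans (lem (∑ (Nb x) (vals x)) (+ 12 * need x) (∑ (Nb x) (flow x))) (cong (_- + 12 * need x) (sym (∑-- (Nb x) (vals x) (flow x)))))
      where
      lem : ∀ a b c → a - b + 0ℤ - c ≡ a - c - b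
      lem = solve-∀

    ch′-free : ∀ {x} (g : Fin n → ℤ) → ¬ W x → I x ≡ false → (∀ {v} → G x v ≡ true → + 28 + g v ≤ vals x v - flow x v) →
      + 28 * D x + ∑ (Nb x) g - + 12 * (+ 2 * S + + 4) ≤ ch′ x
    ch′-free {x} g h i pt = subst₂ _≤_ (cong (λ z → + 28 * D x + ∑ (Nb x) g - + 12 * z) (need-¬I (¬W⁻ {x} h) i)) (sym (ch′-free≡ h i))
      (+-monoˡ-≤ (- (+ 12 * need x)) (≤-trans (≤-reflexive (trans (cong (_+ ∑ (Nb x) g) (sym (∑-const (Nb x) (+ 28)))) (sym (∑-+ (Nb x) (λ _ → + 28) g))))
        (∑-mono (Nb x) (λ m → pt (∈-Nb⁻ m)))))

    ntc : Fin n → Fin n → ℤ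
    ntc x v = 𝟙 (not (tri (x , v , true))) + 𝟙 (not (tri (x , v , false)))

    ntc≡ : ∀ x v → ntc x v ≡ + 2 - trc x v
    ntc≡ x v = trans (cong₂ _+_ (𝟙-not (tri (x , v , true))) (𝟙-not (tri (x , v , false)))) (lem (𝟙 (tri (x , v , true))) (𝟙 (tri (x , v , false))))
      where
      lem : ∀ a b → (1ℤ - a) + (1ℤ - b) ≡ + 2 - (a + b)
      lem = solve-∀

    sides : Bool → Fin n → ℤ
    sides ε x = ∑ (Nb x) (λ v → 𝟙 (not (tri (x , v , ε))))

    ∑-ntc : ∀ x → ∑ (Nb x) (ntc x) ≡ sides true x + sides false x
    ∑-ntc x = ∑-+ (Nb x) (λ v → 𝟙 (not (tri (x , v , true)))) (λ v → 𝟙 (not (tri (x , v , false))))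

    partner : ∀ {x v} ε → G x v ≡ true → tri (x , v , ε) ≡ false → tri (x , rotS x (not ε) v , not ε) ≡ false
    partner {x} {v} ε g h = ¬true⇒false λ k → true≢false (back k) h
      where
      back : tri (x , rotS x (not ε) v , not ε) ≡ true → tri (x , v , ε) ≡ true
      back k = subst₂ (λ z δ → tri (x , z , δ) ≡ true) (trans (cong (λ b → rotS x b (rotS x (not ε) v)) (not-not ε)) (rotS-inv′ ε g)) (not-not ε)
        (tri-corner {x} {rotS x (not ε) v} {not ε} (rotS-closed (not ε) g) k)
        where
        not-not : ∀ b → not (not b) ≡ b
        not-not true = refl
        not-not false = refl

    sides≥1 : ∀ {x v} ε → G x v ≡ true → tri (x , v , ε) ≡ false → 1ℤ ≤ sides ε x
    sides≥1 {x} {v} ε g h = ≤-trans (≤-reflexive (cong (𝟙 ∘ not) (sym h)))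
      (∑-≥-member {f = λ v → 𝟙 (not (tri (x , v , ε)))} (∈-Nb⁺ g) (λ {y} _ → 𝟙≥0 (not (tri (x , y , ε)))))

    sides≥2 : ∀ {x u v} ε → u ≢ v → G x u ≡ true → G x v ≡ true → tri (x , u , ε) ≡ false → tri (x , v , ε) ≡ false → + 2 ≤ sides ε x
    sides≥2 {x} {u} {v} ε ne g k h l = ≤-trans (≤-reflexive (sym (cong₂ (λ a b → 𝟙 (not a) + (𝟙 (not b) + 0ℤ)) h l)))
      (∑-sublist {xs = u ∷ v ∷ []} {f = λ v → 𝟙 (not (tri (x , v , ε)))} ((ne ∷ []) ∷ [] ∷ [])
        (λ { (here refl) → ∈-Nb⁺ g ; (there (here refl)) → ∈-Nb⁺ k }) (λ {y} _ → 𝟙≥0 (not (tri (x , y , ε)))))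

    -- A corner in a nontriangular face is seen from both edges bounding it, once with either sign.
    ntc≥2 : ∀ {x v} ε → G x v ≡ true → tri (x , v , ε) ≡ false → + 2 ≤ ∑ (Nb x) (ntc x)
    ntc≥2 {x} {v} true g h = subst (+ 2 ≤_) (sym (∑-ntc x)) (+-mono-≤ (sides≥1 {x} {v} true g h) (sides≥1 {x} {rotS x false v} false (rotS-closed false g) (partner true g h)))
    ntc≥2 {x} {v} false g h = subst (+ 2 ≤_) (sym (∑-ntc x)) (+-mono-≤ (sides≥1 {x} {rotS x true v} true (rotS-closed true g) (partner false g h)) (sides≥1 {x} {v} false g h))

    -- An edge without triangular sides bounds two such corners, and each sign then occurs at two
    -- different edges.
    ntc≥4 : ∀ {x v} → 2 ℕ.≤ d x → G x v ≡ true → (∀ ε → tri (x , v , ε) ≡ false) → + 4 ≤ ∑ (Nb x) (ntc x)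
    ntc≥4 {x} {v} 2≤ g h = subst (+ 4 ≤_) (sym (∑-ntc x)) (+-mono-≤ (two true) (two false))
      where
      two : ∀ ε → + 2 ≤ sides ε x
      two true = sides≥2 {x} {v} {rotS x true v} true (λ e → ℕ.<-irrefl refl (ℕ.≤-trans 2≤ (rotS-fix⇒ true g (sym e)))) g (rotS-closed true g) (h true) (partner {x} {v} false g (h false))
      two false = sides≥2 {x} {v} {rotS x false v} false (λ e → ℕ.<-irrefl refl (ℕ.≤-trans 2≤ (rotS-fix⇒ false g (sym e)))) g (rotS-closed false g) (h false) (partner {x} {v} true g (h true))

    vals-ntc : ∀ {x v} → ¬ W x → safe x ≡ true ⊎ safe v ≡ true → + 28 + + 7 * ntc x v ≤ vals x v
    vals-ntc {x} {v} h k = ≤-trans (≤-reflexive (trans (cong (λ z → + 28 + + 7 * z) (ntc≡ x v)) (lem (trc x v)))) (vals-safe {x} {v} h k)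
      where
      lem : ∀ t → + 28 + + 7 * (+ 2 - t) ≡ + 42 - + 7 * t
      lem = solve-∀

    next-free : ∀ {x v} → nextW x ≡ false → G x v ≡ true → ¬ W v
    next-free {x} h g w = true≢false (hasNbr⁺ {inW} {x} g w) h

    -- By maximality of I some neighbour lies in I, across an edge in no triangle. The corners
    -- beside it yield four states worth 7 extra, and the neighbour returns 6; these 34 are added to
    -- 28s - (24s + 48).
    ch′-s : ∀ {x} → d x ≡ s → I x ≡ false → + 4 * S - + 14 ≤ ch′ x
    ch′-s {x} e i = by {e = (ch′ x - (+ 28 * S + ∑ (Nb x) g - + 12 * (+ 2 * S + + 4))) + (∑ (Nb x) g - + 34)}
        (⌞ subst (λ k → + 28 * + k + ∑ (Nb x) g - + 12 * (+ 2 * S + + 4) ≤ ch′ x) e (ch′-free {x} g (safe⇒¬W sx) i pt) ⌟ ⊕ ⌞ g≥ ⌟)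
        (lem (ch′ x) (∑ (Nb x) g) S)
      where
      lem : ∀ c g S → c - (+ 4 * S - + 14) ≡ (c - (+ 28 * S + g - + 12 * (+ 2 * S + + 4))) + (g - + 34)
      lem = solve-∀
      sx = s⇒safe e
      g : Fin n → ℤ
      g v = + 7 * ntc x v + + 6 * 𝟙 (I v)
      y = proj₁ (I-maximal e i)
      Iy = proj₁ (proj₂ (I-maximal e i))
      gy = proj₂ (proj₂ (I-maximal e i))
      g≥ : + 34 ≤ ∑ (Nb x) g
      g≥ = by {e = + 7 * (∑ (Nb x) (ntc x) - + 4) + + 6 * (∑ (Nb x) (𝟙 ∘ I) - 1ℤ)}
        (# 7 ⊗ ⌞ ntc≥4 (¬W⇒2≤ {x} (safe⇒¬W sx)) gy (λ ε → no-tri ε gy (ℕ.≤-reflexive (trans (cong₂ ℕ._+_ e (I-deg Iy)) (cong (s ℕ.+_) (sym (ℕ.+-identityʳ s)))))) ⌟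
          ⊕ # 6 ⊗ ⌞ ≤-trans (≤-reflexive (cong 𝟙 (sym Iy))) (∑-≥-member {f = 𝟙 ∘ I} (∈-Nb⁺ gy) (λ {v} _ → 𝟙≥0 (I v))) ⌟)
        (trans (cong (_- + 34) (trans (∑-+ (Nb x) (λ v → + 7 * ntc x v) (λ v → + 6 * 𝟙 (I v))) (cong₂ _+_ (∑-*ˡ (Nb x) (+ 7) (ntc x)) (∑-*ˡ (Nb x) (+ 6) (𝟙 ∘ I)))))
          (lem′ (∑ (Nb x) (ntc x)) (∑ (Nb x) (𝟙 ∘ I))))
        where
        lem′ : ∀ a b → + 7 * a + + 6 * b - + 34 ≡ + 7 * (a - + 4) + + 6 * (b - 1ℤ)
        lem′ = solve-∀
      pt : ∀ {v} → G x v ≡ true → + 28 + g v ≤ vals x v - flow x v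
      pt {v} k = by {e = vals x v - (+ 28 + + 7 * ntc x v)} ⌞ vals-ntc {x} {v} (safe⇒¬W sx) (inj₁ sx) ⌟
        (trans (cong (λ z → vals x v - z - (+ 28 + g v)) (fl (Bool-cases (I v)))) (lem′ (vals x v) (ntc x v) (𝟙 (I v))))
        where
        lem′ : ∀ a b i → a - - (+ 6 * i) - (+ 28 + (+ 7 * b + + 6 * i)) ≡ a - (+ 28 + + 7 * b)
        lem′ = solve-∀
        fl : I v ≡ true ⊎ I v ≡ false → flow x v ≡ - (+ 6 * 𝟙 (I v))
        fl (inj₁ j) = trans (flow-I-s j e) (cong (λ b → - (+ 6 * 𝟙 b)) (sym j))
        fl (inj₂ j) = trans (flow-0 x (safe-nbr sx k) j) (cong (λ b → - (+ 6 * 𝟙 b)) (sym j))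

    flow-s+1 : ∀ {x v} → d x ≡ suc s → ¬ W v → flow x v ≡ 𝟙 (I v)
    flow-s+1 {x} {v} e h = fl (Bool-cases (I v))
      where
      fl : I v ≡ true ⊎ I v ≡ false → flow x v ≡ 𝟙 (I v)
      fl (inj₁ j) = trans (flow-I-s+1 j e) (cong 𝟙 (sym j))
      fl (inj₂ j) = trans (flow-0 x h j) (cong 𝟙 (sym j))

    s+1⇒¬W : ∀ {x} → d x ≡ suc s → ¬ W x
    s+1⇒¬W {x} e = s<⇒¬W {x} (ℕ.≤-reflexive (sym e))

    s+1⇒¬I : ∀ {x} → d x ≡ suc s → I x ≡ false
    s+1⇒¬I e = ≢s⇒¬I (λ q → ℕ.1+n≢n (trans (sym e) q))

    trc-s+1 : ∀ {x v} → d x ≡ suc s → d v ≡ s → G x v ≡ true → trc x v ≤ 1ℤ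
    trc-s+1 {x} {v} e e′ g = by {e = 1ℤ + S + S - (trc x v + + 2 * S)} ⌞ subst₂ (λ a b → trc x v + + 2 * S ≤ + a + + b) e e′ (trc-bound g) ⌟ (lem (trc x v) S)
      where
      lem : ∀ t S → 1ℤ - t ≡ 1ℤ + S + S - (t + + 2 * S)
      lem = solve-∀

    ch′-s+1′ : ∀ {x} (g : Fin n → ℤ) → d x ≡ suc s → (∀ {v} → G x v ≡ true → + 28 + + 6 * g v ≤ vals x v - flow x v) →
      + 4 * S - + 20 + + 6 * ∑ (Nb x) g ≤ ch′ x
    ch′-s+1′ {x} g e pt = ≤-trans (≤-reflexive (trans (lem S (∑ (Nb x) g)) (cong₂ (λ a b → + 28 * + a + b - + 12 * (+ 2 * S + + 4)) (sym e) (sym (∑-*ˡ (Nb x) (+ 6) g)))))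
      (ch′-free {x} (λ v → + 6 * g v) (s+1⇒¬W {x} e) (s+1⇒¬I e) pt)
      where
      lem : ∀ S g → + 4 * S - + 20 + + 6 * g ≡ + 28 * (1ℤ + S) + + 6 * g - + 12 * (+ 2 * S + + 4)
      lem = solve-∀

    -- An edge to a vertex of degree s has at most one triangular side and is worth 35 or more.
    -- After a gift of at most 1 it still exceeds 28 by 6.
    ch′-s+1 : ∀ {x} → d x ≡ suc s → nextW x ≡ false → + 4 * S - + 20 + + 6 * ∑ (Nb x) (λ v → 𝟙 (d v ≡ᵇ s)) ≤ ch′ x
    ch′-s+1 {x} e nx = ch′-s+1′ {x} (λ v → 𝟙 (d v ≡ᵇ s)) e pt
      where
      pt : ∀ {v} → G x v ≡ true → + 28 + + 6 * 𝟙 (d v ≡ᵇ s) ≤ vals x v - flow x v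
      pt {v} g = by-case (Bool-cases (d v ≡ᵇ s))
        where
        fl = flow-s+1 {x} {v} e (next-free {x} nx g)
        by-case : (d v ≡ᵇ s) ≡ true ⊎ (d v ≡ᵇ s) ≡ false → + 28 + + 6 * 𝟙 (d v ≡ᵇ s) ≤ vals x v - flow x v
        by-case (inj₁ q) = by {e = (vals x v - (+ 42 - + 7 * trc x v)) + + 7 * (1ℤ - trc x v) + (1ℤ - 𝟙 (I v))}
          (⌞ vals-safe {x} {v} (s+1⇒¬W {x} e) (inj₂ (s⇒safe (≡ᵇ-true (d v) s q))) ⌟ ⊕ # 7 ⊗ ⌞ trc-s+1 e (≡ᵇ-true (d v) s q) g ⌟ ⊕ ⌞ 𝟙≤1 (I v) ⌟)
          (trans (cong₂ (λ a b → vals x v - a - (+ 28 + + 6 * 𝟙 b)) fl q) (lem (vals x v) (trc x v) (𝟙 (I v))))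
          where
          lem : ∀ a t i → a - i - (+ 28 + + 6 * 1ℤ) ≡ (a - (+ 42 - + 7 * t)) + + 7 * (1ℤ - t) + (1ℤ - i)
          lem = solve-∀
        by-case (inj₂ q) = by {e = vals x v - + 28} ⌞ vals≥28 x v ⌟
          (trans (cong₂ (λ a b → vals x v - a - (+ 28 + + 6 * 𝟙 b)) (trans fl (cong 𝟙 (¬true⇒false λ i → true≢false (trans (cong (_≡ᵇ s) (I-deg i)) (≡ᵇ-refl s)) q))) q) (lem (vals x v)))
          where
          lem : ∀ a → a - 0ℤ - (+ 28 + + 6 * 0ℤ) ≡ a - + 28
          lem = solve-∀

    ch′-s+1-safe : ∀ {x} → d x ≡ suc s → safe x ≡ true → + 4 * S - + 20 + + 6 * ∑ (Nb x) (ntc x) ≤ ch′ x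
    ch′-s+1-safe {x} e sx = ch′-s+1′ {x} (ntc x) e pt
      where
      pt : ∀ {v} → G x v ≡ true → + 28 + + 6 * ntc x v ≤ vals x v - flow x v
      pt {v} g = by {e = (vals x v - (+ 28 + + 7 * ntc x v)) + (ntc x v - 𝟙 (I v))} (⌞ vals-ntc {x} {v} (s+1⇒¬W {x} e) (inj₁ sx) ⌟ ⊕ ⌞ I≤ (Bool-cases (I v)) ⌟)
        (trans (cong (λ z → vals x v - z - (+ 28 + + 6 * ntc x v)) (flow-s+1 {x} {v} e (safe-nbr sx g))) (lem (vals x v) (ntc x v) (𝟙 (I v))))
        where
        lem : ∀ a b i → a - i - (+ 28 + + 6 * b) ≡ (a - (+ 28 + + 7 * b)) + (b - i)
        lem = solve-∀
        I≤ : I v ≡ true ⊎ I v ≡ false → 𝟙 (I v) ≤ ntc x v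
        I≤ (inj₁ j) = ≤-trans (≤-reflexive (cong 𝟙 j)) (by {e = 1ℤ - trc x v} ⌞ trc-s+1 e (I-deg j) g ⌟ (trans (cong (_- 1ℤ) (ntc≡ x v)) (lem′ (trc x v))))
          where
          lem′ : ∀ t → + 2 - t - 1ℤ ≡ 1ℤ - t
          lem′ = solve-∀
        I≤ (inj₂ j) = ≤-trans (≤-reflexive (cong 𝟙 j)) (𝟙≥0 (not (tri (x , v , true))) ⊕ 𝟙≥0 (not (tri (x , v , false))))

    τ : Fin n → ℤ
    τ x = ∑ (Nb x) (λ v → 𝟙 (I v) * trc x v)

    -- Rotating the I-neighbours behind a triangular side leads to neighbours outside I.
    τ-bound : ∀ x → τ x ≤ D x
    τ-bound x = *-cancelˡ-≤-pos (τ x) (D x) (+ 2) (by {e = (D x - (a true + a true)) + (D x - (a false + a false))} (⌞ half true ⌟ ⊕ ⌞ half false ⌟)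
        (trans (cong (λ z → + 2 * D x - + 2 * z) split) (lem (D x) (a true) (a false))))
      where
      lem : ∀ d a b → + 2 * d - + 2 * (a + b) ≡ (d - (a + a)) + (d - (b + b))
      lem = solve-∀
      a : Bool → ℤ
      a ε = ∑ (Nb x) (λ v → 𝟙 (I v ∧ tri (x , v , ε)))
      split : τ x ≡ a true + a false
      split = trans (∑-cong (Nb x) (λ {v} _ → trans (*-distribˡ-+ (𝟙 (I v)) (𝟙 (tri (x , v , true))) (𝟙 (tri (x , v , false))))
          (sym (cong₂ _+_ (𝟙-∧ (I v) (tri (x , v , true))) (𝟙-∧ (I v) (tri (x , v , false)))))))
        (∑-+ (Nb x) (λ v → 𝟙 (I v ∧ tri (x , v , true))) (λ v → 𝟙 (I v ∧ tri (x , v , false))))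
      half : ∀ ε → a ε + a ε ≤ D x
      half ε = ≤-trans (+-mono-≤ (∑-mono (Nb x) (λ {v} _ → 𝟙-mono (I v ∧ tri (x , v , ε)) (I v) (λ h → proj₁ (∧-true h)))) rotated) (≤-reflexive (∑-not (Nb x) I))
        where
        rotated : a ε ≤ ∑ (Nb x) (λ v → 𝟙 (not (I v)))
        rotated = ∑-inj {xs = Nb x} {ys = Nb x} (λ v → I v ∧ tri (x , v , ε)) (not ∘ I) (rotS x (not ε)) (Unique-Nb x)
          (λ {v} m h → let i , t = ∧-true {I v} h in ∈-Nb⁺ (rotS-closed (not ε) (∈-Nb⁻ m)) ,
            not-intro (¬true⇒false λ j → I-indep i j (tri-adj {x} {v} {ε} (∈-Nb⁻ m) t)))
          (λ m m′ _ _ → rotS-inj (not ε) (∈-Nb⁻ m) (∈-Nb⁻ m′))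

    ch′-big′ : ∀ {x} → suc s ℕ.< d x → nextW x ≡ false → + 28 * D x - + 4 * τ x - + 12 * (+ 2 * S + + 4) ≤ ch′ x
    ch′-big′ {x} h nx = ≤-trans (≤-reflexive (cong (λ z → + 28 * D x + z - + 12 * (+ 2 * S + + 4)) (sym (trans (∑-*ˡ (Nb x) (- + 4) (λ v → 𝟙 (I v) * trc x v)) (sym (neg-distribˡ-* (+ 4) (τ x)))))))
      (ch′-free {x} (λ v → - + 4 * (𝟙 (I v) * trc x v)) (s<⇒¬W {x} s<) (≢s⇒¬I (ℕ.>⇒≢ s<)) pt)
      where
      s< : s ℕ.< d x
      s< = ℕ.<-trans (ℕ.n<1+n s) h
      pt : ∀ {v} → G x v ≡ true → + 28 + - + 4 * (𝟙 (I v) * trc x v) ≤ vals x v - flow x v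
      pt {v} g = by {e = vals x v - + 28} ⌞ vals≥28 x v ⌟ (trans (cong (λ z → vals x v - z - (+ 28 + - + 4 * (𝟙 (I v) * trc x v))) (fl (Bool-cases (I v)))) (lem (vals x v) (𝟙 (I v) * trc x v)))
        where
        lem : ∀ a b → a - + 4 * b - (+ 28 + - + 4 * b) ≡ a - + 28
        lem = solve-∀
        fl : I v ≡ true ⊎ I v ≡ false → flow x v ≡ + 4 * (𝟙 (I v) * trc x v)
        fl (inj₁ j) = trans (flow-I-big j h) (cong (+ 4 *_) (sym (trans (cong (λ b → 𝟙 b * trc x v) j) (*-identityˡ (trc x v)))))
        fl (inj₂ j) = trans (flow-0 x (next-free {x} nx g) j) (cong (+ 4 *_) (sym (trans (cong (λ b → 𝟙 b * trc x v) j) (*-zeroˡ (trc x v)))))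

    -- By `τ-bound` the gifts cost at most 4 per edge on average, so that 24 of the 28 remain. The
    -- bound vanishes exactly at degree s + 2.
    ch′-big : ∀ {x} → suc s ℕ.< d x → nextW x ≡ false → + 24 * D x - + 12 * (+ 2 * S + + 4) ≤ ch′ x
    ch′-big {x} h nx = ≤-trans (by {e = + 4 * (D x - τ x)} (# 4 ⊗ ⌞ τ-bound x ⌟) (lem (D x) (τ x) S)) (ch′-big′ {x} h nx)
      where
      lem : ∀ d t S → (+ 28 * d - + 4 * t - + 12 * (+ 2 * S + + 4)) - (+ 24 * d - + 12 * (+ 2 * S + + 4)) ≡ + 4 * (d - t)
      lem = solve-∀

    -- Total charge and the vertices that may stay negative

    Σ : (Fin n → ℤ) → ℤ
    Σ = ∑ V

    length-V : + length V ≡ + n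
    length-V = cong +_ (length-tabulate (λ x → x))

    ∑-pairs : ∀ (g : Fin n → Fin n → ℤ) → ∑ (cartesianProduct V V) (λ e → g (proj₁ e) (proj₂ e)) ≡ Σ (λ x → Σ (g x))
    ∑-pairs g = ∑-× V V (λ e → g (proj₁ e) (proj₂ e))

    size≡ : + size G ≡ Σ (λ x → Σ (λ y → 𝟙 ((toℕ x ℕ.<ᵇ toℕ y) ∧ G x y)))
    size≡ = trans (length-filter≡∑ _ (cartesianProduct V V)) (∑-pairs (λ x y → 𝟙 ((toℕ x ℕ.<ᵇ toℕ y) ∧ G x y)))

    handshake : Σ D ≤ + 2 * + size G
    handshake = ≤-trans (∑-mono V (λ {x} _ → row x)) (≤-reflexive (trans
        (∑-+ V (λ x → Σ (λ y → up x y)) (λ x → Σ (λ y → up y x)))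
        (trans (cong₂ _+_ (sym size≡) (trans (∑-comm V V (λ x y → up y x)) (sym size≡))) (lem (+ size G)))))
      where
      lem : ∀ m → m + m ≡ + 2 * m
      lem = solve-∀
      up : Fin n → Fin n → ℤ
      up x y = 𝟙 ((toℕ x ℕ.<ᵇ toℕ y) ∧ G x y)
      cell : ∀ x y → 𝟙 (G x y) ≤ up x y + up y x
      cell x y = by-cmp (ℕ.<-cmp (toℕ x) (toℕ y)) (Bool-cases (G x y))
        where
        up≥0 : ∀ x y → 0ℤ ≤ up x y
        up≥0 x y = 𝟙≥0 ((toℕ x ℕ.<ᵇ toℕ y) ∧ G x y)
        by-cmp : _ → G x y ≡ true ⊎ G x y ≡ false → 𝟙 (G x y) ≤ up x y + up y x
        by-cmp _ (inj₂ h) = ≤-trans (≤-reflexive (cong 𝟙 h)) (up≥0 x y ⊕ up≥0 y x)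
        by-cmp (tri< l _ _) (inj₁ h) = ≤-trans (≤-reflexive (trans (cong 𝟙 (trans h (sym (∧-intro (<ᵇ-intro l) h)))) (sym (+-identityʳ (up x y))))) (+-monoʳ-≤ (up x y) (up≥0 y x))
        by-cmp (tri≈ _ e _) (inj₁ h) = ⊥-elim (G-≢ h (toℕ-injective e))
        by-cmp (tri> _ _ l) (inj₁ h) = ≤-trans (≤-reflexive (trans (cong 𝟙 (trans h (sym (∧-intro (<ᵇ-intro l) (sym-G h))))) (sym (+-identityˡ (up y x))))) (+-monoˡ-≤ (up y x) (up≥0 x y))
      row : ∀ x → D x ≤ Σ (λ y → up x y) + Σ (λ y → up y x)
      row x = ≤-trans (≤-reflexive (length-filter≡∑ (G x) V)) (≤-trans (∑-mono V (λ {y} _ → cell x y)) (≤-reflexive (∑-+ V (λ y → up x y) (λ y → up y x))))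

    ∑-states : ∑ states wt ≡ Σ (λ x → ∑ (Nb x) (λ y → wt (x , y , true) + wt (x , y , false)))
    ∑-states = trans (∑-filter validᵇ (allStates R) wt) (trans (∑-× V (cartesianProduct V (true ∷ false ∷ [])) (λ t → 𝟙 (validᵇ t) * wt t))
      (∑-cong V (λ {x} _ → trans (∑-× V (true ∷ false ∷ []) (λ u → 𝟙 (validᵇ (x , u)) * wt (x , u)))
        (trans (∑-cong V (λ {y} _ → lem (𝟙 (G x y)) (wt (x , y , true)) (wt (x , y , false)))) (sym (∑-filter (G x) V (λ y → wt (x , y , true) + wt (x , y , false))))))))
      where
      lem : ∀ a b c → a * b + (a * c + 0ℤ) ≡ a * (b + c)
      lem = solve-∀

    ∑-vals : Σ (λ x → ∑ (Nb x) (vals x)) ≡ + 84 * Σ D - + 7 * ∑ states wt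
    ∑-vals = trans (∑-cong V (λ {x} _ → row x)) (trans (∑-- V (λ x → + 84 * D x) (λ x → + 7 * ∑ (Nb x) (w₂ x)))
      (cong₂ _-_ (∑-*ˡ V (+ 84) D) (trans (∑-*ˡ V (+ 7) (λ x → ∑ (Nb x) (w₂ x))) (cong (+ 7 *_) (sym ∑-states)))))
      where
      w₂ : Fin n → Fin n → ℤ
      w₂ x y = wt (x , y , true) + wt (x , y , false)
      row : ∀ x → ∑ (Nb x) (vals x) ≡ + 84 * D x - + 7 * ∑ (Nb x) (w₂ x)
      row x = trans (∑-cong (Nb x) (λ {y} _ → lem (wt (x , y , true)) (wt (x , y , false))))
        (trans (∑-- (Nb x) (λ _ → + 84) (λ y → + 7 * w₂ x y)) (cong₂ _-_ (∑-const (Nb x) (+ 84)) (∑-*ˡ (Nb x) (+ 7) (w₂ x))))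
        where
        lem : ∀ a b → (+ 42 - + 7 * a) + (+ 42 - + 7 * b) ≡ + 84 - + 7 * (a + b)
        lem = solve-∀

    faces≤ : + 2 * + numFaces R ≤ + numOrbits R
    faces≤ = subst (_≤ + numOrbits R) (trans (cong +_ (ℕ.*-comm (numFaces R) 2)) (pos-* 2 (numFaces R))) (+≤+ (m/n*n≤m (numOrbits R) 2))

    sumℤ≡ : ∀ (xs : List ℕ) (g : ℕ → ℤ) → sumℤ (map g xs) ≡ ∑ xs g
    sumℤ≡ [] g = refl
    sumℤ≡ (x ∷ xs) g = cong (_+_ (g x)) (sumℤ≡ xs g)

    module _ (I-size : Σ (𝟙 ∘ I) ≡ + β₀-induced G (inV G s)) where

      ∑-need : Σ need ≡ + 14 * + n + rhs G s
      ∑-need = trans (∑-+ V A B)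
          (trans (cong₂ _+_ (trans (∑-+ V A₁ A₂) (cong₂ _+_ (trans (∑-+ V A₃ A₄) (cong₂ _+_
              (trans (∑-const V (+ 14 + + 2 * (S - + 5))) (cong ((+ 14 + + 2 * (S - + 5)) *_) length-V))
              (trans (∑-*ˡ V (S - + 4) (𝟙 ∘ I)) (cong ((S - + 4) *_) I-size))))
              (trans (∑-*ˡ V (+ 4) (λ x → 𝟙 (d x ℕ.≤ᵇ 2))) (cong (+ 4 *_) (sym (length-filter≡∑ (λ x → d x ℕ.≤ᵇ 2) V))))))
            (trans (∑-*ˡ V (+ 2) (λ x → ∑ mids (λ j → (+ 5 - + j) * 𝟙 (d x ≡ᵇ j)))) (cong (+ 2 *_) mid)))
          (lem S (+ n) (+ β₀-induced G (inV G s)) (+ numDegLe G 2) (sumℤ (map (λ j → (+ 5 - + j) * + numDeg G j) mids))))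
        where
        A₃ A₄ A₁ A₂ A B : Fin n → ℤ
        A₃ x = + 14 + + 2 * (S - + 5)
        A₄ x = (S - + 4) * 𝟙 (I x)
        A₁ x = A₃ x + A₄ x
        A₂ x = + 4 * 𝟙 (d x ℕ.≤ᵇ 2)
        A x = A₁ x + A₂ x
        B x = + 2 * ∑ mids (λ j → (+ 5 - + j) * 𝟙 (d x ≡ᵇ j))
        mid : Σ (λ x → ∑ mids (λ j → (+ 5 - + j) * 𝟙 (d x ≡ᵇ j))) ≡ sumℤ (map (λ j → (+ 5 - + j) * + numDeg G j) mids)
        mid = trans (∑-comm V mids (λ x j → (+ 5 - + j) * 𝟙 (d x ≡ᵇ j)))
          (trans (∑-cong mids (λ {j} _ → trans (∑-*ˡ V (+ 5 - + j) (λ x → 𝟙 (d x ≡ᵇ j))) (cong ((+ 5 - + j) *_) (sym (length-filter≡∑ (λ x → d x ≡ᵇ j) V)))))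
            (sym (sumℤ≡ mids (λ j → (+ 5 - + j) * + numDeg G j))))
        lem : ∀ S n b l m → (+ 14 + + 2 * (S - + 5)) * n + (S - + 4) * b + + 4 * l + + 2 * m ≡ + 14 * n + ((S - + 4) * b + + 2 * (S - + 5) * n + + 4 * l + + 2 * m)
        lem = solve-∀

      total : Σ ch′ ≤ + 12 * (- + 14 * eulerChar R - rhs G s)
      total = by {e = + 7 * (∑ states wt - + 12 * + numOrbits R) + + 84 * (+ 2 * + size G - Σ D) + + 84 * (+ numOrbits R - + 2 * + numFaces R)}
        (# 7 ⊗ ⌞ orbit-weight (λ {t} → all-heavy {t}) ⌟ ⊕ # 84 ⊗ ⌞ handshake ⌟ ⊕ # 84 ⊗ ⌞ faces≤ ⌟)
        (trans (cong (λ z → + 12 * (- + 14 * eulerChar R - rhs G s) - z) ∑ch)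
          (lem (Σ D) (∑ states wt) (+ numOrbits R) (+ size G) (+ n) (+ numFaces R) (rhs G s)))
        where
        ∑ch : Σ ch′ ≡ (+ 84 * Σ D - + 7 * ∑ states wt) - + 12 * (+ 14 * + n + rhs G s)
        ∑ch = trans ∑-ch′ (trans (∑-- V (λ x → ∑ (Nb x) (vals x)) (λ x → + 12 * need x)) (cong₂ _-_ ∑-vals (trans (∑-*ˡ V (+ 12) need) (cong (+ 12 *_) ∑-need))))
        lem : ∀ d w o m n f r → + 12 * (- + 14 * (n - m + f) - r) - ((+ 84 * d - + 7 * w) - + 12 * (+ 14 * n + r)) ≡
          + 7 * (w - + 12 * o) + + 84 * (+ 2 * m - d) + + 84 * (o - + 2 * f)
        lem = solve-∀

    Exceptional : Fin n → Set
    Exceptional x = d x ≡ suc s × nextW x ≡ false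

    classify : ∀ x → 0ℤ ≤ ch′ x ⊎ Exceptional x
    classify x = by-W (Bool-cases (inW x)) (Bool-cases (leaf x)) (Bool-cases (nextW x))
      where
      by-deg : nextW x ≡ false → ¬ W x → _ → 0ℤ ≤ ch′ x ⊎ Exceptional x
      by-deg nx h (tri≈ _ e _) = inj₂ (e , nx)
      by-deg nx h (tri> _ _ l) = inj₁ (≤-trans (by {e = + 24 * (D x - (+ 2 + S))} (# 24 ⊗ ⌞ +≤+ l ⌟) (lem (D x) S)) (ch′-big {x} l nx))
        where
        lem : ∀ d S → + 24 * d - + 12 * (+ 2 * S + + 4) - 0ℤ ≡ + 24 * (d - (+ 2 + S))
        lem = solve-∀
      by-deg nx h (tri< l _ _) = inj₁ (by-I (Bool-cases (I x)))
        where
        lem : ∀ S → + 4 * S - + 14 - 0ℤ ≡ + 4 * (S - + 4) + + 2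
        lem = solve-∀
        by-I : I x ≡ true ⊎ I x ≡ false → 0ℤ ≤ ch′ x
        by-I (inj₁ i) = ch′-I i
        by-I (inj₂ i) = ≤-trans (by {e = + 4 * (S - + 4) + + 2} (# 4 ⊗ ⌞ 4≤S ⌟ ⊕ # 2) (lem S)) (ch′-s (ℕ.≤-antisym (ℕ.≤-pred l) (¬W⁻ {x} h)) i)
      by-W : inW x ≡ true ⊎ inW x ≡ false → leaf x ≡ true ⊎ leaf x ≡ false → nextW x ≡ true ⊎ nextW x ≡ false → 0ℤ ≤ ch′ x ⊎ Exceptional x
      by-W (inj₁ h) (inj₁ l) _ = inj₁ (ch′-leaf {x} l)
      by-W (inj₁ h) (inj₂ l) _ = inj₁ (≤-trans 0≤+ (ch′-small h l))
      by-W (inj₂ h) _ (inj₁ nx) = let w , g , q = hasNbr⁻ {inW} {x} nx in inj₁ (≤-reflexive (sym (ch′-next q (sym-G g))))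
      by-W (inj₂ h) _ (inj₂ nx) = by-deg nx (λ w → true≢false w h) (ℕ.<-cmp (d x) (suc s))

    large-s : 5 ℕ.≤ s → 0ℤ ≤ Σ ch′
    large-s 5≤s = ∑-nonneg V (λ {x} _ → fix x (classify x))
      where
      lem : ∀ S k → + 4 * S - + 20 + + 6 * k - 0ℤ ≡ + 4 * (S - + 5) + + 6 * k
      lem = solve-∀
      fix : ∀ x → 0ℤ ≤ ch′ x ⊎ Exceptional x → 0ℤ ≤ ch′ x
      fix x (inj₁ h) = h
      fix x (inj₂ (e , nx)) = ≤-trans (by {e = + 4 * (S - + 5) + + 6 * k} (# 4 ⊗ ⌞ +≤+ 5≤s ⌟ ⊕ # 6 ⊗ ∑-nonneg (Nb x) (λ {v} _ → 𝟙≥0 (d v ≡ᵇ s))) (lem S k)) (ch′-s+1 {x} e nx)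
        where k = ∑ (Nb x) (λ v → 𝟙 (d v ≡ᵇ s))

    -- The case s = 4

    module DegreeFour (conn : Connected G) (s≡4 : s ≡ 4) {x₀ : Fin n} (I₀ : I x₀ ≡ true)
      (I-size : ∑ (allFin n) (𝟙 ∘ I) ≡ + β₀-induced G (inV G s)) (hyp : - + 14 * eulerChar R < rhs G s)
      where

      S≡4 : S ≡ + 4
      S≡4 = cong +_ s≡4

      count : (Fin n → Bool) → ℤ
      count P = Σ (𝟙 ∘ P)

      count-mono³ : ∀ (a b c u : Fin n → Bool) → (∀ x → a x ≡ true → u x ≡ true) → (∀ x → b x ≡ true → u x ≡ true) → (∀ x → c x ≡ true → u x ≡ true) →
        (∀ x → a x ≡ true → b x ≡ true → ⊥) → (∀ x → a x ≡ true → c x ≡ true → ⊥) → (∀ x → b x ≡ true → c x ≡ true → ⊥) →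
        count a + count b + count c ≤ count u
      count-mono³ a b c u au bu cu ab ac bc = subst (_≤ count u)
          (trans (∑-+ V (λ x → 𝟙 (a x) + 𝟙 (b x)) (𝟙 ∘ c)) (cong (_+ count c) (∑-+ V (𝟙 ∘ a) (𝟙 ∘ b))))
          (∑-mono V (λ {x} _ → pt (a x) (b x) (c x) (u x) (au x) (bu x) (cu x) (ab x) (ac x) (bc x)))
        where
        pt : ∀ a b c u → (a ≡ true → u ≡ true) → (b ≡ true → u ≡ true) → (c ≡ true → u ≡ true) → (a ≡ true → b ≡ true → ⊥) →
          (a ≡ true → c ≡ true → ⊥) → (b ≡ true → c ≡ true → ⊥) → 𝟙 a + 𝟙 b + 𝟙 c ≤ 𝟙 u
        pt false false false u _ _ _ _ _ _ = 𝟙≥0 u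
        pt true true _ _ _ _ _ ab _ _ = ⊥-elim (ab refl refl)
        pt true false true _ _ _ _ _ ac _ = ⊥-elim (ac refl refl)
        pt false true true _ _ _ _ _ _ bc = ⊥-elim (bc refl refl)
        pt true false false u au _ _ _ _ _ = ≤-reflexive (cong 𝟙 (sym (au refl)))
        pt false true false u _ bu _ _ _ _ = ≤-reflexive (cong 𝟙 (sym (bu refl)))
        pt false false true u _ _ cu _ _ _ = ≤-reflexive (cong 𝟙 (sym (cu refl)))

      absurd : ∀ {k e} → 0ℤ ≤ e → e ≡ -[1+ k ] → ⊥
      absurd h refl with h
      ... | ()

      -- `μ` is -χ, `M` is the number of vertices minus twice the number of those of degree below 4,
      -- and `T` is half the difference between the two sides of the hypothesis.
      μ M T : ℤ
      μ = + size G - + n - + numFaces R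
      M = Σ (λ x → 1ℤ - + 2 * 𝟙 (inW x))
      T = + 7 * μ + M

      M≡ : M ≡ + n - + 2 * (+ numDegLe G 2 + + numDeg G 3)
      M≡ = trans (∑-- V (λ _ → 1ℤ) (λ x → + 2 * 𝟙 (inW x))) (cong₂ _-_ (trans (∑-1 V) length-V)
        (trans (∑-*ˡ V (+ 2) (𝟙 ∘ inW)) (cong (+ 2 *_) (trans (∑-cong V (λ {x} _ → split s s≡4 (d x)))
          (trans (∑-+ V (λ x → 𝟙 (d x ℕ.≤ᵇ 2)) (λ x → 𝟙 (d x ≡ᵇ 3))) (cong₂ _+_ (sym (length-filter≡∑ (λ x → d x ℕ.≤ᵇ 2) V)) (sym (length-filter≡∑ (λ x → d x ≡ᵇ 3) V))))))))
        where
        split : ∀ s → s ≡ 4 → ∀ k → 𝟙 (k ℕ.<ᵇ s) ≡ 𝟙 (k ℕ.≤ᵇ 2) + 𝟙 (k ≡ᵇ 3)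
        split _ refl 0 = refl
        split _ refl 1 = refl
        split _ refl 2 = refl
        split _ refl 3 = refl
        split _ refl (suc (suc (suc (suc k)))) = refl

      rhs≡ : rhs G s ≡ - + 2 * + n + + 4 * (+ numDegLe G 2 + + numDeg G 3)
      rhs≡ = at-4 s s≡4
        where
        lem : ∀ b n l k → (+ 4 - + 4) * b + + 2 * (+ 4 - + 5) * n + + 4 * l + + 2 * ((+ 5 - + 3) * k + 0ℤ) ≡ - + 2 * n + + 4 * (l + k)
        lem = solve-∀
        at-4 : ∀ s → s ≡ 4 → rhs G s ≡ - + 2 * + n + + 4 * (+ numDegLe G 2 + + numDeg G 3)
        at-4 _ refl = lem (+ β₀-induced G (inV G 4)) (+ n) (+ numDegLe G 2) (+ numDeg G 3)

      gap≡ : - + 14 * eulerChar R - rhs G s ≡ + 2 * T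
      gap≡ = trans (cong (λ z → - + 14 * eulerChar R - z) rhs≡) (trans (lem (+ n) (+ size G) (+ numFaces R) (+ numDegLe G 2 + + numDeg G 3)) (cong (λ z → + 2 * (+ 7 * μ + z)) (sym M≡)))
        where
        lem : ∀ n m f l → - + 14 * (n - m + f) - (- + 2 * n + + 4 * l) ≡ + 2 * (+ 7 * (m - n - f) + (n - + 2 * l))
        lem = solve-∀

      T≤-1 : T ≤ - 1ℤ
      T≤-1 = by-cases (T ≤? - 1ℤ)
        where
        by-cases : Dec (T ≤ - 1ℤ) → T ≤ - 1ℤ
        by-cases (yes h) = h
        by-cases (no h) = ⊥-elim (absurd {0} (⌞ i<j⇒suc[i]≤j hyp ⌟ ⊕ # 2 ⊗ ⌞ i<j⇒suc[i]≤j (≰⇒> h) ⌟)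
          (trans (lem (rhs G s) (- + 14 * eulerChar R) T) (trans (cong (λ z → - 1ℤ - z + + 2 * T) gap≡) (lem′ T))))
          where
          lem : ∀ r c t → r - (1ℤ + c) + + 2 * (t - (1ℤ + - 1ℤ)) ≡ - 1ℤ - (c - r) + + 2 * t
          lem = solve-∀
          lem′ : ∀ t → - 1ℤ - + 2 * t + + 2 * t ≡ - 1ℤ
          lem′ = solve-∀

      ∑ch′≤ : Σ ch′ ≤ + 24 * T
      ∑ch′≤ = ≤-trans (total I-size) (≤-reflexive (trans (cong (+ 12 *_) gap≡) (lem T)))
        where
        lem : ∀ t → + 12 * (+ 2 * t) ≡ + 24 * t
        lem = solve-∀

      -2≤μ : - + 2 ≤ μ
      -2≤μ = *-cancelˡ-≤-pos (- + 2) μ (+ 2) (by {e = (+ 2 * + size G + + 4 - (+ numOrbits R + + 2 * + n)) + (+ numOrbits R - + 2 * + numFaces R)}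
          (⌞ euler-cast (numOrbits R) n (size G) (EulerBound.euler-bound G simple conn R {x₀} {proj₁ (nbr x₀)} (proj₂ (nbr x₀))) ⌟ ⊕ ⌞ faces≤ ⌟)
          (lem (+ size G) (+ n) (+ numFaces R) (+ numOrbits R)))
        where
        euler-cast : ∀ o n m → o ℕ.+ 2 ℕ.* n ℕ.≤ 2 ℕ.* m ℕ.+ 4 → + o + + 2 * + n ≤ + 2 * + m + + 4
        euler-cast o n m h = subst₂ (λ a b → + o + a ≤ b + + 4) (pos-* 2 n) (pos-* 2 m) (+≤+ h)
        lem : ∀ m n f o → + 2 * (m - n - f) - + 2 * (- + 2) ≡ (+ 2 * m + + 4 - (o + + 2 * n)) + (o - + 2 * f)
        lem = solve-∀

      Q U : Fin n → Bool
      Q x = does (ch′ x <? 0ℤ)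
      U x = not (inW x) ∧ not (nextW x)

      does-true : ∀ {P : Set} (e : Dec P) → does e ≡ true → P
      does-true (yes h) _ = h

      does-false : ∀ {P : Set} (e : Dec P) → does e ≡ false → ¬ P
      does-false (no h) _ = h

      Q⁻ : ∀ {x} → Q x ≡ true → ch′ x < 0ℤ
      Q⁻ {x} = does-true (ch′ x <? 0ℤ)

      ¬Q⁻ : ∀ {x} → Q x ≡ false → 0ℤ ≤ ch′ x
      ¬Q⁻ {x} h = ≮⇒≥ (does-false (ch′ x <? 0ℤ) h)

      ¬Q : ∀ {x} → 0ℤ ≤ ch′ x → ¬ Q x ≡ true
      ¬Q h q = <⇒≱ (Q⁻ q) h

      Q⇒exceptional : ∀ {x} → Q x ≡ true → Exceptional x
      Q⇒exceptional {x} h = from (classify x)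
        where
        from : 0ℤ ≤ ch′ x ⊎ Exceptional x → Exceptional x
        from (inj₁ l) = ⊥-elim (¬Q l h)
        from (inj₂ e) = e

      exceptional-bound : ∀ {x} → Exceptional x → - + 4 + + 6 * ∑ (Nb x) (λ v → 𝟙 (d v ≡ᵇ s)) ≤ ch′ x
      exceptional-bound {x} (e , nx) = subst (λ z → + 4 * z - + 20 + + 6 * ∑ (Nb x) (λ v → 𝟙 (d v ≡ᵇ s)) ≤ ch′ x) S≡4 (ch′-s+1 {x} e nx)

      exceptional-surplus : ∀ {x v} → Exceptional x → G x v ≡ true → d v ≡ s → + 2 ≤ ch′ x
      exceptional-surplus {x} {v} e g q = ≤-trans (by {e = + 6 * (∑ (Nb x) (λ v → 𝟙 (d v ≡ᵇ s)) - 1ℤ)}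
          (# 6 ⊗ ⌞ ≤-trans (≤-reflexive (cong 𝟙 (sym (trans (cong (_≡ᵇ s) q) (≡ᵇ-refl s))))) (∑-≥-member {f = λ v → 𝟙 (d v ≡ᵇ s)} (∈-Nb⁺ g) (λ {v} _ → 𝟙≥0 (d v ≡ᵇ s))) ⌟)
          (lem (∑ (Nb x) (λ v → 𝟙 (d v ≡ᵇ s))))) (exceptional-bound {x} e)
        where
        lem : ∀ k → - + 4 + + 6 * k - + 2 ≡ + 6 * (k - 1ℤ)
        lem = solve-∀

      -- Deficits are at most 4, so raising the charge by 4 on `Q` makes it nonnegative everywhere.
      -- Any single value is then bounded by the sum.
      p : Fin n → ℤ
      p x = ch′ x + + 4 * 𝟙 (Q x)

      ch′≤p : ∀ x → ch′ x ≤ p x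
      ch′≤p x = by {e = + 4 * 𝟙 (Q x)} (# 4 ⊗ 𝟙≥0 (Q x)) (lem (ch′ x) (𝟙 (Q x)))
        where
        lem : ∀ c q → c + + 4 * q - c ≡ + 4 * q
        lem = solve-∀

      p≥0 : ∀ x → 0ℤ ≤ p x
      p≥0 x = from (Bool-cases (Q x))
        where
        from : Q x ≡ true ⊎ Q x ≡ false → 0ℤ ≤ p x
        from (inj₂ h) = ≤-trans (¬Q⁻ h) (ch′≤p x)
        from (inj₁ h) = subst (λ b → 0ℤ ≤ ch′ x + + 4 * 𝟙 b) (sym h) (by {e = (ch′ x - (- + 4 + + 6 * k)) + + 6 * k}
            (⌞ exceptional-bound {x} (Q⇒exceptional h) ⌟ ⊕ # 6 ⊗ ∑-nonneg (Nb x) (λ {v} _ → 𝟙≥0 (d v ≡ᵇ s))) (lem (ch′ x) k))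
          where
          k = ∑ (Nb x) (λ v → 𝟙 (d v ≡ᵇ s))
          lem : ∀ c k → c + + 4 * 1ℤ - 0ℤ ≡ (c - (- + 4 + + 6 * k)) + + 6 * k
          lem = solve-∀

      U⁺ : ∀ {x} → ¬ W x → nextW x ≡ false → U x ≡ true
      U⁺ h k = ∧-intro (not-intro (¬true⇒false h)) (not-intro k)

      Q⇒U : ∀ x → Q x ≡ true → U x ≡ true
      Q⇒U x h = let e , nx = Q⇒exceptional h in U⁺ {x} (s+1⇒¬W {x} e) nx

      safe⇒U : ∀ {x} → safe x ≡ true → U x ≡ true
      safe⇒U {x} h = U⁺ {x} (safe⇒¬W h) (safe⇒¬next {x} h)

      nbr-U : ∀ {x} → safe x ≡ true → ∀ v → G x v ≡ true → U v ≡ true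
      nbr-U {x} h v g = U⁺ {v} (safe-nbr h g) (¬true⇒false λ k → let w , g′ , q = hasNbr⁻ {inW} {v} k in true≢false h (dist2⇒unsafe q (sym-G g′) (sym-G g)))

      nbr-¬Q : ∀ {x} → d x ≡ s → ∀ v → G x v ≡ true → ¬ Q v ≡ true
      nbr-¬Q e v g h = ¬Q (≤-trans 0≤+ (exceptional-surplus {v} (Q⇒exceptional h) (sym-G g) e)) h

      count-nbrs : ∀ x → count (G x) ≡ D x
      count-nbrs x = sym (length-filter≡∑ (G x) V)

      -- Vertices of degree below `s` do not share neighbours, so at least as many vertices are
      -- adjacent to one; `U` omits both kinds.
      U≤M : count U ≤ M
      U≤M = ≤-trans (∑-mono V (λ {x} _ → pt (inW x) (nextW x) (exclusive x))) (by {e = count nextW - count inW} ⌞ W≤next ⌟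
          (trans (cong₂ _-_ (trans (∑-- V (λ _ → 1ℤ) (λ x → + 2 * 𝟙 (inW x))) (cong₂ _-_ (refl {x = Σ (λ _ → 1ℤ)}) (∑-*ˡ V (+ 2) (𝟙 ∘ inW))))
            (trans (∑-- V (λ x → 1ℤ - 𝟙 (inW x)) (𝟙 ∘ nextW)) (cong (_- count nextW) (∑-- V (λ _ → 1ℤ) (𝟙 ∘ inW)))))
            (lem (Σ (λ _ → 1ℤ)) (count inW) (count nextW))))
        where
        lem : ∀ v w x → (v - + 2 * w) - ((v - w) - x) ≡ x - w
        lem = solve-∀
        exclusive : ∀ x → inW x ≡ true → nextW x ≡ true → ⊥
        exclusive x h k = let w , g , q = hasNbr⁻ {inW} {x} k in s<⇒¬W {w} (W-nbr h g) q
        pt : ∀ a b → (a ≡ true → b ≡ true → ⊥) → 𝟙 (not a ∧ not b) ≤ 1ℤ - 𝟙 a - 𝟙 b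
        pt true true h = ⊥-elim (h refl refl)
        pt true false h = ≤-refl
        pt false true h = ≤-refl
        pt false false h = ≤-refl
        W≤next : count inW ≤ count nextW
        W≤next = ≤-trans (∑-mono V (λ {w} _ → own w)) (≤-trans (≤-reflexive swap) (∑-mono V (λ {u} _ → col u (Bool-cases (nextW u)))))
          where
          own : ∀ w → 𝟙 (inW w) ≤ Σ (λ u → 𝟙 (G w u) * 𝟙 (inW w))
          own w = ≤-trans (≤-reflexive (sym (trans (cong (λ b → 𝟙 b * 𝟙 (inW w)) (proj₂ (nbr w))) (*-identityˡ (𝟙 (inW w))))))
            (∑-≥-member {f = λ u → 𝟙 (G w u) * 𝟙 (inW w)} (∈-allFin (proj₁ (nbr w))) (λ {u} _ → 𝟙≥0 (G w u) ⊗ 𝟙≥0 (inW w)))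
          swap : Σ (λ w → Σ (λ u → 𝟙 (G w u) * 𝟙 (inW w))) ≡ Σ (λ u → ∑ (Nb u) (𝟙 ∘ inW))
          swap = trans (∑-comm V V (λ w u → 𝟙 (G w u) * 𝟙 (inW w))) (∑-cong V (λ {u} _ →
            trans (∑-cong V (λ {w} _ → cong (λ b → 𝟙 b * 𝟙 (inW w)) (proj₁ simple w u))) (sym (∑-filter (G u) V (𝟙 ∘ inW)))))
          col : ∀ u → nextW u ≡ true ⊎ nextW u ≡ false → ∑ (Nb u) (𝟙 ∘ inW) ≤ 𝟙 (nextW u)
          col u (inj₁ h) = ≤-trans (W-count u) (≤-reflexive (cong 𝟙 (sym h)))
          col u (inj₂ h) = ≤-reflexive (trans (∑-zero u (λ {v} g → cong 𝟙 (¬true⇒false (next-free {u} {v} h g)))) (cong 𝟙 (sym h)))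

      q : ℤ
      q = count Q

      safe₀ : safe x₀ ≡ true
      safe₀ = safe-I I₀

      D-I : ∀ {x} → I x ≡ true → D x ≡ + 4
      D-I i = cong +_ (trans (I-deg i) s≡4)

      -- `Q`, the vertex `x₀` and its four neighbours are disjoint inside `U`: an exceptional vertex
      -- next to one of degree four has charge at least -4 + 6.
      q+5≤M : q + + 5 ≤ M
      q+5≤M = ≤-trans (≤-reflexive (trans (lem q) (cong₂ (λ a b → q + a + b) (sym single) (sym (trans (count-nbrs x₀) (D-I I₀))))))
          (≤-trans (count-mono³ Q (x₀ ==_) (G x₀) U Q⇒U (λ x h → subst (λ z → U z ≡ true) (==-true {x = x₀} {y = x} h) (safe⇒U {x₀} safe₀)) (nbr-U safe₀)
            (λ x h e → ¬Q (ch′-I (subst (λ z → I z ≡ true) (==-true {x = x₀} {y = x} e) I₀)) h)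
            (λ x h g → nbr-¬Q (I-deg I₀) x g h)
            (λ x e g → G-≢ g (==-true {x = x₀} {y = x} e))) U≤M)
        where
        lem : ∀ q → q + + 5 ≡ q + 1ℤ + + 4
        lem = solve-∀
        single : count (x₀ ==_) ≡ 1ℤ
        single = ≤-antisym (∑-≤1 (x₀ ==_) Unique-V (λ {x} {y} _ _ h k → trans (sym (==-true {x = x₀} {y = x} h)) (==-true {x = x₀} {y = y} k)))
          (≤-trans (≤-reflexive (cong 𝟙 (sym (==-refl x₀)))) (∑-≥-member {f = λ x → 𝟙 (x₀ == x)} (∈-allFin x₀) (λ {x} _ → 𝟙≥0 (x₀ == x))))

      ∑p≡ : Σ p ≡ Σ ch′ + + 4 * q
      ∑p≡ = trans (∑-+ V ch′ (λ x → + 4 * 𝟙 (Q x))) (cong (λ z → Σ ch′ + z) (∑-*ˡ V (+ 4) (𝟙 ∘ Q)))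

      T+q≥0 : 0ℤ ≤ + 24 * T + + 4 * q
      T+q≥0 = ≤-trans (∑-nonneg V {p} (λ {x} _ → p≥0 x)) (≤-trans (≤-reflexive ∑p≡) (+-monoˡ-≤ (+ 4 * q) ∑ch′≤))

      -- Otherwise T ≥ -7 + (q + 5), so T ≤ -1 leaves q ≤ 1, too few vertices in deficit for 24T +
      -- 4q ≥ 0.
      μ≡-2 : μ ≡ - + 2
      μ≡-2 = sym (≤-antisym -2≤μ (by-cases (μ ≤? - + 2)))
        where
        lem : ∀ m M q → + 24 * (+ 7 * m + M) + + 4 * q + + 4 * (M - (q + + 5)) + + 28 * (m - - 1ℤ) + + 28 * (- 1ℤ - (+ 7 * m + M)) ≡ - + 20
        lem = solve-∀
        by-cases : Dec (μ ≤ - + 2) → μ ≤ - + 2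
        by-cases (yes h) = h
        by-cases (no h) = ⊥-elim (absurd {19} (T+q≥0 ⊕ # 4 ⊗ ⌞ q+5≤M ⌟ ⊕ # 28 ⊗ ⌞ i<j⇒suc[i]≤j (≰⇒> h) ⌟ ⊕ # 28 ⊗ ⌞ T≤-1 ⌟) (lem μ M q))

      T≡M-14 : T ≡ M - + 14
      T≡M-14 = trans (cong (λ m → + 7 * m + M) μ≡-2) (lem M)
        where
        lem : ∀ M → + 7 * - + 2 + M ≡ M - + 14
        lem = solve-∀

      -- T ≤ -2 would require q ≥ 12, but then M ≤ 12 and so q ≤ 7.
      T≡-1 : T ≡ - 1ℤ
      T≡-1 = ≤-antisym T≤-1 (by-cases (- 1ℤ ≤? T))
        where
        lem : ∀ M q → + 24 * (M - + 14) + + 4 * q + + 4 * (M - (q + + 5)) + + 28 * (- 1ℤ - (1ℤ + (M - + 14))) ≡ - + 20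
        lem = solve-∀
        by-cases : Dec (- 1ℤ ≤ T) → - 1ℤ ≤ T
        by-cases (yes h) = h
        by-cases (no h) = ⊥-elim (absurd {19} (T+q≥0 ⊕ # 4 ⊗ ⌞ q+5≤M ⌟ ⊕ # 28 ⊗ ⌞ i<j⇒suc[i]≤j (≰⇒> h) ⌟)
          (trans (cong (λ t → + 24 * t + + 4 * q + + 4 * (M - (q + + 5)) + + 28 * (- 1ℤ - (1ℤ + t))) T≡M-14) (lem M q)))

      M≡13 : M ≡ + 13
      M≡13 = trans (lem M) (cong (_+ + 14) (trans (sym T≡M-14) T≡-1))
        where
        lem : ∀ M → M ≡ M - + 14 + + 14
        lem = solve-∀

      q≤8 : q ≤ + 8
      q≤8 = by {e = + 13 - (q + + 5)} ⌞ subst (q + + 5 ≤_) M≡13 q+5≤M ⌟ (lem q)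
        where
        lem : ∀ q → + 8 - q ≡ + 13 - (q + + 5)
        lem = solve-∀

      6≤q : + 6 ≤ q
      6≤q = *-cancelˡ-≤-pos (+ 6) q (+ 4) (by (subst (λ t → 0ℤ ≤ + 24 * t + + 4 * q) T≡-1 T+q≥0) (lem q))
        where
        lem : ∀ q → + 4 * q - + 4 * + 6 ≡ + 24 * - 1ℤ + + 4 * q
        lem = solve-∀

      ∑p≤ : Σ p ≤ + 4 * q - + 24
      ∑p≤ = ≤-trans (≤-reflexive ∑p≡) (≤-trans (+-monoˡ-≤ (+ 4 * q) (subst (λ t → Σ ch′ ≤ + 24 * t) T≡-1 ∑ch′≤)) (≤-reflexive (lem q)))
        where
        lem : ∀ q → + 24 * - 1ℤ + + 4 * q ≡ + 4 * q - + 24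
        lem = solve-∀

      ∑p≤8 : Σ p ≤ + 8
      ∑p≤8 = ≤-trans ∑p≤ (by {e = + 4 * (+ 8 - q)} (# 4 ⊗ ⌞ q≤8 ⌟) (lem q))
        where
        lem : ∀ q → + 8 - (+ 4 * q - + 24) ≡ + 4 * (+ 8 - q)
        lem = solve-∀

      sum-p≤ : ∀ {xs} → Unique xs → ∑ xs p ≤ Σ p
      sum-p≤ u = ∑-sublist u (λ {x} _ → ∈-allFin x) (λ {x} _ → p≥0 x)

      -- Other vertices of degree below 4 end with charge at least 24, whereas all values of `p`
      -- together make at most 8.
      W⇒leaf : ∀ {w} → W w → leaf w ≡ true
      W⇒leaf {w} h = from (Bool-cases (leaf w))
        where
        lem : ∀ a → a + 0ℤ - + 24 + (+ 8 - (a + 0ℤ)) ≡ - + 16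
        lem = solve-∀
        from : leaf w ≡ true ⊎ leaf w ≡ false → leaf w ≡ true
        from (inj₁ l) = l
        from (inj₂ l) = ⊥-elim (absurd {15} (⌞ ≤-trans (≤-trans (ch′-small h l) (ch′≤p w)) (≤-reflexive (sym (+-identityʳ (p w)))) ⌟ ⊕ ⌞ ≤-trans (sum-p≤ {w ∷ []} ([] ∷ [])) ∑p≤8 ⌟) (lem (p w)))

      -- As vertices of degree below 4 are leaves, a vertex within distance two of one has degree at
      -- least 7.
      low⇒safe : ∀ {x} → ¬ W x → d x ℕ.≤ 6 → safe x ≡ true
      low⇒safe {x} h l = safe⁺ {x} h (λ g w → clash w (far₁ w (sym-G g))) two
        where
        clash : ∀ {w} → W w → 2 ℕ.* s ℕ.≤ d w ℕ.+ d x → ⊥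
        clash {w} Ww b = ℕ.1+n≰n (ℕ.≤-trans (subst₂ (λ k j → 2 ℕ.* k ℕ.≤ j ℕ.+ d x) s≡4 (≡ᵇ-true (d w) 1 (W⇒leaf {w} Ww)) b) (s≤s l))
        two : ∀ {y z} → G x y ≡ true → G y z ≡ true → ¬ W z
        two {y} {z} g k w with z ≟ᶠ x
        ... | yes refl = h w
        ... | no ne = clash w (far₂ (sym-G k) (sym-G g) ne)

      -- Such an edge lies in no triangle, so its ends have eight neighbours in all. Together with
      -- the six or more vertices of `Q` they would exceed the 13 places in `U`.
      no-four : ∀ {x y} → d x ≡ s → d y ≡ s → ¬ G x y ≡ true
      no-four {x} {y} e e′ g = absurd {0} (⌞ ≤-trans bound (≤-trans U≤M (≤-reflexive M≡13)) ⌟ ⊕ ⌞ 6≤q ⌟) (lem q)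
        where
        lem : ∀ q → + 13 - (q + + 4 + + 4) + (q - + 6) ≡ - 1ℤ
        lem = solve-∀
        D4 : ∀ {x} → d x ≡ s → count (G x) ≡ + 4
        D4 {x} e = trans (count-nbrs x) (cong +_ (trans e s≡4))
        bound : q + + 4 + + 4 ≤ count U
        bound = ≤-trans (≤-reflexive (cong₂ (λ a b → q + a + b) (sym (D4 e)) (sym (D4 e′))))
          (count-mono³ Q (G x) (G y) U Q⇒U (nbr-U (s⇒safe e)) (nbr-U (s⇒safe e′)) (λ v h k → nbr-¬Q e v k h) (λ v h k → nbr-¬Q e′ v k h)
            (λ v k k′ → no-common g (ℕ.≤-reflexive (trans (cong₂ ℕ._+_ e e′) (cong (s ℕ.+_) (sym (ℕ.+-identityʳ s))))) k k′))

      ≤1⇒nontri : ∀ {x y} → trc x y ≤ 1ℤ → ∃ λ ε → tri (x , y , ε) ≡ false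
      ≤1⇒nontri {x} {y} h = from (Bool-cases (tri (x , y , true))) (Bool-cases (tri (x , y , false)))
        where
        from : tri (x , y , true) ≡ true ⊎ tri (x , y , true) ≡ false → tri (x , y , false) ≡ true ⊎ tri (x , y , false) ≡ false → ∃ λ ε → tri (x , y , ε) ≡ false
        from (inj₂ a) _ = true , a
        from (inj₁ _) (inj₂ b) = false , b
        from (inj₁ a) (inj₁ b) = ⊥-elim (absurd {0} ⌞ subst₂ (λ u v → 𝟙 u + 𝟙 v ≤ 1ℤ) a b h ⌟ refl)

      nontri⇒≤1 : ∀ {x y} ε → tri (x , y , ε) ≡ false → trc x y ≤ 1ℤ
      nontri⇒≤1 {x} {y} true h = ≤-trans (≤-reflexive (cong (λ b → 𝟙 b + 𝟙 (tri (x , y , false))) h)) (≤-trans (≤-reflexive (+-identityˡ (𝟙 (tri (x , y , false))))) (𝟙≤1 (tri (x , y , false))))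
      nontri⇒≤1 {x} {y} false h = ≤-trans (≤-reflexive (trans (cong (λ b → 𝟙 (tri (x , y , true)) + 𝟙 b) h) (+-identityʳ (𝟙 (tri (x , y , true)))))) (𝟙≤1 (tri (x , y , true)))

      -- The edge to `x` has a nontriangular side, hence `y` has two nontriangular states, and -4 +
      -- 6 · 2 = 8.
      five-charge : ∀ {x y} → I x ≡ true → G x y ≡ true → d y ≡ suc s → + 8 ≤ ch′ y
      five-charge {x} {y} i g e = ≤-trans (by {e = + 6 * (∑ (Nb y) (ntc y) - + 2)} (# 6 ⊗ ⌞ two ⌟) (trans (cong (λ z → + 4 * z - + 20 + + 6 * ∑ (Nb y) (ntc y) - + 8) S≡4) (lem (∑ (Nb y) (ntc y)))))
          (ch′-s+1-safe {y} e (low⇒safe {y} (s+1⇒¬W {y} e) (ℕ.≤-trans (ℕ.≤-reflexive (trans e (cong suc s≡4))) (ℕ.n≤1+n 5))))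
        where
        lem : ∀ k → + 4 * + 4 - + 20 + + 6 * k - + 8 ≡ + 6 * (k - + 2)
        lem = solve-∀
        nt = ≤1⇒nontri {y} {x} (trc-s+1 e (I-deg i) (sym-G g))
        two : + 2 ≤ ∑ (Nb y) (ntc y)
        two = ntc≥2 {y} {x} (proj₁ nt) (sym-G g) (proj₂ nt)

      -- `y` alone exhausts the bound 8 on the sum of `p`. But `z` forces more: a surplus at `x` if
      -- its degree is at least 6, a surplus of its own if it is 5; degree 4 is excluded by
      -- `no-four`.
      no-five-at : ∀ {x y z} ε → I x ≡ true → G x y ≡ true → d y ≡ suc s → G x z ≡ true → y ≢ z → tri (x , z , ε) ≡ false → ⊥
      no-five-at {x} {y} {z} ε i g e gz y≢z nz = by-degree (ℕ.<-cmp (d z) (suc s))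
        where
        overfull : ∀ {a b} → + 8 ≤ a → 1ℤ ≤ b → a + (b + 0ℤ) ≤ + 8 → ⊥
        overfull {a} {b} h k l = absurd {0} (⌞ h ⌟ ⊕ ⌞ k ⌟ ⊕ ⌞ l ⌟) (lem a b)
          where
          lem : ∀ a b → (a - + 8) + (b - 1ℤ) + (+ 8 - (a + (b + 0ℤ))) ≡ - 1ℤ
          lem = solve-∀
        clash : ∀ {w} → y ≢ w → 1ℤ ≤ ch′ w → ⊥
        clash {w} ne h = overfull {p y} {p w} (≤-trans (five-charge i g e) (ch′≤p y)) (≤-trans h (ch′≤p w)) (≤-trans (sum-p≤ {y ∷ w ∷ []} ((ne ∷ []) ∷ [] ∷ [])) ∑p≤8)
        by-degree : _ → ⊥
        by-degree (tri> _ _ l) = clash {x} (λ q → G-≢ g (sym q)) (≤-trans lit (ch′-I-surplus i gz l (nontri⇒≤1 {x} {z} ε nz)))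
        by-degree (tri≈ _ e′ _) = clash {z} y≢z (≤-trans lit (exceptional-surplus {z} {x} (e′ , safe⇒¬next {z} (low⇒safe {z} (s+1⇒¬W {z} e′) (ℕ.≤-trans (ℕ.≤-reflexive (trans e′ (cong suc s≡4))) (ℕ.n≤1+n 5)))) (sym-G gz) (I-deg i)))
        by-degree (tri< l _ _) = no-four (I-deg i) (ℕ.≤-antisym (ℕ.≤-pred l) (safe-nbr-s≤ (safe-I i) gz)) gz

      no-five : ∀ {x y} → I x ≡ true → G x y ≡ true → ¬ d y ≡ suc s
      no-five {x} {y} i g e = from (≤1⇒nontri {x} {y} (subst (_≤ 1ℤ) (sym (trc-sym g)) (trc-s+1 e (I-deg i) (sym-G g))))
        where
        from : (∃ λ ε → tri (x , y , ε) ≡ false) → ⊥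
        from (ε , nt) = no-five-at {x} {y} {rotS x (not ε) y} (not ε) i g e (rotS-closed (not ε) g)
          (λ q → ℕ.<-irrefl refl (ℕ.≤-trans (¬W⇒2≤ {x} (I⇒¬W i)) (rotS-fix⇒ (not ε) g (sym q)))) (partner {x} {y} ε g nt)

      I-nbr-big : ∀ {x a} → I x ≡ true → G x a ≡ true → suc s ℕ.< d a
      I-nbr-big {x} {a} i g = ℕ.≤∧≢⇒< (ℕ.≤∧≢⇒< (safe-nbr-s≤ (safe-I i) g) (λ e → no-four (I-deg i) (sym e) g)) (λ e → no-five i g (sym e))

      i : ℤ
      i = count I

      -- I, the four neighbours of `x₀` and `Q` share the 13 places in `U` without overlap.
      i+q≤9 : i + q ≤ + 9
      i+q≤9 = by {e = + 13 - (i + + 4 + q)} ⌞ ≤-trans (≤-trans (≤-reflexive (cong (λ k → i + k + q) (sym (trans (count-nbrs x₀) (D-I I₀)))))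
          (count-mono³ I (G x₀) Q U (λ x h → safe⇒U {x} (safe-I h)) (nbr-U safe₀) Q⇒U
            (λ x h g → I-indep I₀ h g) (λ x h k → ¬Q (ch′-I h) k) (λ x g h → nbr-¬Q (I-deg I₀) x g h))) (≤-trans U≤M (≤-reflexive M≡13)) ⌟ (lem i q)
        where
        lem : ∀ i q → + 9 - (i + q) ≡ + 13 - (i + + 4 + q)
        lem = solve-∀

      ∑I≤ : ∀ x → ∑ (Nb x) (𝟙 ∘ I) ≤ i
      ∑I≤ x = ∑-sublist (Unique-Nb x) (λ {y} _ → ∈-allFin y) (λ {y} _ → 𝟙≥0 (I y))

      τ≤ : ∀ x → τ x ≤ + 2 * ∑ (Nb x) (𝟙 ∘ I)
      τ≤ x = ≤-trans (∑-mono (Nb x) (λ {v} _ → pt (I v) (trc≤2 x v))) (≤-reflexive (∑-*ˡ (Nb x) (+ 2) (𝟙 ∘ I)))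
        where
        pt : ∀ b {t} → t ≤ + 2 → 𝟙 b * t ≤ + 2 * 𝟙 b
        pt true {t} h = ≤-trans (≤-reflexive (*-identityˡ t)) h
        pt false {t} h = ≤-reflexive (*-zeroˡ t)

      A-charge : ∀ {a} → G x₀ a ≡ true → + 28 * D a - + 4 * τ a - + 144 ≤ p a
      A-charge {a} g = ≤-trans (≤-trans (≤-reflexive (trans (lem (+ 28 * D a - + 4 * τ a)) (cong (λ z → + 28 * D a - + 4 * τ a - + 12 * (+ 2 * z + + 4)) (sym S≡4)))) (ch′-big′ {a} (I-nbr-big I₀ g) next-a)) (ch′≤p a)
        where
        lem : ∀ k → k - + 144 ≡ k - + 12 * (+ 2 * + 4 + + 4)
        lem = solve-∀
        next-a : nextW a ≡ false
        next-a = not-true (proj₂ (∧-true {not (inW a)} (nbr-U safe₀ a g)))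

      D-A : ∀ {a} → G x₀ a ≡ true → + 6 ≤ D a
      D-A {a} g = +≤+ (ℕ.≤-trans (ℕ.≤-reflexive (cong (2 ℕ.+_) (sym s≡4))) (I-nbr-big I₀ g))

      -- A neighbour of `x₀` has degree at least 6 and gives at most 8 to each vertex of I, keeping
      -- 28 · 6 - 144 - 8i. Four of these fit into 4q - 24, which is at most 12 - 4i, only if i ≥ 3.
      3≤i : + 3 ≤ i
      3≤i = *-cancelˡ-≤-pos (+ 3) i (+ 28) (by {e = ((+ 4 * q - + 24) - (+ 24 - + 8 * i) * + 4) + + 4 * (+ 9 - (i + q))}
          (⌞ ≤-trans (subst (λ k → (+ 24 - + 8 * i) * k ≤ ∑ (Nb x₀) p) (D-I I₀) (∑-≥-const x₀ (+ 24 - + 8 * i) pt)) (≤-trans (sum-p≤ (Unique-Nb x₀)) ∑p≤) ⌟ ⊕ # 4 ⊗ ⌞ i+q≤9 ⌟) (lem i q))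
        where
        lem : ∀ i q → + 28 * i - + 28 * + 3 ≡ ((+ 4 * q - + 24) - (+ 24 - + 8 * i) * + 4) + + 4 * (+ 9 - (i + q))
        lem = solve-∀
        pt : ∀ {a} → G x₀ a ≡ true → + 24 - + 8 * i ≤ p a
        pt {a} g = by {e = (p a - (+ 28 * D a - + 4 * τ a - + 144)) + + 28 * (D a - + 6) + + 4 * (+ 2 * k - τ a) + + 8 * (i - k)}
          (⌞ A-charge g ⌟ ⊕ # 28 ⊗ ⌞ D-A g ⌟ ⊕ # 4 ⊗ ⌞ τ≤ a ⌟ ⊕ # 8 ⊗ ⌞ ∑I≤ a ⌟) (lem′ (p a) (D a) (τ a) k i)
          where
          k = ∑ (Nb a) (𝟙 ∘ I)
          lem′ : ∀ p d t k i → p - (+ 24 - + 8 * i) ≡ (p - (+ 28 * d - + 4 * t - + 144)) + + 28 * (d - + 6) + + 4 * (+ 2 * k - t) + + 8 * (i - k)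
          lem′ = solve-∀

      q≡6 : q ≡ + 6
      q≡6 = sym (≤-antisym 6≤q (by {e = (+ 9 - (i + q)) + (i - + 3)} (⌞ i+q≤9 ⌟ ⊕ ⌞ 3≤i ⌟) (lem i q)))
        where
        lem : ∀ i q → + 6 - q ≡ (+ 9 - (i + q)) + (i - + 3)
        lem = solve-∀

      i≡3 : i ≡ + 3
      i≡3 = sym (≤-antisym 3≤i (by {e = (+ 9 - (i + q)) + (q - + 6)} (⌞ i+q≤9 ⌟ ⊕ ⌞ 6≤q ⌟) (lem i q)))
        where
        lem : ∀ i q → + 3 - i ≡ (+ 9 - (i + q)) + (q - + 6)
        lem = solve-∀

      -- The only remaining configuration: I consists of three vertices joined to four common neighbours of degree six.
      module _ {a} (g : G x₀ a ≡ true) where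

        pa≤0 : p a ≤ 0ℤ
        pa≤0 = ≤-trans (≤-trans (≤-reflexive (sym (+-identityʳ (p a)))) (sum-p≤ {a ∷ []} ([] ∷ []))) (≤-trans ∑p≤ (≤-reflexive (cong (λ k → + 4 * k - + 24) q≡6)))

        k = ∑ (Nb a) (𝟙 ∘ I)

        k≤3 : k ≤ + 3
        k≤3 = ≤-trans (∑I≤ a) (≤-reflexive i≡3)

        τ≥6 : + 6 ≤ τ a
        τ≥6 = *-cancelˡ-≤-pos (+ 6) (τ a) (+ 4) (by {e = (0ℤ - (+ 28 * D a - + 4 * τ a - + 144)) + + 28 * (D a - + 6)}
          (⌞ ≤-trans (A-charge g) pa≤0 ⌟ ⊕ # 28 ⊗ ⌞ D-A g ⌟) (lem (D a) (τ a)))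
          where
          lem : ∀ d t → + 4 * t - + 4 * + 6 ≡ (0ℤ - (+ 28 * d - + 4 * t - + 144)) + + 28 * (d - + 6)
          lem = solve-∀

        3≤k : + 3 ≤ k
        3≤k = *-cancelˡ-≤-pos (+ 3) k (+ 2) (≤-trans τ≥6 (τ≤ a))

        D≤6 : D a ≤ + 6
        D≤6 = *-cancelˡ-≤-pos (D a) (+ 6) (+ 28) (by {e = (0ℤ - (+ 28 * D a - + 4 * τ a - + 144)) + + 4 * (+ 2 * k - τ a) + + 8 * (+ 3 - k)}
          (⌞ ≤-trans (A-charge g) pa≤0 ⌟ ⊕ # 4 ⊗ ⌞ τ≤ a ⌟ ⊕ # 8 ⊗ ⌞ k≤3 ⌟) (lem (D a) (τ a) k))
          where
          lem : ∀ d t k → + 28 * + 6 - + 28 * d ≡ (0ℤ - (+ 28 * d - + 4 * t - + 144)) + + 4 * (+ 2 * k - t) + + 8 * (+ 3 - k)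
          lem = solve-∀

        -- Three neighbours in I must account for six triangular sides, so none of their edges to
        -- `a` has a nontriangular one.
        I-all-tri : ∀ {v} → G a v ≡ true → I v ≡ true → tri (a , v , true) ≡ true
        I-all-tri {v} h j = from (Bool-cases (tri (a , v , true)))
          where
          deficit : Fin n → ℤ
          deficit v = 𝟙 (I v) * (+ 2 - trc a v)
          deficit≥0 : ∀ v → 0ℤ ≤ deficit v
          deficit≥0 v = 𝟙≥0 (I v) ⊗ ⌞ trc≤2 a v ⌟
          total≤0 : ∑ (Nb a) deficit ≤ 0ℤ
          total≤0 = ≤-trans (≤-reflexive (trans (∑-cong (Nb a) (λ {v} _ → lem (𝟙 (I v)) (trc a v))) (trans (∑-- (Nb a) (λ v → + 2 * 𝟙 (I v)) (λ v → 𝟙 (I v) * trc a v)) (cong (_- τ a) (∑-*ˡ (Nb a) (+ 2) (𝟙 ∘ I))))))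
            (by {e = + 2 * (+ 3 - k) + (τ a - + 6)} (# 2 ⊗ ⌞ k≤3 ⌟ ⊕ ⌞ τ≥6 ⌟) (lem′ k (τ a)))
            where
            lem : ∀ b t → b * (+ 2 - t) ≡ + 2 * b - b * t
            lem = solve-∀
            lem′ : ∀ k t → 0ℤ - (+ 2 * k - t) ≡ + 2 * (+ 3 - k) + (t - + 6)
            lem′ = solve-∀
          v≤0 : deficit v ≤ 0ℤ
          v≤0 = ≤-trans (∑-≥-member {f = deficit} (∈-Nb⁺ h) (λ {y} _ → deficit≥0 y)) total≤0
          from : tri (a , v , true) ≡ true ⊎ tri (a , v , true) ≡ false → tri (a , v , true) ≡ true
          from (inj₁ t) = t
          from (inj₂ t) = ⊥-elim (absurd {0} (⌞ v≤0 ⌟ ⊕ ⌞ nontri⇒≤1 {a} {v} true t ⌟)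
            (trans (cong (λ b → 0ℤ - 𝟙 b * (+ 2 - trc a v) + (1ℤ - trc a v)) j) (lem (trc a v))))
            where
            lem : ∀ t → 0ℤ - 1ℤ * (+ 2 - t) + (1ℤ - t) ≡ - 1ℤ
            lem = solve-∀

        I-adjacent : ∀ {v} → I v ≡ true → G a v ≡ true
        I-adjacent {v} j = from (Bool-cases (G a v))
          where
          missing : Fin n → ℤ
          missing v = (1ℤ - 𝟙 (G a v)) * 𝟙 (I v)
          missing≥0 : ∀ v → 0ℤ ≤ missing v
          missing≥0 v = ⌞ 𝟙≤1 (G a v) ⌟ ⊗ 𝟙≥0 (I v)
          total≤0 : Σ missing ≤ 0ℤ
          total≤0 = ≤-trans (≤-reflexive (trans (∑-cong V (λ {v} _ → lem (𝟙 (G a v)) (𝟙 (I v)))) (trans (∑-- V (𝟙 ∘ I) (λ v → 𝟙 (G a v) * 𝟙 (I v))) (cong (λ z → i - z) (sym (∑-filter (G a) V (𝟙 ∘ I)))))))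
            (≤-trans (≤-reflexive (cong (_- k) i≡3)) (by {e = k - + 3} ⌞ 3≤k ⌟ (lem′ k)))
            where
            lem : ∀ a b → (1ℤ - a) * b ≡ b - a * b
            lem = solve-∀
            lem′ : ∀ k → 0ℤ - (+ 3 - k) ≡ k - + 3
            lem′ = solve-∀
          from : G a v ≡ true ⊎ G a v ≡ false → G a v ≡ true
          from (inj₁ h) = h
          from (inj₂ h) = ⊥-elim (absurd {0} ⌞ ≤-trans (∑-≥-member {f = missing} (∈-allFin v) (λ {y} _ → missing≥0 y)) total≤0 ⌟
            (cong₂ (λ b c → 0ℤ - (1ℤ - 𝟙 b) * 𝟙 c) h j))

      -- `v` is adjacent to all four neighbours of `x₀`, and its degree is four.
      I-nbrs : ∀ {v u} → I v ≡ true → G v u ≡ true → G x₀ u ≡ true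
      I-nbrs {v} {u} j h = from (Bool-cases (G x₀ u)) (∑-full (Nb v) (𝟙 ∘ G x₀) (λ {x} _ → 𝟙≤1 (G x₀ x)) full (∈-Nb⁺ h))
        where
        full : + length (Nb v) ≤ ∑ (Nb v) (𝟙 ∘ G x₀)
        full = ≤-trans (≤-reflexive (trans (D-I j) (trans (sym (D-I I₀)) (sym (∑-1 (Nb x₀))))))
          (∑-inj {xs = Nb x₀} {ys = Nb v} (λ _ → true) (G x₀) (λ x → x) (Unique-Nb x₀) (λ m _ → ∈-Nb⁺ (sym-G (I-adjacent (∈-Nb⁻ m) j)) , ∈-Nb⁻ m) (λ _ _ _ _ e → e))
        from : G x₀ u ≡ true ⊎ G x₀ u ≡ false → 1ℤ ≤ 𝟙 (G x₀ u) → G x₀ u ≡ true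
        from (inj₁ e) _ = e
        from (inj₂ e) l = ⊥-elim (absurd {0} ⌞ subst (λ b → 1ℤ ≤ 𝟙 b) e l ⌟ refl)

      -- Rotating the three neighbours in I past their triangular sides gives three more neighbours,
      -- which lie in the neighbourhood of `x₀`. That makes six, the full degree of `a`.
      A-nbrs : ∀ {a u} → G x₀ a ≡ true → G a u ≡ true → I u ≡ true ⊎ G x₀ u ≡ true
      A-nbrs {a} {u} g h = from (Bool-cases (I u)) (Bool-cases (G x₀ u)) (∑-full (Nb a) φ (λ {x} _ → φ≤1 x) full (∈-Nb⁺ h))
        where
        φ : Fin n → ℤ
        φ x = 𝟙 (I x) + 𝟙 (G x₀ x)
        φ≤1 : ∀ x → φ x ≤ 1ℤ
        φ≤1 x = pt (I x) (G x₀ x) (λ j e → I-indep I₀ j e)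
          where
          pt : ∀ a b → (a ≡ true → b ≡ true → ⊥) → 𝟙 a + 𝟙 b ≤ 1ℤ
          pt true true h = ⊥-elim (h refl refl)
          pt true false h = ≤-refl
          pt false b h = ≤-trans (≤-reflexive (+-identityˡ (𝟙 b))) (𝟙≤1 b)
        rotated : ∑ (Nb a) (𝟙 ∘ I) ≤ ∑ (Nb a) (𝟙 ∘ G x₀)
        rotated = ∑-inj {xs = Nb a} {ys = Nb a} I (G x₀) (rotS a false) (Unique-Nb a)
          (λ {v} m j → ∈-Nb⁺ (rotS-closed false (∈-Nb⁻ m)) , I-nbrs j (tri-adj {a} {v} {true} (∈-Nb⁻ m) (I-all-tri g (∈-Nb⁻ m) j)))
          (λ m m′ _ _ → rotS-inj false (∈-Nb⁻ m) (∈-Nb⁻ m′))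
        full : + length (Nb a) ≤ ∑ (Nb a) φ
        full = ≤-trans (D≤6 g) (≤-trans (+-mono-≤ (3≤k g) (≤-trans (3≤k g) rotated)) (≤-reflexive (sym (∑-+ (Nb a) (𝟙 ∘ I) (𝟙 ∘ G x₀)))))
        from : I u ≡ true ⊎ I u ≡ false → G x₀ u ≡ true ⊎ G x₀ u ≡ false → 1ℤ ≤ φ u → I u ≡ true ⊎ G x₀ u ≡ true
        from (inj₁ j) _ _ = inj₁ j
        from (inj₂ _) (inj₁ e) _ = inj₂ e
        from (inj₂ j) (inj₂ e) l = ⊥-elim (absurd {0} ⌞ subst₂ (λ b c → 1ℤ ≤ 𝟙 b + 𝟙 c) j e l ⌟ refl)

      reach : ∀ {x y} → Walk G x y → I x ≡ true ⊎ G x₀ x ≡ true → I y ≡ true ⊎ G x₀ y ≡ true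
      reach here c = c
      reach (step h w) (inj₁ j) = reach w (inj₂ (I-nbrs j h))
      reach (step h w) (inj₂ g) = reach w (A-nbrs g h)

      impossible : ⊥
      impossible = from (∑-pos-member V Q (≤-trans lit (≤-reflexive (sym q≡6))))
        where
        from : (∃ λ x → x ∈ V × Q x ≡ true) → ⊥
        from (x , _ , h) = end (reach (conn x₀ x) (inj₁ I₀))
          where
          end : I x ≡ true ⊎ G x₀ x ≡ true → ⊥
          end (inj₁ j) = ¬Q (ch′-I j) h
          end (inj₂ g) = nbr-¬Q (I-deg I₀) x g h

open Charges

-- Maximum independent sets, the meaning of a large B′, and the contradiction

module Assembly where
  open import Data.Nat hiding (ℕ; zero; suc; z≤n; s≤s)
  open import Data.Nat.Properties
  open import Data.Integer as ℤ using (ℤ; +_)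
  import Data.Integer.Properties as ℤ
  import Data.Integer.Tactic.RingSolver as ℤ
  open import Data.Fin.Subset using (Subset; ∣_∣)
  open import Data.Vec using ([]; _∷_; lookup; _[_]≔_; replicate)
  open import Data.Vec.Properties using (lookup∘update′; lookup-replicate)
  open import Data.Bool.Properties using (∧-comm)
  open import Data.List using (tabulate)

  foldr-⊔-≥ : ∀ {d x} {xs : List ℕ} → x ∈ xs → x ≤ foldr _⊔_ d xs
  foldr-⊔-≥ (here refl) = m≤m⊔n _ _
  foldr-⊔-≥ {xs = y ∷ _} (there m) = ≤-trans (foldr-⊔-≥ m) (m≤n⊔m y _)

  foldr-⊔-sel : ∀ d xs → foldr _⊔_ d xs ≡ d ⊎ foldr _⊔_ d xs ∈ xs
  foldr-⊔-sel d [] = inj₁ refl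
  foldr-⊔-sel d (x ∷ xs) with ⊔-sel x (foldr _⊔_ d xs)
  ... | inj₁ e = inj₂ (here e)
  ... | inj₂ e with foldr-⊔-sel d xs
  ...   | inj₁ h = inj₁ (trans e h)
  ...   | inj₂ h = inj₂ (subst (_∈ x ∷ xs) (sym e) (there h))

  ∑-lookup : ∀ {m} {A : Set} (J : Subset m) (h : Fin m → A) (g : A → ℤ) → (∀ k → g (h k) ≡ 𝟙 (lookup J k)) → ∑ (tabulate h) g ≡ + ∣ J ∣
  ∑-lookup [] h g e = refl
  ∑-lookup (true ∷ J) h g e = cong₂ ℤ._+_ (e zero) (∑-lookup J (h ∘ suc) g (e ∘ suc))
  ∑-lookup (false ∷ J) h g e = trans (cong₂ ℤ._+_ (e zero) (∑-lookup J (h ∘ suc) g (e ∘ suc))) (ℤ.+-identityˡ _)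

  ∣empty∣ : ∀ m → ∣ replicate m false ∣ ≡ 0
  ∣empty∣ zero = refl
  ∣empty∣ (suc m) = ∣empty∣ m

  module MaximumIndependent {n} (G : Graph n) (simple : Simple G) (P : Fin n → Bool) where

    Good : Subset n → Set
    Good J = (∀ {x y} → lookup J x ≡ true → lookup J y ≡ true → ¬ G x y ≡ true) × (∀ {x} → lookup J x ≡ true → P x ≡ true)

    goodᵇ : Subset n → Bool
    goodᵇ J = independentᵇ G J ∧ Data.Bool.ListAction.all (λ x → not (lookup J x) ∨ P x) (allFin n)

    good⁻ : ∀ J → goodᵇ J ≡ true → Good J
    good⁻ J h = (λ {x} {y} a b g → indep x y a b g) , λ {x} a → sub x a
      where
      indep : ∀ x y → lookup J x ≡ true → lookup J y ≡ true → ¬ G x y ≡ true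
      indep x y a b g = true≢false (∧-intro a (∧-intro b g)) (not-true (all⁻ (proj₁ (∧-true {independentᵇ G J} h)) (∈-cartesianProduct⁺ (∈-allFin x) (∈-allFin y))))
      sub : ∀ x → lookup J x ≡ true → P x ≡ true
      sub x a = from (∨-true (all⁻ {p = λ x → not (lookup J x) ∨ P x} (proj₂ (∧-true {independentᵇ G J} h)) (∈-allFin x)))
        where
        from : not (lookup J x) ≡ true ⊎ P x ≡ true → P x ≡ true
        from (inj₁ e) = ⊥-elim (true≢false a (not-true e))
        from (inj₂ e) = e

    good⁺ : ∀ J → Good J → goodᵇ J ≡ true
    good⁺ J (indep , sub) = ∧-intro (all⁺ (cartesianProduct (allFin n) (allFin n)) (λ { {x , y} _ → not-intro (¬true⇒false λ h →
        let a , bg = ∧-true {lookup J x} h ; b , g = ∧-true {lookup J y} bg in indep a b g) }))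
      (all⁺ {p = λ x → not (lookup J x) ∨ P x} (allFin n) (λ {x} _ → by-case x (Bool-cases (lookup J x))))
      where
      by-case : ∀ x → lookup J x ≡ true ⊎ lookup J x ≡ false → not (lookup J x) ∨ P x ≡ true
      by-case x (inj₁ a) = ∨-true₂ (not (lookup J x)) (sub a)
      by-case x (inj₂ a) = ∨-true₁ (not-intro a)

    β : ℕ
    β = β₀-induced G P

    good≤β : ∀ J → Good J → ∣ J ∣ ≤ β
    good≤β J h = foldr-⊔-≥ (∈-map⁺ ∣_∣ (∈-filterᵇ⁺ {p = goodᵇ} (∈-allSubsets J) (good⁺ J h)))

    β-attained : ∃ λ J → Good J × ∣ J ∣ ≡ β
    β-attained with foldr-⊔-sel 0 (map ∣_∣ (filterᵇ goodᵇ (allSubsets n)))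
    ... | inj₁ e = replicate n false , ((λ {x} a _ _ → true≢false a (lookup-replicate x false)) , λ {x} a → ⊥-elim (true≢false a (lookup-replicate x false))) , trans (∣empty∣ n) (sym e)
    ... | inj₂ m = let J , i , e = ∈-map⁻ ∣_∣ m in J , good⁻ J (proj₂ (∈-filterᵇ⁻ (allSubsets n) i)) , sym e

    maximal : ∀ J → Good J → ∣ J ∣ ≡ β → ∀ {y} → P y ≡ true → lookup J y ≡ false → ∃ λ x → lookup J x ≡ true × G y x ≡ true
    maximal J (indep , sub) size {y} Py y∉ = from (Bool-cases (any (λ x → lookup J x ∧ G y x) (allFin n)))
      where
      J′ = J [ y ]≔ true
      member : ∀ {x} → lookup J′ x ≡ true → x ≡ y ⊎ lookup J x ≡ true
      member {x} h with x ≟ᶠ y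
      ... | yes e = inj₁ e
      ... | no ne = inj₂ (trans (sym (lookup∘update′ ne J true)) h)
      from : any (λ x → lookup J x ∧ G y x) (allFin n) ≡ true ⊎ any (λ x → lookup J x ∧ G y x) (allFin n) ≡ false → ∃ λ x → lookup J x ≡ true × G y x ≡ true
      from (inj₁ h) = let x , _ , e = any⁻ {p = λ x → lookup J x ∧ G y x} (allFin n) h in x , ∧-true e
      from (inj₂ h) = ⊥-elim (1+n≰n (≤-trans (≤-reflexive (trans (cong suc (sym size)) (sym (∣insert∣ J y y∉)))) (good≤β J′ (indep′ , sub′))))
        where
        away : ∀ {x} → lookup J x ≡ true → ¬ G y x ≡ true
        away {x} a g = true≢false (any⁺ {p = λ x → lookup J x ∧ G y x} (∈-allFin x) (∧-intro a g)) h
        indep″ : ∀ {a b} → a ≡ y ⊎ lookup J a ≡ true → b ≡ y ⊎ lookup J b ≡ true → ¬ G a b ≡ true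
        indep″ (inj₁ refl) (inj₁ refl) g = true≢false g (proj₂ simple y)
        indep″ (inj₁ refl) (inj₂ b) g = away b g
        indep″ {a} (inj₂ m) (inj₁ refl) g = away m (trans (proj₁ simple y a) g)
        indep″ (inj₂ m) (inj₂ b) g = indep m b g
        indep′ : ∀ {a b} → lookup J′ a ≡ true → lookup J′ b ≡ true → ¬ G a b ≡ true
        indep′ a b = indep″ (member a) (member b)
        sub′ : ∀ {x} → lookup J′ x ≡ true → P x ≡ true
        sub′ {x} a = by-case (member a)
          where
          by-case : x ≡ y ⊎ lookup J x ≡ true → P x ≡ true
          by-case (inj₁ refl) = Py
          by-case (inj₂ m) = sub m

  module LargeB′ {n} (G : Graph n) (simple : Simple G) (s : ℕ) (large : 2 * s ∸ 2 < B′ G) where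
    open Graphs G simple

    b₁-≤ : ∀ {x y} → dist12 G x y ≡ true → b₁ G ≤ deg G x + deg G y ∸ 1
    b₁-≤ {x} {y} h = foldr-⊓-≤ (∈-map⁺ _ (∈-filterᵇ⁺ (∈-cartesianProduct⁺ (∈-allFin x) (∈-allFin y)) h))

    b₃-≤ : ∀ {x y} → toℕ x < toℕ y → G x y ≡ true → b₃ G ≤ (deg G x + deg G y ∸ 1 ∸ commonNbrs G x y) ⊔ (deg G x + deg G y ∸ 3)
    b₃-≤ l g = foldr-⊓-≤ (∈-map⁺ _ (∈-edgeList⁺ l g))

    -- Truncation is harmless: anything above `t ∸ 2` is positive, so `1 + c` is at most `k` and can
    -- be moved across. The strict inequality pays for the 1.
    shift : ∀ {t k} c → t ∸ 2 < k ∸ (1 + c) → t + c ≤ k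
    shift {t} {k} c h = begin
      t + c                    ≤⟨ +-monoˡ-≤ c (m≤n+m∸n t 2) ⟩
      2 + (t ∸ 2) + c          ≡⟨ cong suc (sym (+-suc (t ∸ 2) c)) ⟩
      suc (t ∸ 2) + (1 + c)    ≤⟨ m≤o∸n⇒m+n≤o (suc (t ∸ 2)) 1+c≤k h ⟩
      k ∎
      where
      open ≤-Reasoning
      1+c≤k : 1 + c ≤ k
      1+c≤k = ≮⇒≥ λ l → n≮0 (subst (t ∸ 2 <_) (m≤n⇒m∸n≡0 (<⇒≤ l)) h)

    far : ∀ {x y} → x ≢ y → (G x y ≡ true ⊎ ∃ λ z → G x z ≡ true × G z y ≡ true) → 2 * s ≤ deg G x + deg G y
    far {x} {y} ne h = subst (_≤ deg G x + deg G y) (+-identityʳ (2 * s))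
      (shift 0 (<-≤-trans large (≤-trans (m⊓n≤m (b₁ G) (b₃ G)) (b₁-≤ (∧-intro (not-intro (==-false ne)) (near h))))))
      where
      near : (G x y ≡ true ⊎ ∃ λ z → G x z ≡ true × G z y ≡ true) → G x y ∨ any (λ z → G x z ∧ G z y) (allFin n) ≡ true
      near (inj₁ g) = ∨-true₁ g
      near (inj₂ (z , g , k)) = ∨-true₂ (G x y) (any⁺ {p = λ z → G x z ∧ G z y} (∈-allFin z) (∧-intro g k))

    triangles-at : ∀ {k c} → b₃ G ≤ (k ∸ 1 ∸ c) ⊔ (k ∸ 3) → k ≤ 2 * s + 1 → 2 * s + c ≤ k
    triangles-at {k} {c} h le = from (⊔-sel (k ∸ 1 ∸ c) (k ∸ 3))
      where
      bound : 2 * s ∸ 2 < (k ∸ 1 ∸ c) ⊔ (k ∸ 3)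
      bound = <-≤-trans large (≤-trans (m⊓n≤n (b₁ G) (b₃ G)) h)
      from : (k ∸ 1 ∸ c) ⊔ (k ∸ 3) ≡ k ∸ 1 ∸ c ⊎ (k ∸ 1 ∸ c) ⊔ (k ∸ 3) ≡ k ∸ 3 → 2 * s + c ≤ k
      from (inj₁ e) = shift c (subst (2 * s ∸ 2 <_) (trans e (∸-+-assoc k 1 c)) bound)
      -- If the second entry of the maximum were the larger one, `k` would be at least 2s + 2,
      -- against `le`.
      from (inj₂ e) = ⊥-elim (1+n≰n (≤-trans (≤-trans (≤-reflexive (sym (+-suc (2 * s) 1))) (shift 2 (subst (2 * s ∸ 2 <_) e bound))) le))

    triangles : ∀ {x y} → G x y ≡ true → deg G x + deg G y ≤ 2 * s + 1 → 2 * s + commonNbrs G x y ≤ deg G x + deg G y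
    triangles {x} {y} g le with <-cmp (toℕ x) (toℕ y)
    ... | tri< l _ _ = triangles-at (b₃-≤ l g) le
    ... | tri≈ _ e _ = ⊥-elim (G-≢ g (toℕ-injective e))
    ... | tri> _ _ l = subst₂ (λ c k → 2 * s + c ≤ k) (length-filter-cong (allFin n) (λ z → ∧-comm (G y z) (G x z))) (+-comm (deg G y) (deg G x))
      (triangles-at (b₃-≤ l (sym-G g)) (subst (_≤ 2 * s + 1) (+-comm (deg G x) (deg G y)) le))

  nbr-of-degree : ∀ {n} (G : Graph n) → ∀ {s x} → 4 ≤ s → deg G x ≡ s → ∃ λ y → G x y ≡ true
  nbr-of-degree {n} G {x = x} 4≤s e =
    let y , _ , g = ∑-pos-member (allFin n) (G x) (subst (ℤ.1ℤ ℤ.≤_) (length-filter≡∑ (G x) (allFin n))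
          (ℤ.+≤+ (≤-trans (≤-trans (s≤s z≤n) 4≤s) (≤-reflexive (sym e)))))
    in y , g

  module Contradiction {n} (G : Graph n) (simple : Simple G) (conn : Connected G) (R : EmbeddingScheme G) (s : ℕ) (4≤s : 4 ≤ s)
    {x : Fin n} (x-deg : deg G x ≡ s) (hyp : ℤ.- (+ 14) ℤ.* eulerChar R ℤ.< rhs G s) (large : 2 * s ∸ 2 < B′ G) where
    open Graphs G simple
    open LargeB′ G simple s large
    open MaximumIndependent G simple (inV G s)

    x-nbr : ∃ λ y → G x y ≡ true
    x-nbr = nbr-of-degree G 4≤s x-deg

    nbr : ∀ y → ∃ λ z → G y z ≡ true
    nbr y = first (conn y x)
      where
      first : ∀ {y} → Walk G y x → ∃ λ z → G y z ≡ true
      first here = x-nbr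
      first (step g _) = _ , g

    J₀ : Subset n
    J₀ = proj₁ β-attained

    J-good : Good J₀
    J-good = proj₁ (proj₂ β-attained)

    I : Fin n → Bool
    I = lookup J₀

    I-deg : ∀ {y} → I y ≡ true → deg G y ≡ s
    I-deg {y} h = ≡ᵇ-true (deg G y) s (proj₂ J-good h)

    I-maximal : ∀ {y} → deg G y ≡ s → I y ≡ false → ∃ λ z → I z ≡ true × G y z ≡ true
    I-maximal {y} e = maximal J₀ J-good (proj₂ (proj₂ β-attained)) {y} (trans (cong (_≡ᵇ s) e) (≡ᵇ-refl s))

    I-size : ∑ V (𝟙 ∘ I) ≡ + β₀-induced G (inV G s)
    I-size = trans (∑-lookup J₀ (λ y → y) (𝟙 ∘ I) (λ _ → refl)) (cong +_ (proj₂ (proj₂ β-attained)))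

    I-member : ∃ λ y → I y ≡ true
    I-member = from (Bool-cases (I x))
      where
      from : I x ≡ true ⊎ I x ≡ false → ∃ λ y → I y ≡ true
      from (inj₁ h) = x , h
      from (inj₂ h) = let y , i , _ = I-maximal x-deg h in y , i

    module A = Discharging G simple R s 4≤s far triangles nbr I I-deg (proj₁ J-good) I-maximal

    contradiction : ⊥
    contradiction = from (m≤n⇒m<n∨m≡n 4≤s)
      where
      from : 5 ≤ s ⊎ 4 ≡ s → ⊥
      from (inj₁ 5≤s) = below {ℤ.- (+ 14) ℤ.* eulerChar R} {rhs G s} (ℤ.≤-trans (A.large-s 5≤s) (A.total I-size)) (ℤ.i<j⇒suc[i]≤j hyp)
        where
        below : ∀ {c r} → ℤ.0ℤ ℤ.≤ + 12 ℤ.* (c ℤ.- r) → ℤ.1ℤ ℤ.+ c ℤ.≤ r → ⊥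
        below {c} {r} h l = 12≰0 (by {e = + 12 ℤ.* (c ℤ.- r) ℤ.+ + 12 ℤ.* (r ℤ.- (ℤ.1ℤ ℤ.+ c))} (h ⊕ # 12 ⊗ ⌞ l ⌟) (lem c r))
          where
          lem : ∀ c r → ℤ.0ℤ ℤ.- + 12 ≡ + 12 ℤ.* (c ℤ.- r) ℤ.+ + 12 ℤ.* (r ℤ.- (ℤ.1ℤ ℤ.+ c))
          lem = ℤ.solve-∀
          12≰0 : ¬ + 12 ℤ.≤ ℤ.0ℤ
          12≰0 (ℤ.+≤+ ())
      from (inj₂ e) = A.DegreeFour.impossible conn (sym e) (proj₂ I-member) I-size hyp

open Assembly

open import Data.Nat using (_≤_; _*_; _∸_; _≤?_)
open import Data.Nat.Properties using (≰⇒>)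
open import Data.Integer as ℤ using (+_; -_; _<_)

theorem1 : ∀ {n} (G : Graph n) → Simple G → Connected G →
    (R : EmbeddingScheme G) → (s : ℕ) → 4 ≤ s → (∃ λ x → deg G x ≡ s) →
    - (+ 14) ℤ.* eulerChar R < rhs G s →
    bondage G ≤ B′ G × B′ G ≤ 2 * s ∸ 2
theorem1 G simple conn R s 4≤s (x , x-deg) hyp =
  bondage≤B′ (proj₂ (nbr-of-degree G 4≤s x-deg)) , B′≤ (B′ G ≤? 2 * s ∸ 2)
  where
  open Bondage G simple
  B′≤ : Dec (B′ G ≤ 2 * s ∸ 2) → B′ G ≤ 2 * s ∸ 2
  B′≤ (yes h) = h
  B′≤ (no h) = ⊥-elim (Contradiction.contradiction G simple conn R s 4≤s x-deg hyp (≰⇒> h))
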